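{- If $k\geq 2$ is odd then $\mathrm{ex}(n,C_3,\textnormal{rainbow- }C_{2k})=\Omega(n^{1+1/k})$, and if $k\geq 2$ is even then $\mathrm{ex}(n,C_3,\textnormal{rainbow- }C_{2k+1})=\Omega(n^{1+1/k})$. Furthermore, for every integer $k\geq 2$, \[\mathrm{ex}(n,C_3,\textnormal{rainbow- }C_{2k})=O(\mathrm{ex}^*(n,C_{2k})),\] and \begin{align*} \mathrm{ex}(n,C_3,\textnormal{rainbow- }C_{2k})&\geq \mathrm{ex}(n,C_3,C_{2k})=\Omega(\mathrm{ex}(n,\{C_4,C_6,\dots,C_{2k}\})),\\ \mathrm{ex}(n,C_3,\textnormal{rainbow- }C_{2k+1})&\geq \mathrm{ex}(n,C_3,C_{2k+1})=\Omega(\mathrm{ex}(n,\{C_4,C_6,\dots,C_{2k}\})). \end{align*}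
   Context: A proper edge-colouring of a graph assigns colours to edges so that any two edges sharing a vertex receive different colours. A subgraph of an edge-coloured graph is rainbow if all its edges have distinct colours. For graphs $H,F$: $\mathrm{ex}(n,H,\textnormal{rainbow- }F)$ is the maximum number of copies of $H$ in a properly edge-coloured $n$-vertex graph with no rainbow subgraph isomorphic to $F$; $\mathrm{ex}(n,H,F)$ is the maximum number of copies of $H$ in an $n$-vertex graph with no subgraph isomorphic to $F$; $\mathrm{ex}^*(n,F)$ is the maximum number of edges of a properly edge-coloured $n$-vertex graph with no rainbow copy of $F$; for a family $\mathcal F$ of graphs, $\mathrm{ex}(n,\mathcal F)$ is the maximum number of edges in an $n$-vertex graph containing no member of $\mathcal F$ as a subgraph. $C_m$ is the cycle of length $m$. Implied constants may depend on $k$. -}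

module Defs where

open import Data.Nat using (ℕ; zero; suc; _+_; _*_; _^_; _≤_; _<ᵇ_)
open import Data.Bool using (Bool; true; false; _∧_; if_then_else_)
open import Data.Fin using (Fin; toℕ)
open import Data.List using (List; map; allFin)
open import Data.Nat.ListAction using (sum)
open import Data.Product using (Σ; Σ-syntax; _×_)
open import Data.Sum using (_⊎_)
open import Relation.Binary.PropositionalEquality using (_≡_; _≢_)
open import Relation.Nullary using (¬_)
open import Function.Definitions using (Injective)

record Graph (n : ℕ) : Set where
  field
    adj    : Fin n → Fin n → Bool
    sym    : ∀ u v → adj u v ≡ adj v u
    irrefl : ∀ u → adj u u ≡ false

open Graph public

Edge : ∀ {n} → Graph n → Fin n → Fin n → Set
Edge G u v = adj G u v ≡ true

-- A proper edge-colouring of G: colours are natural numbers, the colour of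
-- the edge uv is c u v = c v u (values on non-edges are irrelevant), and two
-- distinct edges sharing a vertex get different colours.
record ProperColouring {n : ℕ} (G : Graph n) : Set where
  field
    col    : Fin n → Fin n → ℕ
    colSym : ∀ u v → col u v ≡ col v u
    proper : ∀ u v w → Edge G u v → Edge G u w → v ≢ w → col u v ≢ col u w

open ProperColouring public

CycAdj : (m : ℕ) → Fin m → Fin m → Set
CycAdj m i j = (suc (toℕ i) ≡ toℕ j) ⊎ ((suc (toℕ i) ≡ m) × (toℕ j ≡ 0))

-- G contains C_m as a subgraph (m ≥ 3 in all uses): an injective map
-- Fin m → V(G) sending consecutive cycle vertices to adjacent vertices.
CycleMap : ∀ {n} → Graph n → (m : ℕ) → (Fin m → Fin n) → Set
CycleMap {n} G m f = Injective _≡_ _≡_ f × (∀ i j → CycAdj m i j → Edge G (f i) (f j))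

HasCycle : ∀ {n} → Graph n → ℕ → Set
HasCycle {n} G m = Σ[ f ∈ (Fin m → Fin n) ] CycleMap G m f

HasRainbowCycle : ∀ {n} (G : Graph n) → ProperColouring G → ℕ → Set
HasRainbowCycle {n} G c m =
  Σ[ f ∈ (Fin m → Fin n) ] (CycleMap G m f ×
    (∀ i j i' j' → CycAdj m i j → CycAdj m i' j' → i ≢ i' →
       col c (f i) (f j) ≢ col c (f i') (f j')))

bit : Bool → ℕ
bit true = 1
bit false = 0

ΣFin : (n : ℕ) → (Fin n → ℕ) → ℕ
ΣFin n f = sum (map f (allFin n))

lt : ∀ {n} → Fin n → Fin n → Bool
lt u v = toℕ u <ᵇ toℕ v

edgeCount : ∀ {n} → Graph n → ℕ
edgeCount {n} G = ΣFin n λ u → ΣFin n λ v → bit (lt u v ∧ adj G u v)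

triangleCount : ∀ {n} → Graph n → ℕ
triangleCount {n} G = ΣFin n λ u → ΣFin n λ v → ΣFin n λ w →
  bit (lt u v ∧ lt v w ∧ adj G u v ∧ adj G v w ∧ adj G u w)

IsMax : (ℕ → Set) → ℕ → Set
IsMax S m = S m × (∀ j → S j → j ≤ m)

TriRainbowFree : ℕ → ℕ → ℕ → Set
TriRainbowFree n m t = Σ[ G ∈ Graph n ] Σ[ c ∈ ProperColouring G ]
  (¬ HasRainbowCycle G c m × triangleCount G ≡ t)

TriFree : ℕ → ℕ → ℕ → Set
TriFree n m t = Σ[ G ∈ Graph n ] (¬ HasCycle G m × triangleCount G ≡ t)

EdgeRainbowFree : ℕ → ℕ → ℕ → Set
EdgeRainbowFree n m e = Σ[ G ∈ Graph n ] Σ[ c ∈ ProperColouring G ]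
  (¬ HasRainbowCycle G c m × edgeCount G ≡ e)

EdgeEvenCyclesFree : ℕ → ℕ → ℕ → Set
EdgeEvenCyclesFree n k e = Σ[ G ∈ Graph n ]
  ((∀ l → 2 ≤ l → l ≤ k → ¬ HasCycle G (2 * l)) × edgeCount G ≡ e)

-- f(n) = Ω(n^{1+1/k}) for the (relationally given) function f:
-- ∃ d, N such that for all n ≥ N, f(n) ≥ n^{1+1/k} / d, i.e. n^{k+1} ≤ d^k f(n)^k.
OmegaPow : (ℕ → ℕ → Set) → ℕ → Set
OmegaPow F k = Σ[ d ∈ ℕ ] Σ[ N ∈ ℕ ] (∀ n → N ≤ n → ∀ m → F n m →
  n ^ (k + 1) ≤ (d ^ k) * (m ^ k))

BigO : (ℕ → ℕ → Set) → (ℕ → ℕ → Set) → Set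
BigO F G = Σ[ C ∈ ℕ ] Σ[ N ∈ ℕ ] (∀ n → N ≤ n → ∀ a b → F n a → G n b → a ≤ C * b)

GeqAll : (ℕ → ℕ → Set) → (ℕ → ℕ → Set) → Set
GeqAll F G = ∀ n a b → F n a → G n b → b ≤ a

exTriRainbow : ℕ → ℕ → ℕ → Set
exTriRainbow m n = IsMax (TriRainbowFree n m)

exTri : ℕ → ℕ → ℕ → Set
exTri m n = IsMax (TriFree n m)

exStar : ℕ → ℕ → ℕ → Set
exStar m n = IsMax (EdgeRainbowFree n m)

exEven : ℕ → ℕ → ℕ → Set
exEven k n = IsMax (EdgeEvenCyclesFree n k)

{-# OPTIONS --safe #-}
module Submission where

-- Constructions. Over a field with p elements the factors 1 - tX lie in a group of p^k truncated
-- power series in which the multiset of factors of a k-fold product can be read off the product. Join two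
-- adjacent copies of a series x to the series x(1 - tX), using a different colour for each pair (t , copy).
-- On a rainbow closed walk each t is then used once forwards and once backwards, at different copies, so
-- exactly k of these edges leave the second copy; the parity of that number is that of the number of edges
-- between the copies, of which a rainbow walk has at most one. Primes p close to any given size come from
-- Chebyshev's argument.
-- Upper bound. If every edge lies in many triangles, a rainbow cycle grows by replacing an edge by two
-- sides of a triangle; so in a graph without a rainbow cycle some edge lies in few triangles, and deleting
-- it inductively bounds the triangles by a multiple of the edges.
-- Even girth. In a bipartite graph without short even cycles, doubling the vertices of one side into
-- adjacent twins yields a triangle for each edge, while every cycle of moderate length stays within one pair
-- of twins and its neighbours and so has length 3 or 4. For C₄ itself, the number of edges of a C₄-free
-- graph is O(n^(3/2)), and the sum graph of the parabola {(t , t²)} has that many triangles.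

open import Defs
open import Data.Nat hiding (parity)
open import Data.Nat.Properties
open import Data.Nat.Divisibility
open import Data.Nat.Primality
open import Data.Nat.Tactic.RingSolver using (solve-∀)
open import Data.Integer as ℤ using (ℤ; 0ℤ; 1ℤ)
import Data.Integer.Properties as ℤ
import Data.Integer.DivMod as ℤ
import Data.Integer.Divisibility.Signed as ℤ
open import Data.Integer.Tactic.RingSolver using () renaming (solve-∀ to solve-∀-ℤ)
open import Data.Nat.Primality.Factorisation using (factorise)
open import Data.Nat.Combinatorics using (_C_; nCk≡n!/k![n-k]!; k![n∸k]!∣n!; nCk+nC[k+1]≡[n+1]C[k+1]; nCk≡nC[n∸k]; nCn≡1)
open import Data.Nat.DivMod using (_%_; m/n*n≡m; m%n<n; m≡m%n+[m/n]*n; [m+kn]%n≡m%n; m<n⇒m%n≡m; n%n≡0)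
open import Data.Nat.ListAction.Properties using (∈⇒∣product)
open import Data.Nat.ListAction using (sum; product)
open import Data.Bool as Bool using (Bool; true; false; _∧_; _∨_; _xor_; not; T)
open import Data.Bool.Properties using (xor-comm; xor-same; ∧-zeroʳ; ∧-comm; ∨-comm; not-involutive)
open import Data.Fin as Fin using (Fin; zero; suc; toℕ; fromℕ<)
open import Data.Fin.Properties as Fin using (toℕ<n; toℕ-injective; toℕ-fromℕ<; any?; all?)
open import Data.List using (List; []; _∷_; _++_; map; allFin; tabulate; length; filter; lookup)
open import Data.List.Properties using (map-tabulate; length-map; map-∘; length-++)
open import Data.List.Relation.Unary.All as All using (All; []; _∷_)
open import Data.List.Relation.Unary.Any as Any using (Any; here; there)
open import Data.List.Relation.Unary.Unique.Propositional using (Unique; []; _∷_)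
open import Data.List.Relation.Unary.Unique.Propositional.Properties using (map⁺; allFin⁺; filter⁺)
open import Data.List.Membership.Propositional using (_∈_; _∉_)
open import Data.List.Membership.Propositional.Properties using (∈-lookup; ∈-filter⁺; ∈-filter⁻; ∈-allFin)
open import Data.List.Relation.Unary.All.Properties using (¬Any⇒All¬) renaming (++⁺ to All-++⁺; map⁺ to All-map⁺)
open import Data.List.Relation.Unary.Any.Properties using () renaming (++⁺ˡ to Any-++⁺ˡ; ++⁺ʳ to Any-++⁺ʳ; map⁺ to Any-map⁺)
open import Data.Product using (Σ-syntax; ∃-syntax; _×_; _,_; proj₁; proj₂)
open import Data.Sum using (_⊎_; inj₁; inj₂; [_,_]′; map₂)
open import Data.Empty using (⊥; ⊥-elim)
open import Data.Unit using (tt)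
open import Function using (_∘_; id; case_of_)
open import Relation.Nullary
open import Relation.Nullary.Decidable as Dec using (_×-dec_; ¬?)
open import Relation.Binary.Definitions using (tri<; tri≈; tri>)
open import Relation.Binary.PropositionalEquality renaming (sym to ≡-sym) hiding ([_])

-- Truncating after X^k is forced from both sides. A rainbow cycle of length 2k or 2k + 1 would use
-- k factors in each direction, and a product of k factors 1 - tX has degree at most k, so a
-- congruence modulo X^(k+1) is an equality of polynomials over a field, where factorisation is
-- unique. Keeping no further coefficients leaves p^k series with p factors each: about p^k vertices
-- and p^(k+1) triangles, hence the exponent 1 + 1/k. The parity obstruction works only if k plus
-- the number of edges between copies is odd, which pairs length 2k with odd k and length 2k + 1
-- with even k. Extremal numbers are relations "m is the maximum", so a lower bound needs a single
-- graph for each large n. The constructions have 3p^k or p² vertices and are completed by isolated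
-- vertices; this is why primes are needed within a constant factor of every size. Doubling one side
-- cannot exclude 4-cycles, since two twins with two common neighbours form one. This is the reason
-- for a separate argument when the forbidden cycle is C₄.

ΣFin-suc : ∀ n (f : Fin (suc n) → ℕ) → ΣFin (suc n) f ≡ f zero + ΣFin n (f ∘ suc)
ΣFin-suc n f = cong (λ l → f zero + sum l)
  (trans (map-tabulate suc f) (≡-sym (map-tabulate id (f ∘ suc))))

ΣFin-mono : ∀ n {f g : Fin n → ℕ} → (∀ i → f i ≤ g i) → ΣFin n f ≤ ΣFin n g
ΣFin-mono zero f≤g = z≤n
ΣFin-mono (suc n) {f} {g} f≤g rewrite ΣFin-suc n f | ΣFin-suc n g =
  +-mono-≤ (f≤g zero) (ΣFin-mono n (f≤g ∘ suc))

ΣFin-cong : ∀ n {f g : Fin n → ℕ} → (∀ i → f i ≡ g i) → ΣFin n f ≡ ΣFin n g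
ΣFin-cong n f≡g = ≤-antisym (ΣFin-mono n (≤-reflexive ∘ f≡g)) (ΣFin-mono n (≤-reflexive ∘ ≡-sym ∘ f≡g))

ΣFin-+ : ∀ n (f g : Fin n → ℕ) → ΣFin n (λ i → f i + g i) ≡ ΣFin n f + ΣFin n g
ΣFin-+ zero f g = refl
ΣFin-+ (suc n) f g
  rewrite ΣFin-suc n (λ i → f i + g i) | ΣFin-suc n f | ΣFin-suc n g | ΣFin-+ n (f ∘ suc) (g ∘ suc) =
  +-+-exchange (f zero) (g zero) (ΣFin n (f ∘ suc)) (ΣFin n (g ∘ suc))
  where
  +-+-exchange : ∀ a b c d → a + b + (c + d) ≡ a + c + (b + d)
  +-+-exchange = solve-∀

ΣFin-*ˡ : ∀ n c (f : Fin n → ℕ) → ΣFin n (λ i → c * f i) ≡ c * ΣFin n f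
ΣFin-*ˡ zero c f = ≡-sym (*-zeroʳ c)
ΣFin-*ˡ (suc n) c f
  rewrite ΣFin-suc n (λ i → c * f i) | ΣFin-suc n f | ΣFin-*ˡ n c (f ∘ suc) =
  ≡-sym (*-distribˡ-+ c (f zero) (ΣFin n (f ∘ suc)))

ΣFin-const : ∀ n c → ΣFin n (λ _ → c) ≡ n * c
ΣFin-const zero c = refl
ΣFin-const (suc n) c rewrite ΣFin-suc n (λ _ → c) = cong (c +_) (ΣFin-const n c)

ΣFin-≤-const : ∀ n {f : Fin n → ℕ} c → (∀ i → f i ≤ c) → ΣFin n f ≤ n * c
ΣFin-≤-const n c f≤c = subst (_ ≤_) (ΣFin-const n c) (ΣFin-mono n f≤c)

ΣFin-swap : ∀ m n (f : Fin m → Fin n → ℕ) →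
  ΣFin m (λ i → ΣFin n (f i)) ≡ ΣFin n (λ j → ΣFin m (λ i → f i j))
ΣFin-swap zero n f = ≡-sym (trans (ΣFin-const n 0) (*-zeroʳ n))
ΣFin-swap (suc m) n f = begin
  ΣFin (suc m) (λ i → ΣFin n (f i))
    ≡⟨ ΣFin-suc m (λ i → ΣFin n (f i)) ⟩
  ΣFin n (f zero) + ΣFin m (λ i → ΣFin n (f (suc i)))
    ≡⟨ cong (ΣFin n (f zero) +_) (ΣFin-swap m n (f ∘ suc)) ⟩
  ΣFin n (f zero) + ΣFin n (λ j → ΣFin m (λ i → f (suc i) j))
    ≡⟨ ΣFin-+ n (f zero) _ ⟨
  ΣFin n (λ j → f zero j + ΣFin m (λ i → f (suc i) j))
    ≡⟨ ΣFin-cong n (λ j → ΣFin-suc m (λ i → f i j)) ⟨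
  ΣFin n (λ j → ΣFin (suc m) (λ i → f i j)) ∎
  where open ≡-Reasoning

ΣFin-≥-term : ∀ n (f : Fin n → ℕ) i → f i ≤ ΣFin n f
ΣFin-≥-term (suc n) f zero rewrite ΣFin-suc n f = m≤m+n _ _
ΣFin-≥-term (suc n) f (suc i) rewrite ΣFin-suc n f =
  ≤-trans (ΣFin-≥-term n (f ∘ suc) i) (m≤n+m _ (f zero))

bit-≤1 : ∀ b → bit b ≤ 1
bit-≤1 true = ≤-refl
bit-≤1 false = z≤n

-- Sums over lists without repetition

module _ {n : ℕ} where

  eqBit : Fin n → Fin n → ℕ
  eqBit x i = bit ⌊ i Fin.≟ x ⌋

  ΣFin-eqBit-≤ : ∀ x → ΣFin n (eqBit x) ≤ 1
  ΣFin-eqBit-≤ = go n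
    where
    go : ∀ n (x : Fin n) → ΣFin n (λ i → bit ⌊ i Fin.≟ x ⌋) ≤ 1
    go (suc n) zero rewrite ΣFin-suc n (λ i → bit ⌊ i Fin.≟ zero ⌋) | ΣFin-const n 0 | *-zeroʳ n = ≤-refl
    go (suc n) (suc x) rewrite ΣFin-suc n (λ i → bit ⌊ i Fin.≟ suc x ⌋) =
      ≤-trans (ΣFin-mono n λ i → ≤-reflexive (peel i)) (go n x)
      where
      peel : ∀ i → bit ⌊ suc i Fin.≟ suc x ⌋ ≡ bit ⌊ i Fin.≟ x ⌋
      peel i with i Fin.≟ x
      ... | yes _ = refl
      ... | no  _ = refl

  countIn : List (Fin n) → Fin n → ℕ
  countIn xs i = sum (map (λ x → eqBit x i) xs)

  countIn-∉ : ∀ {xs i} → i ∉ xs → countIn xs i ≡ 0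
  countIn-∉ {[]} _ = refl
  countIn-∉ {x ∷ xs} {i} i∉ with i Fin.≟ x
  ... | yes i≡x = ⊥-elim (i∉ (here i≡x))
  ... | no  _   = countIn-∉ (i∉ ∘ there)

  countIn-unique : ∀ {xs} → Unique xs → ∀ i → countIn xs i ≤ 1
  countIn-unique [] i = z≤n
  countIn-unique {x ∷ xs} (x∉ ∷ u) i with i Fin.≟ x
  ... | yes refl = ≤-reflexive (cong suc (countIn-∉ λ i∈ → All.lookup x∉ i∈ refl))
  ... | no  _    = countIn-unique u i

  eqBit-refl : ∀ x → eqBit x x ≡ 1
  eqBit-refl x with x Fin.≟ x
  ... | yes _  = refl
  ... | no x≢x = ⊥-elim (x≢x refl)

  sum-≤-ΣFin-countIn : ∀ xs (f : Fin n → ℕ) → sum (map f xs) ≤ ΣFin n (λ i → countIn xs i * f i)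
  sum-≤-ΣFin-countIn [] f = z≤n
  sum-≤-ΣFin-countIn (x ∷ xs) f = begin
    f x + sum (map f xs)
      ≤⟨ +-mono-≤ head-≤ (sum-≤-ΣFin-countIn xs f) ⟩
    ΣFin n (λ i → eqBit x i * f i) + ΣFin n (λ i → countIn xs i * f i)
      ≡⟨ ΣFin-+ n (λ i → eqBit x i * f i) (λ i → countIn xs i * f i) ⟨
    ΣFin n (λ i → eqBit x i * f i + countIn xs i * f i)
      ≡⟨ ΣFin-cong n (λ i → *-distribʳ-+ (f i) (eqBit x i) (countIn xs i)) ⟨
    ΣFin n (λ i → countIn (x ∷ xs) i * f i) ∎
    where
    open ≤-Reasoning
    head-≤ : f x ≤ ΣFin n (λ i → eqBit x i * f i)
    head-≤ = ≤-trans (≤-reflexive (≡-sym (trans (cong (_* f x) (eqBit-refl x)) (+-identityʳ _))))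
      (ΣFin-≥-term n (λ i → eqBit x i * f i) x)

  sum-unique-≤-ΣFin : ∀ {xs} → Unique xs → (f : Fin n → ℕ) → sum (map f xs) ≤ ΣFin n f
  sum-unique-≤-ΣFin {xs} u f = ≤-trans (sum-≤-ΣFin-countIn xs f)
    (ΣFin-mono n λ i → ≤-trans (*-monoˡ-≤ (f i) (countIn-unique u i)) (≤-reflexive (+-identityʳ _)))

-- The image of an injection is a list without repetition, so its sum is part of the full sum. Lower
-- bounds on triangle counts select subfamilies of triples in this way.
ΣFin-injection : ∀ m n (ι : Fin m → Fin n) → (∀ {i j} → ι i ≡ ι j → i ≡ j) →
  (f : Fin n → ℕ) → ΣFin m (f ∘ ι) ≤ ΣFin n f
ΣFin-injection m n ι inj f = subst (_≤ ΣFin n f)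
  (cong sum (≡-sym (map-∘ (allFin m))))
  (sum-unique-≤-ΣFin (map⁺ inj (allFin⁺ m)) f)

-- Chebyshev: primes in short multiplicative intervals

choose-factorial : ∀ i j → ((i + j) C i) * (i ! * j !) ≡ (i + j) !
choose-factorial i j = begin
  ((i + j) C i) * (i ! * j !)
    ≡⟨ cong (λ x → ((i + j) C i) * (i ! * x !)) (m+n∸m≡n i j) ⟨
  ((i + j) C i) * (i ! * (i + j ∸ i) !)
    ≡⟨ cong (_* (i ! * (i + j ∸ i) !)) (nCk≡n!/k![n-k]! (m≤m+n i j)) ⟩
  ((i + j) ! / (i ! * (i + j ∸ i) !)) * (i ! * (i + j ∸ i) !)
    ≡⟨ m/n*n≡m (k![n∸k]!∣n! (m≤m+n i j)) ⟩
  (i + j) ! ∎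
  where
  open ≡-Reasoning
  instance _ = i !* (i + j ∸ i) !≢0

choose-≤-2^ : ∀ n k → n C k ≤ 2 ^ n
choose-≤-2^ zero zero = ≤-refl
choose-≤-2^ zero (suc k) = z≤n
choose-≤-2^ (suc n) zero = m^n>0 2 (suc n)
choose-≤-2^ (suc n) (suc k) = begin
  suc n C suc k       ≡⟨ nCk+nC[k+1]≡[n+1]C[k+1] n k ⟨
  n C k + n C suc k   ≤⟨ +-mono-≤ (choose-≤-2^ n k) (choose-≤-2^ n (suc k)) ⟩
  2 ^ n + 2 ^ n       ≡⟨ cong (2 ^ n +_) (+-identityʳ (2 ^ n)) ⟨
  2 ^ suc n           ∎
  where open ≤-Reasoning

-- The two Pascal parents of the next central coefficient are equal by symmetry, and each is at
-- least the present central coefficient; so the value at least doubles.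
central-choose-≥-2^ : ∀ h → 2 ^ h ≤ (h + h) C h
central-choose-≥-2^ zero = ≤-refl
central-choose-≥-2^ (suc h) = begin
  2 ^ suc h
    ≡⟨ cong (2 ^ h +_) (+-identityʳ (2 ^ h)) ⟩
  2 ^ h + 2 ^ h
    ≤⟨ +-mono-≤ left right ⟩
  (suc (h + h)) C h + (suc (h + h)) C suc h
    ≡⟨ nCk+nC[k+1]≡[n+1]C[k+1] (suc (h + h)) h ⟩
  (suc (suc (h + h))) C suc h
    ≡⟨ cong (λ x → suc x C suc h) (≡-sym (+-suc h h)) ⟩
  (suc h + suc h) C suc h ∎
  where
  open ≤-Reasoning
  right : 2 ^ h ≤ (suc (h + h)) C suc h
  right = ≤-trans (central-choose-≥-2^ h)
    (≤-trans (m≤m+n _ ((h + h) C suc h)) (≤-reflexive (nCk+nC[k+1]≡[n+1]C[k+1] (h + h) h)))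
  left : 2 ^ h ≤ (suc (h + h)) C h
  left = ≤-trans right (≤-reflexive (≡-sym (trans (nCk≡nC[n∸k] (m≤n⇒m≤1+n (m≤m+n h h)))
    (cong (suc (h + h) C_) (trans (+-∸-assoc 1 (m≤m+n h h)) (cong suc (m+n∸m≡n h h)))))))

-- The reciprocal of the Beta integral of x^i (1 - x)^j over [0 , 1].
leibniz : ℕ → ℕ → ℕ
leibniz i j = suc (i + j) * ((i + j) C i)

leibniz-factorial : ∀ i j → leibniz i j * (i ! * j !) ≡ suc (i + j) !
leibniz-factorial i j =
  trans (*-assoc (suc (i + j)) ((i + j) C i) _) (cong (suc (i + j) *_) (choose-factorial i j))

module _ (i j : ℕ) where

  private instance _ = i !* j !≢0

  leibniz-sucʳ : leibniz i (suc j) * suc j ≡ (2 + (i + j)) * leibniz i j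
  leibniz-sucʳ = *-cancelʳ-≡ _ _ (i ! * j !) (begin
    leibniz i (suc j) * suc j * (i ! * j !)     ≡⟨ regroup (leibniz i (suc j)) (suc j) (i !) (j !) ⟩
    leibniz i (suc j) * (i ! * (suc j * j !))   ≡⟨ leibniz-factorial i (suc j) ⟩
    suc (i + suc j) !                           ≡⟨ cong (λ x → suc x !) (+-suc i j) ⟩
    (2 + (i + j)) * suc (i + j) !               ≡⟨ cong ((2 + (i + j)) *_) (leibniz-factorial i j) ⟨
    (2 + (i + j)) * (leibniz i j * (i ! * j !)) ≡⟨ *-assoc (2 + (i + j)) (leibniz i j) _ ⟨
    (2 + (i + j)) * leibniz i j * (i ! * j !)   ∎)
    where
    open ≡-Reasoning
    regroup : ∀ a b c d → a * b * (c * d) ≡ a * (c * (b * d))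
    regroup = solve-∀

  leibniz-sucˡ : leibniz (suc i) j * suc i ≡ (2 + (i + j)) * leibniz i j
  leibniz-sucˡ = *-cancelʳ-≡ _ _ (i ! * j !) (begin
    leibniz (suc i) j * suc i * (i ! * j !)     ≡⟨ regroup (leibniz (suc i) j) (suc i) (i !) (j !) ⟩
    leibniz (suc i) j * (suc i * i ! * j !)     ≡⟨ leibniz-factorial (suc i) j ⟩
    (2 + (i + j)) * suc (i + j) !               ≡⟨ cong ((2 + (i + j)) *_) (leibniz-factorial i j) ⟨
    (2 + (i + j)) * (leibniz i j * (i ! * j !)) ≡⟨ *-assoc (2 + (i + j)) (leibniz i j) _ ⟨
    (2 + (i + j)) * leibniz i j * (i ! * j !)   ∎)
    where
    open ≡-Reasoning
    regroup : ∀ a b c d → a * b * (c * d) ≡ a * (b * c * d)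
    regroup = solve-∀

-- Leibniz's harmonic triangle: 1/leibniz i (1+j) = 1/leibniz i j − 1/leibniz (1+i) j,
-- and 1/leibniz i 0 = 1/(1+i).
leibniz∣ : ∀ {L N} → (∀ i → i < N → suc i ∣ L) → ∀ j i → i + j < N → leibniz i j ∣ L
leibniz∣ {L} divides-L zero i i<N = subst (_∣ L)
  (≡-sym (trans (cong₂ _*_ (cong suc (+-identityʳ i)) (trans (cong (_C i) (+-identityʳ i)) (nCn≡1 i)))
    (*-identityʳ (suc i))))
  (divides-L i (subst (_< _) (+-identityʳ i) i<N))
leibniz∣ {L} {N} divides-L (suc j) i i+j<N
  with leibniz∣ divides-L j i (<-trans (+-monoʳ-< i (n<1+n j)) i+j<N)
     | leibniz∣ divides-L j (suc i) (subst (_< N) (+-suc i j) i+j<N)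
... | divides q₁ L≡q₁ | divides q₂ L≡q₂ =
  ∣m+n∣m⇒∣n (divides q₁ q₂W+L≡q₁W) (n∣m*n q₂)
  where
  open ≡-Reasoning
  W = leibniz i (suc j)
  regroup : ∀ q w s → q * w * s ≡ q * (w * s)
  regroup = solve-∀
  split : ∀ L i j → (2 + (i + j)) * L ≡ suc i * L + L * suc j
  split = solve-∀
  swap₃ : ∀ q m w → q * (m * w) ≡ m * (q * w)
  swap₃ = solve-∀
  swap₃′ : ∀ s q w → s * (q * w) ≡ q * (w * s)
  swap₃′ = solve-∀
  -- The recurrence for reciprocals multiplied by L reads L/W = q₁ - q₂; the additive form avoids
  -- subtraction in ℕ.
  q₂W+L≡q₁W : q₂ * W + L ≡ q₁ * W
  q₂W+L≡q₁W = *-cancelʳ-≡ _ _ (suc j) (begin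
    (q₂ * W + L) * suc j
      ≡⟨ *-distribʳ-+ (suc j) (q₂ * W) L ⟩
    q₂ * W * suc j + L * suc j
      ≡⟨ cong (_+ L * suc j) (trans (regroup q₂ W (suc j))
           (cong (q₂ *_) (trans (leibniz-sucʳ i j) (≡-sym (leibniz-sucˡ i j))))) ⟩
    q₂ * (leibniz (suc i) j * suc i) + L * suc j
      ≡⟨ cong (_+ L * suc j) (swap₃′ (suc i) q₂ (leibniz (suc i) j)) ⟨
    suc i * (q₂ * leibniz (suc i) j) + L * suc j
      ≡⟨ cong (λ x → suc i * x + L * suc j) L≡q₂ ⟨
    suc i * L + L * suc j
      ≡⟨ split L i j ⟨
    (2 + (i + j)) * L
      ≡⟨ cong ((2 + (i + j)) *_) L≡q₁ ⟩
    (2 + (i + j)) * (q₁ * leibniz i j)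
      ≡⟨ swap₃ q₁ (2 + (i + j)) (leibniz i j) ⟨
    q₁ * ((2 + (i + j)) * leibniz i j)
      ≡⟨ cong (q₁ *_) (leibniz-sucʳ i j) ⟨
    q₁ * (W * suc j)
      ≡⟨ regroup q₁ W (suc j) ⟨
    q₁ * W * suc j ∎)

prime∤⇒*∣ : ∀ {p a X} → Prime p → p ∤ a → a ∣ X → p ∣ X → p * a ∣ X
prime∤⇒*∣ {p} {a} pp p∤a (divides c refl) p∣X with euclidsLemma c a pp p∣X
... | inj₁ p∣c = *-monoˡ-∣ a p∣c
... | inj₂ p∣a = ⊥-elim (p∤a p∣a)

-- Runs over the half-open interval (m , m + j], so that adjacent intervals multiply; `primesIn 0 n`
-- is the primorial of n.
primesIn : ℕ → ℕ → ℕ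
primesIn m zero = 1
primesIn m (suc j) with prime? (suc (m + j))
... | yes _ = suc (m + j) * primesIn m j
... | no  _ = primesIn m j

primesIn≢0 : ∀ m j → NonZero (primesIn m j)
primesIn≢0 m zero = _
primesIn≢0 m (suc j) with prime? (suc (m + j))
... | yes _ = m*n≢0 (suc (m + j)) (primesIn m j) {{_}} {{primesIn≢0 m j}}
... | no  _ = primesIn≢0 m j

prime∣primesIn⇒≤ : ∀ {p} m j → Prime p → p ∣ primesIn m j → p ≤ m + j
prime∣primesIn⇒≤ m zero pp p∣1 = ⊥-elim (¬prime[1] (subst Prime (∣1⇒≡1 p∣1) pp))
prime∣primesIn⇒≤ m (suc j) pp p∣ rewrite +-suc m j with prime? (suc (m + j))
... | no  _ = m≤n⇒m≤1+n (prime∣primesIn⇒≤ m j pp p∣)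
... | yes _ with euclidsLemma (suc (m + j)) _ pp p∣
...   | inj₁ p∣q = ∣⇒≤ p∣q
...   | inj₂ p∣Π = m≤n⇒m≤1+n (prime∣primesIn⇒≤ m j pp p∣Π)

primesIn∣ : ∀ {X} m j → (∀ {p} → Prime p → m < p → p ≤ m + j → p ∣ X) → primesIn m j ∣ X
primesIn∣ m zero _ = 1∣ _
primesIn∣ m (suc j) h rewrite +-suc m j with prime? (suc (m + j))
... | no  _ = primesIn∣ m j λ pp m<p p≤ → h pp m<p (m≤n⇒m≤1+n p≤)
... | yes pp = prime∤⇒*∣ pp
  (λ p∣ → <-irrefl refl (prime∣primesIn⇒≤ m j pp p∣))
  (primesIn∣ m j λ pp m<p p≤ → h pp m<p (m≤n⇒m≤1+n p≤))
  (h pp (s≤s (m≤m+n m j)) ≤-refl)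

∣primesIn : ∀ {p} m j → Prime p → m < p → p ≤ m + j → p ∣ primesIn m j
∣primesIn m zero pp m<p p≤m rewrite +-identityʳ m = ⊥-elim (<⇒≱ m<p p≤m)
∣primesIn {p} m (suc j) pp m<p p≤ rewrite +-suc m j with prime? (suc (m + j)) | p ≟ suc (m + j)
... | yes _  | yes refl = m∣m*n _
... | no ¬pp | yes refl = ⊥-elim (¬pp pp)
... | yes _  | no p≢ = ∣n⇒∣m*n (suc (m + j)) (∣primesIn m j pp m<p (≤-pred (≤∧≢⇒< p≤ p≢)))
... | no  _  | no p≢ = ∣primesIn m j pp m<p (≤-pred (≤∧≢⇒< p≤ p≢))

primesIn-+ : ∀ m j → primesIn 0 (m + j) ≡ primesIn m j * primesIn 0 m
primesIn-+ m zero rewrite +-identityʳ m | +-identityʳ (primesIn 0 m) = refl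
primesIn-+ m (suc j) rewrite +-suc m j with prime? (suc (m + j))
... | no  _ = primesIn-+ m j
... | yes _ = trans (cong (suc (m + j) *_) (primesIn-+ m j))
  (≡-sym (*-assoc (suc (m + j)) (primesIn m j) (primesIn 0 m)))

prime∤! : ∀ {p} m → Prime p → m < p → p ∤ m !
prime∤! zero pp _ p∣1 = ¬prime[1] (subst Prime (∣1⇒≡1 p∣1) pp)
prime∤! (suc m) pp m<p p∣ with euclidsLemma (suc m) (m !) pp p∣
... | inj₁ p∣m = <⇒≱ m<p (∣⇒≤ p∣m)
... | inj₂ p∣! = prime∤! m pp (<-trans (n<1+n m) m<p) p∣!

prime∣! : ∀ {p m} → Prime p → p ≤ m → p ∣ m !
prime∣! {suc p} _ p≤m = ∣-trans (m∣m*n (p !)) (m≤n⇒m!∣n! p≤m)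
prime∣! {zero} pp _ = ⊥-elim (¬prime[0] pp)

-- A prime in (m , 2m] divides (2m)! but not m!, hence it divides the central binomial coefficient,
-- which is at most 4^m.
primesIn-double-≤ : ∀ m → primesIn m m ≤ 4 ^ m
primesIn-double-≤ m = begin
  primesIn m m   ≤⟨ ∣⇒≤ (primesIn∣ m m p∣C) ⟩
  (m + m) C m    ≤⟨ choose-≤-2^ (m + m) m ⟩
  2 ^ (m + m)    ≡⟨ cong (2 ^_) (cong (m +_) (+-identityʳ m)) ⟨
  2 ^ (2 * m)    ≡⟨ ^-*-assoc 2 2 m ⟨
  4 ^ m          ∎
  where
  open ≤-Reasoning
  instance
    C≢0 : NonZero ((m + m) C m)
    C≢0 = >-nonZero (≤-trans (m^n>0 2 m) (central-choose-≥-2^ m))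
  p∣C : ∀ {p} → Prime p → m < p → p ≤ m + m → p ∣ (m + m) C m
  p∣C pp m<p p≤ with euclidsLemma ((m + m) C m) (m ! * m !) pp
    (subst (_ ∣_) (≡-sym (choose-factorial m m)) (prime∣! pp p≤))
  ... | inj₁ p∣ = p∣
  ... | inj₂ p∣!! with euclidsLemma (m !) (m !) pp p∣!!
  ...   | inj₁ p∣! = ⊥-elim (prime∤! m pp m<p p∣!)
  ...   | inj₂ p∣! = ⊥-elim (prime∤! m pp m<p p∣!)

-- The block (m , 2m] costs 4^m and the induction hypothesis another 4^m. Powers of two suffice,
-- because `prime-between` uses the bound at 2^(1 + 2b).
primorial-2^-≤ : ∀ a → primesIn 0 (2 ^ a) ≤ 4 ^ (2 ^ a)
primorial-2^-≤ zero = s≤s z≤n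
primorial-2^-≤ (suc a) = begin
  primesIn 0 (2 * 2 ^ a)                     ≡⟨ cong (λ x → primesIn 0 (2 ^ a + x)) (+-identityʳ (2 ^ a)) ⟩
  primesIn 0 (2 ^ a + 2 ^ a)                 ≡⟨ primesIn-+ (2 ^ a) (2 ^ a) ⟩
  primesIn (2 ^ a) (2 ^ a) * primesIn 0 (2 ^ a)
                                             ≤⟨ *-mono-≤ (primesIn-double-≤ (2 ^ a)) (primorial-2^-≤ a) ⟩
  4 ^ (2 ^ a) * 4 ^ (2 ^ a)                  ≡⟨ ^-distribˡ-+-* 4 (2 ^ a) (2 ^ a) ⟨
  4 ^ (2 ^ a + 2 ^ a)                        ≡⟨ cong (λ x → 4 ^ (2 ^ a + x)) (+-identityʳ (2 ^ a)) ⟨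
  4 ^ (2 * 2 ^ a)                            ∎
  where open ≤-Reasoning

-- A prime that already divides `s` moves together with its copy into the square part; any other
-- prime joins `s`. So the primes of `s` are distinct divisors of P, and their product divides P.
product-squarefree-split : ∀ {P} ps → All Prime ps → All (_∣ P) ps →
  ∃[ s ] ∃[ t ] (product ps ≡ s * (t * t) × s ∣ P)
product-squarefree-split [] _ _ = 1 , 1 , refl , 1∣ _
product-squarefree-split (p ∷ ps) (pp ∷ pps) (p∣P ∷ ps∣P)
  with product-squarefree-split ps pps ps∣P
... | s , t , eq , s∣P with p ∣? s
... | no p∤s = p * s , t , trans (cong (p *_) eq) (≡-sym (*-assoc p s (t * t))) , prime∤⇒*∣ pp p∤s s∣P p∣P
... | yes (divides s′ refl) =
  s′ , p * t , trans (cong (p *_) eq) (regroup p s′ t) , ∣-trans (m∣m*n p) s∣P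
  where
  regroup : ∀ p s t → p * (s * p * (t * t)) ≡ s * (p * t * (p * t))
  regroup = solve-∀

-- Writing i = s t² with s squarefree, s divides the product of the primes and t divides r!.
∣primes*!² : ∀ {P r} → (∀ {p} → Prime p → p ≤ r * r → p ∣ P) →
  ∀ i → i < r * r → suc i ∣ P * (r ! * r !)
∣primes*!² {P} {r} allPrimes i i<N
  with factorise (suc i)
... | record { factors = ps ; isFactorisation = i≡Π ; factorsPrime = pps }
  with product-squarefree-split {P} ps pps (All.tabulate λ {p} p∈ → allPrimes (All.lookup pps p∈)
    (≤-trans (∣⇒≤ (subst (p ∣_) (≡-sym i≡Π) (∈⇒∣product p∈))) i<N))
... | s , t , eq , s∣P = subst (_∣ P * (r ! * r !)) (≡-sym i≡st²)
  (*-pres-∣ s∣P (*-pres-∣ t∣r! t∣r!))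
  where
  i≡st² : suc i ≡ s * (t * t)
  i≡st² = trans i≡Π eq
  t≢0 : t ≢ 0
  t≢0 refl with () ← trans i≡st² (*-zeroʳ s)
  t²≤N : t * t ≤ r * r
  t²≤N = ≤-trans (∣⇒≤ (subst (t * t ∣_) (≡-sym i≡st²) (n∣m*n s))) i<N
  t≤r : t ≤ r
  t≤r = ≮⇒≥ λ r<t → <⇒≱ (*-mono-< r<t r<t) t²≤N
  divides! : ∀ {t r} → t ≢ 0 → t ≤ r → t ∣ r !
  divides! {zero} t≢0 _ = ⊥-elim (t≢0 refl)
  divides! {suc t} _ t≤r = ∣-trans (m∣m*n (t !)) (m≤n⇒m!∣n! t≤r)
  t∣r! : t ∣ r !
  t∣r! = divides! t≢0 t≤r

!-≤-^ : ∀ n → n ! ≤ n ^ n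
!-≤-^ zero = ≤-refl
!-≤-^ (suc n) = *-monoʳ-≤ (suc n) (≤-trans (!-≤-^ n) (^-monoˡ-≤ n (n≤1+n n)))

-- In `prime-between` the factor (4q)!² is at most 2^(2(4b + 8)q); with q = 2^b this makes it at
-- most 2^(2q²). The inequality still fails at b = 4.
4b+8<2^b : ∀ b → 5 ≤ b → 4 * b + 8 < 2 ^ b
4b+8<2^b b 5≤b with ≤⇒≤′ 5≤b
... | ≤′-refl = ≤ᵇ⇒≤ 29 32 tt
... | ≤′-step {n = b} 5≤′b = begin-strict
  4 * suc b + 8        ≡⟨ rearr b ⟩
  4 * b + 8 + 4        <⟨ +-mono-<-≤ ih (≤-trans (m≤n+m 4 (4 * b + 4)) (≤-trans (≤-reflexive (rearr₂ b)) (<⇒≤ ih))) ⟩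
  2 ^ b + 2 ^ b        ≡⟨ cong (2 ^ b +_) (+-identityʳ (2 ^ b)) ⟨
  2 ^ suc b            ∎
  where
  open ≤-Reasoning
  ih = 4b+8<2^b b (≤′⇒≤ 5≤′b)
  rearr : ∀ b → 4 * suc b + 8 ≡ 4 * b + 8 + 4
  rearr = solve-∀
  rearr₂ : ∀ b → 4 * b + 4 + 4 ≡ 4 * b + 8
  rearr₂ = solve-∀

-- Without a prime in (2q² , 16q²], the number L = P (4q)!², where P is the primorial of 2q², is a
-- common multiple of 1, ..., 16q². Then a central entry of the harmonic triangle divides L, so L ≥
-- 2^(7q²). But P ≤ 2^(4q²) and (4q)!² ≤ 2^(2q²).
prime-between : ∀ b → 5 ≤ b → ∃[ p ] (Prime p × 2 * (2 ^ b * 2 ^ b) < p × p ≤ 16 * (2 ^ b * 2 ^ b))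
prime-between b 5≤b
  with anyUpTo? (λ p → prime? p ×-dec (2 * (2 ^ b * 2 ^ b) <? p)) (suc (16 * (2 ^ b * 2 ^ b)))
... | yes (p , p≤ , pp , <p) = p , pp , <p , ≤-pred p≤
... | no none = ⊥-elim (<⇒≱ L<2^7qq 2^7qq≤L)
  where
  q = 2 ^ b
  n = 2 * (q * q)
  r = 4 * q
  P = primesIn 0 n
  L = P * (r ! * r !)

  rr≡16qq : r * r ≡ 16 * (q * q)
  rr≡16qq = lemma q where
    lemma : ∀ q → 4 * q * (4 * q) ≡ 16 * (q * q)
    lemma = solve-∀

  allPrimes : ∀ {p} → Prime p → p ≤ r * r → p ∣ P
  allPrimes {p} pp p≤ with n <? p
  ... | yes n<p = ⊥-elim (none (p , s≤s (subst (p ≤_) rr≡16qq p≤) , pp , n<p))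
  ... | no  n≮p = ∣primesIn 0 n pp (>-nonZero⁻¹ p {{prime⇒nonZero pp}}) (≮⇒≥ n≮p)

  q>0 : 0 < q
  q>0 = m^n>0 2 b

  14qq<rr : 7 * (q * q) + 7 * (q * q) < r * r
  14qq<rr = subst₂ _<_ (lemma q) (≡-sym rr≡16qq)
    (*-monoˡ-< (q * q) {{>-nonZero (*-mono-< q>0 q>0)}} (≤ᵇ⇒≤ 15 16 tt))
    where
    lemma : ∀ q → 14 * (q * q) ≡ 7 * (q * q) + 7 * (q * q)
    lemma = solve-∀

  instance
    L≢0 : NonZero L
    L≢0 = m*n≢0 P (r ! * r !) {{primesIn≢0 0 n}} {{r !* r !≢0}}

  2^7qq≤L : 2 ^ (7 * (q * q)) ≤ L
  2^7qq≤L = ≤-trans (central-choose-≥-2^ (7 * (q * q)))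
    (∣⇒≤ (m*n∣⇒n∣ (suc (7 * (q * q) + 7 * (q * q))) _
      (leibniz∣ (∣primes*!² {P} {r} allPrimes) (7 * (q * q)) (7 * (q * q)) 14qq<rr)))

  r≡2^ : r ≡ 2 ^ (2 + b)
  r≡2^ = ≡-sym (^-distribˡ-+-* 2 2 b)

  r!≤ : r ! ≤ 2 ^ ((2 + b) * r)
  r!≤ = ≤-trans (!-≤-^ r) (≤-reflexive (trans (cong (_^ r) r≡2^) (^-*-assoc 2 (2 + b) r)))

  P≤ : P ≤ 2 ^ (2 * n)
  P≤ = ≤-trans (subst (λ x → primesIn 0 x ≤ 4 ^ x) 2^≡n (primorial-2^-≤ (1 + (b + b))))
    (≤-reflexive (^-*-assoc 2 2 n))
    where
    2^≡n : 2 ^ (1 + (b + b)) ≡ n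
    2^≡n = cong (2 *_) (^-distribˡ-+-* 2 b b)

  exponent : 2 * n + ((2 + b) * r + (2 + b) * r) < 7 * (q * q)
  exponent = begin-strict
    2 * n + ((2 + b) * r + (2 + b) * r)  ≡⟨ lemma₁ b q ⟩
    4 * (q * q) + 2 * ((4 * b + 8) * q)  ≤⟨ +-monoʳ-≤ (4 * (q * q)) (*-monoʳ-≤ 2 (*-monoˡ-≤ q (<⇒≤ (4b+8<2^b b 5≤b)))) ⟩
    4 * (q * q) + 2 * (q * q)            ≡⟨ *-distribʳ-+ (q * q) 4 2 ⟨
    6 * (q * q)                          <⟨ *-monoˡ-< (q * q) {{>-nonZero (*-mono-< q>0 q>0)}} (n<1+n 6) ⟩
    7 * (q * q)                          ∎
    where
    open ≤-Reasoning
    lemma₁ : ∀ b q → 2 * (2 * (q * q)) + ((2 + b) * (4 * q) + (2 + b) * (4 * q)) ≡ 4 * (q * q) + 2 * ((4 * b + 8) * q)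
    lemma₁ = solve-∀

  L<2^7qq : L < 2 ^ (7 * (q * q))
  L<2^7qq = begin-strict
    P * (r ! * r !)
      ≤⟨ *-mono-≤ P≤ (*-mono-≤ r!≤ r!≤) ⟩
    2 ^ (2 * n) * (2 ^ ((2 + b) * r) * 2 ^ ((2 + b) * r))
      ≡⟨ cong (2 ^ (2 * n) *_) (^-distribˡ-+-* 2 ((2 + b) * r) ((2 + b) * r)) ⟨
    2 ^ (2 * n) * 2 ^ ((2 + b) * r + (2 + b) * r)
      ≡⟨ ^-distribˡ-+-* 2 (2 * n) ((2 + b) * r + (2 + b) * r) ⟨
    2 ^ (2 * n + ((2 + b) * r + (2 + b) * r))
      <⟨ ^-monoʳ-< 2 (s≤s (s≤s z≤n)) exponent ⟩
    2 ^ (7 * (q * q)) ∎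
    where open ≤-Reasoning

bracket : (f : ℕ → ℕ) → ∀ {n} → f 0 ≤ n → ∀ M → n < f M → ∃[ x ] (f x ≤ n × n < f (suc x))
bracket f f0≤n zero n<f0 = ⊥-elim (<⇒≱ n<f0 f0≤n)
bracket f {n} f0≤n (suc M) n<fM with n <? f M
... | yes n<f = bracket f f0≤n M n<f
... | no  n≮f = M , ≮⇒≥ n≮f , n<fM

n<2^n : ∀ n → n < 2 ^ n
n<2^n zero = s≤s z≤n
n<2^n (suc n) = ≤-trans (+-mono-≤ (m^n>0 2 n) (n<2^n n)) (≤-reflexive (cong (2 ^ n +_) (≡-sym (+-identityʳ (2 ^ n)))))

n≤n^suc : ∀ n k → n ≤ n ^ suc k
n≤n^suc zero k = z≤n
n≤n^suc (suc n) k = m≤m*n (suc n) (suc n ^ k) {{m^n≢0 (suc n) k}}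

abstract
  -- If x lies between 16q² and 64q², with q a power of two, the prime in (2q² , 16q²] serves: it is
  -- at most x, and x < 64q² = 32 · 2q² < 32p.
  prime-below : ∃[ X ] (∀ x → X ≤ x → ∃[ p ] (Prime p × 5 ≤ p × p ≤ x × suc x ≤ 32 * p))
  prime-below = square 5 , go
    where
    square : ℕ → ℕ
    square b = 16 * (2 ^ b * 2 ^ b)

    b≤square : ∀ b → b ≤ square b
    b≤square b = ≤-trans (<⇒≤ (n<2^n b))
      (≤-trans (m≤m*n (2 ^ b) (2 ^ b) {{m^n≢0 2 b}}) (m≤n*m (2 ^ b * 2 ^ b) 16))

    square-suc : ∀ b → square (suc b) ≡ 32 * (2 * (2 ^ b * 2 ^ b))
    square-suc b = lemma (2 ^ b)
      where
      lemma : ∀ q → 16 * ((2 * q) * (2 * q)) ≡ 32 * (2 * (q * q))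
      lemma = solve-∀

    go : ∀ x → square 5 ≤ x → ∃[ p ] (Prime p × 5 ≤ p × p ≤ x × suc x ≤ 32 * p)
    go x X≤x with bracket (λ i → square (i + 5)) X≤x (suc x)
      (≤-trans (m≤m+n (suc x) 5) (b≤square (suc x + 5)))
    ... | i , ≤x , x< with prime-between (i + 5) (m≤n+m 5 i)
    ... | p , pp , <p , p≤ = p , pp , 5≤p , ≤-trans p≤ ≤x ,
      ≤-trans x< (≤-trans (≤-reflexive (square-suc (i + 5))) (*-monoʳ-≤ 32 (<⇒≤ <p)))
      where
      Q : ℕ
      Q = 2 ^ (i + 5)
      5≤p : 5 ≤ p
      5≤p = ≤-trans (m≤n+m 5 i) (≤-trans (<⇒≤ (n<2^n (i + 5)))
        (≤-trans (m≤m*n Q Q {{m^n≢0 2 (i + 5)}}) (≤-trans (m≤n*m (Q * Q) 2) (<⇒≤ <p))))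

-- For the largest x with 3x^k ≤ n, a prime p with p ≤ x < 32p gives a graph on 3p^k vertices that
-- fits into n vertices and is smaller by at most a constant factor.
scaled-prime : ∀ k → 0 < k → ∃[ N ] (∀ n → N ≤ n →
  ∃[ p ] (Prime p × 5 ≤ p × 3 * p ^ k ≤ n × n ≤ 3 * (32 * p) ^ k))
scaled-prime (suc k) _ = 3 * X ^ suc k , prime-for
  where
  X = proj₁ prime-below
  prime-for : ∀ n → 3 * X ^ suc k ≤ n →
    ∃[ p ] (Prime p × 5 ≤ p × 3 * p ^ suc k ≤ n × n ≤ 3 * (32 * p) ^ suc k)
  prime-for n N≤n
    with bracket (λ x → 3 * x ^ suc k) z≤n (suc n)
      (≤-trans (n≤n^suc (suc n) k) (m≤n*m (suc n ^ suc k) 3))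
  ... | x , ≤n , n< with proj₂ prime-below x (≮⇒≥ λ x<X →
          <⇒≱ n< (≤-trans (*-monoʳ-≤ 3 (^-monoˡ-≤ (suc k) x<X)) N≤n))
  ... | p , pp , 5≤p , p≤x , x< =
    p , pp , 5≤p , ≤-trans (*-monoʳ-≤ 3 (^-monoˡ-≤ (suc k) p≤x)) ≤n ,
    <⇒≤ (<-≤-trans n< (*-monoʳ-≤ 3 (^-monoˡ-≤ (suc k) x<)))

-- Products of the linear factors 1 - sX, truncated modulo p and a power of X

Series : Set
Series = ℕ → ℤ

one : Series
one zero = 1ℤ
one (suc _) = 0ℤ

mulLin : ℤ → Series → Series
mulLin s c zero = c 0
mulLin s c (suc j) = c (suc j) ℤ.- s ℤ.* c j

-- The Cauchy product, computed by splitting off the constant term of the first series.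
conv : Series → Series → Series
conv c a zero = c 0 ℤ.* a 0
conv c a (suc j) = c 0 ℤ.* a (suc j) ℤ.+ conv (c ∘ suc) a j

conv-zeroˡ : ∀ a j → conv (λ _ → 0ℤ) a j ≡ 0ℤ
conv-zeroˡ a zero = refl
conv-zeroˡ a (suc j) = trans (ℤ.+-identityˡ _) (conv-zeroˡ a j)

conv-linear : ∀ s c d a j → conv (λ i → c i ℤ.- s ℤ.* d i) a j ≡ conv c a j ℤ.- s ℤ.* conv d a j
conv-linear s c d a zero = identity s (c 0) (d 0) (a 0)
  where
  identity : ∀ s c d a → (c ℤ.- s ℤ.* d) ℤ.* a ≡ c ℤ.* a ℤ.- s ℤ.* (d ℤ.* a)
  identity = solve-∀-ℤ
conv-linear s c d a (suc j) =
  trans (cong (λ z → (c 0 ℤ.- s ℤ.* d 0) ℤ.* a (suc j) ℤ.+ z) (conv-linear s (c ∘ suc) (d ∘ suc) a j))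
    (identity s (c 0) (d 0) (a (suc j)) (conv (c ∘ suc) a j) (conv (d ∘ suc) a j))
  where
  identity : ∀ s c d a x y → (c ℤ.- s ℤ.* d) ℤ.* a ℤ.+ (x ℤ.- s ℤ.* y)
    ≡ c ℤ.* a ℤ.+ x ℤ.- s ℤ.* (d ℤ.* a ℤ.+ y)
  identity = solve-∀-ℤ

conv-mulLin : ∀ s c a j → conv (mulLin s c) a j ≡ mulLin s (conv c a) j
conv-mulLin s c a zero = refl
conv-mulLin s c a (suc j) =
  trans (cong (λ z → c 0 ℤ.* a (suc j) ℤ.+ z) (conv-linear s (c ∘ suc) c a j))
    (identity (c 0 ℤ.* a (suc j)) (conv (c ∘ suc) a j) (s ℤ.* conv c a j))
  where
  identity : ∀ x y z → x ℤ.+ (y ℤ.- z) ≡ x ℤ.+ y ℤ.- z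
  identity = solve-∀-ℤ

-- The coefficient of X^n in c/(1 - sX); for a polynomial c of degree at most n this is
-- its reversal evaluated at s.
eval : ℤ → Series → ℕ → ℤ
eval s c zero = c 0
eval s c (suc n) = s ℤ.* eval s c n ℤ.+ c (suc n)

eval-mulLin : ∀ s t c n → eval s (mulLin t c) (suc n) ≡ (s ℤ.- t) ℤ.* eval s c n ℤ.+ c (suc n)
eval-mulLin s t c zero = identity s t (c 0) (c 1)
  where
  identity : ∀ s t c d → s ℤ.* c ℤ.+ (d ℤ.- t ℤ.* c) ≡ (s ℤ.- t) ℤ.* c ℤ.+ d
  identity = solve-∀-ℤ
eval-mulLin s t c (suc n) rewrite eval-mulLin s t c n = identity s t (eval s c n) (c (suc n)) (c (suc (suc n)))
  where
  identity : ∀ s t e c d → s ℤ.* ((s ℤ.- t) ℤ.* e ℤ.+ c) ℤ.+ (d ℤ.- t ℤ.* c) ≡ (s ℤ.- t) ℤ.* (s ℤ.* e ℤ.+ c) ℤ.+ d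
  identity = solve-∀-ℤ

module Factors {A : Set} (val : A → ℤ) where

  mulLins : List A → Series → Series
  mulLins [] c = c
  mulLins (s ∷ L) c = mulLin (val s) (mulLins L c)

  -- Separates the product of the factors from the series it is applied to, so that `conv-cancelʳ`
  -- can remove the latter.
  mulLins-conv : ∀ L a j → mulLins L a j ≡ conv (mulLins L one) a j
  mulLins-conv [] a zero = ≡-sym (ℤ.*-identityˡ (a 0))
  mulLins-conv [] a (suc j) = ≡-sym (trans (cong₂ ℤ._+_ (ℤ.*-identityˡ (a (suc j))) (conv-zeroˡ a j)) (ℤ.+-identityʳ _))
  mulLins-conv (s ∷ L) a zero = mulLins-conv L a zero
  mulLins-conv (s ∷ L) a (suc j) =
    trans (cong₂ (λ x y → x ℤ.- val s ℤ.* y) (mulLins-conv L a (suc j)) (mulLins-conv L a j))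
      (≡-sym (conv-mulLin (val s) (mulLins L one) a (suc j)))

  mulLins-one-degree : ∀ L j → length L < j → mulLins L one j ≡ 0ℤ
  mulLins-one-degree [] (suc j) _ = refl
  mulLins-one-degree (s ∷ L) (suc j) (s≤s L<j) =
    trans (cong₂ (λ x y → x ℤ.- val s ℤ.* y)
        (mulLins-one-degree L (suc j) (m≤n⇒m≤1+n L<j)) (mulLins-one-degree L j L<j))
      (trans (ℤ.+-identityˡ _) (cong ℤ.-_ (ℤ.*-zeroʳ (val s))))

  roots : ℤ → List A → ℤ
  roots s [] = 1ℤ
  roots s (t ∷ L) = (s ℤ.- val t) ℤ.* roots s L

  -- Reversal turns each factor 1 - tX into X - t, so the value at s is the product of the
  -- differences s - t.
  eval-mulLins-one : ∀ s L → eval s (mulLins L one) (length L) ≡ roots s L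
  eval-mulLins-one s [] = refl
  eval-mulLins-one s (t ∷ L) = begin
    eval s (mulLins (t ∷ L) one) (suc (length L))
      ≡⟨ eval-mulLin s (val t) (mulLins L one) (length L) ⟩
    (s ℤ.- val t) ℤ.* eval s (mulLins L one) (length L) ℤ.+ mulLins L one (suc (length L))
      ≡⟨ cong₂ (λ x y → (s ℤ.- val t) ℤ.* x ℤ.+ y) (eval-mulLins-one s L) (mulLins-one-degree L _ ≤-refl) ⟩
    (s ℤ.- val t) ℤ.* roots s L ℤ.+ 0ℤ
      ≡⟨ ℤ.+-identityʳ _ ⟩
    roots s (t ∷ L) ∎
    where open ≡-Reasoning

abstract

  neg-sub : ∀ a b → ℤ.- (a ℤ.- b) ≡ b ℤ.- a
  neg-sub = solve-∀-ℤ

  sub-add-sub : ∀ a b c → a ℤ.- b ℤ.+ (b ℤ.- c) ≡ a ℤ.- c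
  sub-add-sub = solve-∀-ℤ

  sub-sub-mul-sub : ∀ a b c d s → a ℤ.- b ℤ.- s ℤ.* (c ℤ.- d) ≡ a ℤ.- s ℤ.* c ℤ.- (b ℤ.- s ℤ.* d)
  sub-sub-mul-sub = solve-∀-ℤ

  sub-mul-cancel : ∀ a b c d s → a ℤ.- s ℤ.* c ℤ.- (b ℤ.- s ℤ.* d) ℤ.+ s ℤ.* (c ℤ.- d) ≡ a ℤ.- b
  sub-mul-cancel = solve-∀-ℤ

  sub-mul-comm₁ : ∀ s t c d → c ℤ.- t ℤ.* d ℤ.- s ℤ.* d ≡ c ℤ.- s ℤ.* d ℤ.- t ℤ.* d
  sub-mul-comm₁ = solve-∀-ℤ

  sub-mul-comm₂ : ∀ s t c d e → c ℤ.- t ℤ.* d ℤ.- s ℤ.* (d ℤ.- t ℤ.* e) ≡ c ℤ.- s ℤ.* d ℤ.- t ℤ.* (d ℤ.- s ℤ.* e)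
  sub-mul-comm₂ = solve-∀-ℤ

  mul-sub-add-sub : ∀ s x y c d → s ℤ.* (x ℤ.- y) ℤ.+ (c ℤ.- d) ≡ s ℤ.* x ℤ.+ c ℤ.- (s ℤ.* y ℤ.+ d)
  mul-sub-add-sub = solve-∀-ℤ

module Mod (p : ℕ) where

  infix 4 _≈_ _≈[_]_

  -- A wrapper instead of a synonym: the difference a - b would compute, and a and b could then not
  -- be recovered from the type.
  data _≈_ (a b : ℤ) : Set where
    mk≈ : ℤ.+ p ℤ.∣ (a ℤ.- b) → a ≈ b

  ∣difference : ∀ {a b} → a ≈ b → ℤ.+ p ℤ.∣ (a ℤ.- b)
  ∣difference (mk≈ d) = d

  ≈-from : ∀ {a b x} → x ≡ a ℤ.- b → ℤ.+ p ℤ.∣ x → a ≈ b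
  ≈-from refl p∣x = mk≈ p∣x

  ≈-reflexive : ∀ {a b} → a ≡ b → a ≈ b
  ≈-reflexive {a} refl = ≈-from (≡-sym (ℤ.+-inverseʳ a)) (ℤ.∣n⇒∣m*n 0ℤ {ℤ.+ p} ℤ.∣-refl)

  ≈-sym : ∀ {a b} → a ≈ b → b ≈ a
  ≈-sym {a} {b} (mk≈ a≈b) = ≈-from (neg-sub a b) (ℤ.∣m⇒∣-m a≈b)

  ≈-trans : ∀ {a b c} → a ≈ b → b ≈ c → a ≈ c
  ≈-trans {a} {b} {c} (mk≈ a≈b) (mk≈ b≈c) = ≈-from (sub-add-sub a b c) (ℤ.∣m∣n⇒∣m+n a≈b b≈c)

  ≈-subMul : ∀ {a b c d} s → a ≈ b → c ≈ d → a ℤ.- s ℤ.* c ≈ b ℤ.- s ℤ.* d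
  ≈-subMul {a} {b} {c} {d} s (mk≈ a≈b) (mk≈ c≈d) =
    ≈-from (sub-sub-mul-sub a b c d s) (ℤ.∣m∣n⇒∣m-n a≈b (ℤ.∣n⇒∣m*n s c≈d))

  ≈-cancel-subMul : ∀ {a b c d} s → a ℤ.- s ℤ.* c ≈ b ℤ.- s ℤ.* d → c ≈ d → a ≈ b
  ≈-cancel-subMul {a} {b} {c} {d} s (mk≈ e) (mk≈ c≈d) =
    ≈-from (sub-mul-cancel a b c d s) (ℤ.∣m∣n⇒∣m+n e (ℤ.∣n⇒∣m*n s c≈d))

  -- Congruence modulo p and X^(k+1).
  _≈[_]_ : Series → ℕ → Series → Set
  c ≈[ k ] d = ∀ j → j ≤ k → c j ≈ d j

  mulLin-cong : ∀ s {c d k} → c ≈[ k ] d → mulLin s c ≈[ k ] mulLin s d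
  mulLin-cong s c≈d zero 0≤k = c≈d 0 0≤k
  mulLin-cong s {c} {d} c≈d (suc j) j<k =
    ≈-subMul {c (suc j)} {d (suc j)} {c j} {d j} s (c≈d (suc j) j<k) (c≈d j (<⇒≤ j<k))

  -- The factor 1 - sX is a unit among power series: each coefficient is recovered from its image
  -- and the coefficient before it.
  mulLin-cancel : ∀ s {c d k} → mulLin s c ≈[ k ] mulLin s d → c ≈[ k ] d
  mulLin-cancel s e zero 0≤k = e 0 0≤k
  mulLin-cancel s {c} {d} e (suc j) j<k =
    ≈-cancel-subMul {c (suc j)} {d (suc j)} {c j} {d j} s (e (suc j) j<k) (mulLin-cancel s {c} {d} e j (<⇒≤ j<k))

  mulLin-comm : ∀ s t c k → mulLin s (mulLin t c) ≈[ k ] mulLin t (mulLin s c)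
  mulLin-comm s t c k zero _ = ≈-reflexive refl
  mulLin-comm s t c k (suc zero) _ = ≈-reflexive (sub-mul-comm₁ s t (c 1) (c 0))
  mulLin-comm s t c k (suc (suc j)) _ = ≈-reflexive (sub-mul-comm₂ s t (c (suc (suc j))) (c (suc j)) (c j))

  eval-cong : ∀ s {c d} k → c ≈[ k ] d → eval s c k ≈ eval s d k
  eval-cong s zero c≈d = c≈d 0 z≤n
  eval-cong s {c} {d} (suc k) c≈d =
    ≈-from (mul-sub-add-sub s (eval s c k) (eval s d k) (c (suc k)) (d (suc k)))
      (ℤ.∣m∣n⇒∣m+n
        (ℤ.∣n⇒∣m*n s (∣difference (eval-cong s k λ j j≤k → c≈d j (m≤n⇒m≤1+n j≤k))))
        (∣difference (c≈d (suc k) ≤-refl)))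

  -- Since `a` has constant term 1, the constant term of `d` is that of the product. Once it
  -- vanishes modulo p, its contribution drops out and the shifted series satisfies the same
  -- hypothesis.
  conv-cancelʳ-zero : ∀ k {d a} → a 0 ≡ 1ℤ → (∀ j → j ≤ k → ℤ.+ p ℤ.∣ conv d a j) → ∀ j → j ≤ k → ℤ.+ p ℤ.∣ d j
  conv-cancelʳ-zero k {d} a₀≡1 div zero _ =
    subst (ℤ.+ p ℤ.∣_) (trans (cong (λ z → d 0 ℤ.* z) a₀≡1) (ℤ.*-identityʳ (d 0))) (div 0 z≤n)
  conv-cancelʳ-zero (suc k) {d} {a} a₀≡1 div (suc j) (s≤s j≤k) =
    conv-cancelʳ-zero k {d ∘ suc} a₀≡1
      (λ i i≤k → ℤ.∣m+n∣m⇒∣n (div (suc i) (s≤s i≤k))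
        (ℤ.∣m⇒∣m*n (a (suc i)) (conv-cancelʳ-zero (suc k) {d} a₀≡1 div 0 z≤n)))
      j j≤k

  conv-cancelʳ : ∀ k {c d a} → a 0 ≡ 1ℤ → conv c a ≈[ k ] conv d a → c ≈[ k ] d
  conv-cancelʳ k {c} {d} {a} a₀≡1 e j j≤k =
    ≈-from (cong (λ x → c j ℤ.- x) (ℤ.*-identityˡ (d j)))
      -- The difference is written c - 1 · d to have the shape of `conv-linear`.
      (conv-cancelʳ-zero k {λ i → c i ℤ.- 1ℤ ℤ.* d i} {a} a₀≡1
        (λ i i≤k → subst (ℤ.+ p ℤ.∣_)
          (≡-sym (trans (conv-linear 1ℤ c d a i) (cong (λ x → conv c a i ℤ.- x) (ℤ.*-identityˡ _))))
          (∣difference (e i i≤k)))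
        j j≤k)

  ∣*⇒∣⊎∣ : Prime p → ∀ a b → ℤ.+ p ℤ.∣ a ℤ.* b → (ℤ.+ p ℤ.∣ a) ⊎ (ℤ.+ p ℤ.∣ b)
  ∣*⇒∣⊎∣ pp a b p∣ab with euclidsLemma ℤ.∣ a ∣ ℤ.∣ b ∣ pp
    (subst (p ∣_) (ℤ.abs-* a b) (ℤ.∣⇒∣ᵤ p∣ab))
  ... | inj₁ p∣a = inj₁ (ℤ.∣ᵤ⇒∣ p∣a)
  ... | inj₂ p∣b = inj₂ (ℤ.∣ᵤ⇒∣ p∣b)

  module _ {A : Set} (val : A → ℤ) where

    open Factors val

    mulLins-cong : ∀ L {c d k} → c ≈[ k ] d → mulLins L c ≈[ k ] mulLins L d
    mulLins-cong [] c≈d = c≈d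
    mulLins-cong (s ∷ L) c≈d = mulLin-cong (val s) (mulLins-cong L c≈d)

    mulLin-mulLins-comm : ∀ s L c k → mulLin s (mulLins L c) ≈[ k ] mulLins L (mulLin s c)
    mulLin-mulLins-comm s [] c k j _ = ≈-reflexive refl
    mulLin-mulLins-comm s (t ∷ L) c k j j≤k =
      ≈-trans (mulLin-comm s (val t) (mulLins L c) k j j≤k)
        (mulLin-cong (val t) (mulLin-mulLins-comm s L c k) j j≤k)

    mulLins-cancel : ∀ k O E {a} → a 0 ≡ 1ℤ → mulLins O a ≈[ k ] mulLins E a →
      mulLins O one ≈[ k ] mulLins E one
    mulLins-cancel k O E {a} a₀≡1 e = conv-cancelʳ k a₀≡1 λ j j≤k →
      subst₂ _≈_ (mulLins-conv O a j) (mulLins-conv E a j) (e j j≤k)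

    module _ (pp : Prime p) where

      -- Euclid's lemma finds a factor congruent to s, and commutativity brings it to the front. The
      -- remaining list is known only through its product, so its length and its total weight are
      -- carried along; `wt` will be the copy bit.
      extract-root : (wt : A → ℕ) → ∀ s L → ℤ.+ p ℤ.∣ roots s L →
        ∃[ t ] ∃[ L′ ] (s ≈ val t × t ∈ L × (∀ {x} → x ∈ L′ → x ∈ L) ×
          length L ≡ suc (length L′) × sum (map wt L) ≡ wt t + sum (map wt L′) ×
          (∀ c k → mulLins L c ≈[ k ] mulLin (val t) (mulLins L′ c)))
      extract-root wt s [] p∣1 = ⊥-elim (¬prime[1] (subst Prime (∣1⇒≡1 (ℤ.∣⇒∣ᵤ p∣1)) pp))
      extract-root wt s (t ∷ L) p∣ with ∣*⇒∣⊎∣ pp (s ℤ.- val t) (roots s L) p∣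
      ... | inj₁ s≈t = t , L , mk≈ s≈t , here refl , there , refl , refl , λ _ _ _ _ → ≈-reflexive refl
      ... | inj₂ p∣L with extract-root wt s L p∣L
      ...   | u , L′ , s≈u , u∈L , L′⊆L , len , sum≡ , prod =
        u , t ∷ L′ , s≈u , there u∈L ,
        (λ { (here x≡t) → here x≡t ; (there x∈) → there (L′⊆L x∈) }) ,
        cong suc len ,
        trans (cong (_+_ (wt t)) sum≡) (exchange (wt t) (wt u) _) ,
        λ c k j j≤k → ≈-trans (mulLin-cong (val t) (prod c k) j j≤k)
          (mulLin-comm (val t) (val u) (mulLins L′ c) k j j≤k)
        where
        exchange : ∀ a b c → a + (b + c) ≡ b + (a + c)
        exchange = solve-∀

-- Equal products have the same roots, so the entries of O and E are matched in pairs
-- (t , b), (t , b′); distinctness forces b ≢ b′, and each pair contributes one to the sum.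
module Matching (p : ℕ) (pp : Prime p) where

  open Mod p

  Label : Set
  Label = Fin p × Bool

  val : Label → ℤ
  val (t , _) = ℤ.+ toℕ t

  open Factors val public

  bits : List Label → ℕ
  bits L = sum (map (bit ∘ proj₂) L)

  <⇒≉ : ∀ {m n} → m < n → n < p → ¬ (ℤ.+ m ≈ ℤ.+ n)
  <⇒≉ {m} {n} m<n n<p (mk≈ p∣) = <⇒≱ (≤-<-trans (m∸n≤m n m) n<p)
    (∣⇒≤ {{>-nonZero (m<n⇒0<n∸m m<n)}}
      (subst (p ∣_) (trans (cong ℤ.∣_∣ (ℤ.m-n≡m⊖n m n)) (ℤ.∣⊖∣-≤ (<⇒≤ m<n))) (ℤ.∣⇒∣ᵤ p∣)))

  ≈⇒≡ : ∀ {m n} → m < p → n < p → ℤ.+ m ≈ ℤ.+ n → m ≡ n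
  ≈⇒≡ {m} {n} m<p n<p m≈n with <-cmp m n
  ... | tri≈ _ m≡n _ = m≡n
  ... | tri< m<n _ _ = ⊥-elim (<⇒≉ m<n n<p m≈n)
  ... | tri> _ _ n<m = ⊥-elim (<⇒≉ n<m m<p (≈-sym {ℤ.+ m} {ℤ.+ n} m≈n))

  bit-complement : ∀ {b b′} → b ≢ b′ → bit b + bit b′ ≡ 1
  bit-complement {true}  {true}  b≢ = ⊥-elim (b≢ refl)
  bit-complement {true}  {false} _ = refl
  bit-complement {false} {true}  _ = refl
  bit-complement {false} {false} b≢ = ⊥-elim (b≢ refl)

  bits-matching : ∀ n O E → length O ≡ n → length E ≡ n →
    (∀ k → mulLins O one ≈[ k ] mulLins E one) → (∀ {x y} → x ∈ O → y ∈ E → x ≢ y) →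
    bits O + bits E ≡ n
  bits-matching zero [] [] _ _ _ _ = refl
  bits-matching (suc n) ((t , b) ∷ O) E lenO lenE prod distinct
    with extract-root val pp (bit ∘ proj₂) (ℤ.+ toℕ t) E root-of-E
    where
    P = mulLins ((t , b) ∷ O) one
    -- The first label of O contributes the factor t - t, so the product over O vanishes at t, and
    -- with it the product over E modulo p.
    root-of-E : ℤ.+ p ℤ.∣ roots (ℤ.+ toℕ t) E
    root-of-E = subst (ℤ.+ p ℤ.∣_) (ℤ.+-identityʳ (roots (ℤ.+ toℕ t) E))
      (∣difference (≈-sym (subst₂ _≈_ eval-P (eval-mulLins-one (ℤ.+ toℕ t) E)
        (eval-cong (ℤ.+ toℕ t) (length E) (prod (length E))))))
      where
      eval-P : eval (ℤ.+ toℕ t) P (length E) ≡ 0ℤ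
      eval-P = trans (cong (eval (ℤ.+ toℕ t) P) (trans lenE (≡-sym lenO)))
        (trans (eval-mulLins-one (ℤ.+ toℕ t) ((t , b) ∷ O))
          (trans (cong (λ z → z ℤ.* roots (ℤ.+ toℕ t) O) (ℤ.+-inverseʳ (ℤ.+ toℕ t))) refl))
  ... | (t′ , b′) , E′ , t≈t′ , t′∈E , E′⊆E , len≡ , bits≡ , prod′
    with toℕ-injective (≈⇒≡ (toℕ<n t) (toℕ<n t′) t≈t′)
  ... | refl = begin
    bit b + bits O + bits E                ≡⟨ cong (bit b + bits O +_) bits≡ ⟩
    bit b + bits O + (bit b′ + bits E′)    ≡⟨ exchange (bit b) (bits O) (bit b′) (bits E′) ⟩
    (bit b + bit b′) + (bits O + bits E′)  ≡⟨ cong₂ _+_ (bit-complement {b} {b′} λ { refl → distinct (here refl) t′∈E refl }) ih ⟩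
    suc n                                  ∎
    where
    open ≡-Reasoning
    exchange : ∀ a b c d → a + b + (c + d) ≡ a + c + (b + d)
    exchange = solve-∀
    ih : bits O + bits E′ ≡ n
    ih = bits-matching n O E′ (suc-injective lenO) (suc-injective (trans (≡-sym len≡) lenE))
      (λ k → mulLin-cancel (ℤ.+ toℕ t) λ j j≤k → ≈-trans (prod k j j≤k) (prod′ one k j j≤k))
      λ x∈ y∈ → distinct (there x∈) (E′⊆E y∈)

-- Ordered and sorted triangles

bit-∧₃-≤ : ∀ a b c {m} → (a ≡ true → b ≡ true → c ≡ true → 1 ≤ m) → bit (a ∧ b ∧ c) ≤ m
bit-∧₃-≤ true  true  true  1≤m = 1≤m refl refl refl
bit-∧₃-≤ false _     _     _   = z≤n
bit-∧₃-≤ true  false _     _   = z≤n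
bit-∧₃-≤ true  true  false _   = z≤n

module _ {n : ℕ} (G : Graph n) where

  orderedTriangle sortedTriangle : Fin n → Fin n → Fin n → ℕ
  orderedTriangle u v w = bit (adj G u v ∧ adj G v w ∧ adj G u w)
  sortedTriangle u v w = bit (lt u v ∧ lt v w ∧ adj G u v ∧ adj G v w ∧ adj G u w)

  <⇒lt : ∀ {u v : Fin n} → toℕ u < toℕ v → lt u v ≡ true
  <⇒lt u<v = T⇒≡true (<⇒<ᵇ u<v)
    where
    T⇒≡true : ∀ {b} → T b → b ≡ true
    T⇒≡true {true} _ = refl

  adj-sym : ∀ {u v} → Edge G u v → Edge G v u
  adj-sym {u} {v} uv = trans (Graph.sym G v u) uv

  adj⇒≢ : ∀ {u v} → Edge G u v → u ≢ v
  adj⇒≢ {u} uv refl with () ← trans (≡-sym uv) (irrefl G u)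

  sortedTriangle-true : ∀ {u v w} → toℕ u < toℕ v → toℕ v < toℕ w →
    Edge G u v → Edge G v w → Edge G u w → sortedTriangle u v w ≡ 1
  sortedTriangle-true u<v v<w uv vw uw
    rewrite <⇒lt u<v | <⇒lt v<w | uv | vw | uw = refl

  orderedTriangle-true : ∀ {u v w} → Edge G u v → Edge G v w → Edge G u w → orderedTriangle u v w ≡ 1
  orderedTriangle-true uv vw uw rewrite uv | vw | uw = refl

  orderings : Fin n → Fin n → Fin n → ℕ
  orderings u v w =
    sortedTriangle u v w + (sortedTriangle u w v + (sortedTriangle v u w +
    (sortedTriangle v w u + (sortedTriangle w u v + sortedTriangle w v u))))

  orderings-≥1 : ∀ {u v w} → Edge G u v → Edge G v w → Edge G u w → 1 ≤ orderings u v w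
  orderings-≥1 {u} {v} {w} uv vw uw
    with <-cmp (toℕ u) (toℕ v) | <-cmp (toℕ v) (toℕ w) | <-cmp (toℕ u) (toℕ w)
  ... | tri≈ _ u≡v _ | _ | _ = ⊥-elim (adj⇒≢ uv (toℕ-injective u≡v))
  ... | _ | tri≈ _ v≡w _ | _ = ⊥-elim (adj⇒≢ vw (toℕ-injective v≡w))
  ... | _ | _ | tri≈ _ u≡w _ = ⊥-elim (adj⇒≢ uw (toℕ-injective u≡w))
  ... | tri< u<v _ _ | tri< v<w _ _ | _ =
    ≤-trans (≤-reflexive (≡-sym (sortedTriangle-true u<v v<w uv vw uw))) (m≤m+n _ _)
  ... | tri< u<v _ _ | tri> _ _ w<v | tri< u<w _ _ =
    m≤n⇒m≤o+n (sortedTriangle u v w)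
    (≤-trans (≤-reflexive (≡-sym (sortedTriangle-true u<w w<v uw (adj-sym vw) uv))) (m≤m+n _ _))
  ... | tri< u<v _ _ | tri> _ _ w<v | tri> _ _ w<u =
    m≤n⇒m≤o+n (sortedTriangle u v w) (m≤n⇒m≤o+n (sortedTriangle u w v)
    (m≤n⇒m≤o+n (sortedTriangle v u w) (m≤n⇒m≤o+n (sortedTriangle v w u)
    (≤-trans (≤-reflexive (≡-sym (sortedTriangle-true w<u u<v (adj-sym uw) uv (adj-sym vw)))) (m≤m+n _ _)))))
  ... | tri> _ _ v<u | tri< v<w _ _ | tri< u<w _ _ =
    m≤n⇒m≤o+n (sortedTriangle u v w) (m≤n⇒m≤o+n (sortedTriangle u w v)
    (≤-trans (≤-reflexive (≡-sym (sortedTriangle-true v<u u<w (adj-sym uv) uw vw))) (m≤m+n _ _)))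
  ... | tri> _ _ v<u | tri< v<w _ _ | tri> _ _ w<u =
    m≤n⇒m≤o+n (sortedTriangle u v w) (m≤n⇒m≤o+n (sortedTriangle u w v)
    (m≤n⇒m≤o+n (sortedTriangle v u w)
    (≤-trans (≤-reflexive (≡-sym (sortedTriangle-true v<w w<u vw (adj-sym uw) (adj-sym uv)))) (m≤m+n _ _))))
  ... | tri> _ _ v<u | tri> _ _ w<v | _ =
    m≤n⇒m≤o+n (sortedTriangle u v w) (m≤n⇒m≤o+n (sortedTriangle u w v)
    (m≤n⇒m≤o+n (sortedTriangle v u w) (m≤n⇒m≤o+n (sortedTriangle v w u)
    (m≤n⇒m≤o+n (sortedTriangle w u v)
    (≤-reflexive (≡-sym (sortedTriangle-true w<v v<u (adj-sym vw) (adj-sym uv) (adj-sym uw))))))))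

  orderedTriangle-≤ : ∀ u v w → orderedTriangle u v w ≤ orderings u v w
  orderedTriangle-≤ u v w = bit-∧₃-≤ (adj G u v) (adj G v w) (adj G u w) orderings-≥1

  orderedTriangleCount : ℕ
  orderedTriangleCount = ΣFin n λ u → ΣFin n λ v → ΣFin n λ w → orderedTriangle u v w

  -- An ordered triangle has one of six sortings, and permuting the summation variables turns the
  -- sum over each into `triangleCount G`. Constructions can thus count triples without comparing
  -- indices.
  orderedTriangleCount-≤ : orderedTriangleCount ≤ 6 * triangleCount G
  orderedTriangleCount-≤ = begin
    orderedTriangleCount
      ≤⟨ ΣFin-mono n (λ u → ΣFin-mono n λ v → ΣFin-mono n λ w → orderedTriangle-≤ u v w) ⟩
    Σ³ orderings
      ≡⟨ plus τ _ refl (plus _ _ e₂ (plus _ _ e₃ (plus _ _ e₄ (plus _ _ e₅ e₆)))) ⟩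
    t + (t + (t + (t + (t + t))))
      ≡⟨ six t ⟩
    6 * triangleCount G ∎
    where
    open ≤-Reasoning
    t = triangleCount G
    τ = sortedTriangle
    Σ³ : (Fin n → Fin n → Fin n → ℕ) → ℕ
    Σ³ f = ΣFin n λ u → ΣFin n λ v → ΣFin n λ w → f u v w
    Σ³-+ : ∀ f g → Σ³ (λ u v w → f u v w + g u v w) ≡ Σ³ f + Σ³ g
    Σ³-+ f g = trans (ΣFin-cong n λ u → trans (ΣFin-cong n λ v → ΣFin-+ n (f u v) (g u v))
      (ΣFin-+ n (λ v → ΣFin n (f u v)) (λ v → ΣFin n (g u v)))) (ΣFin-+ n _ _)
    swap₂₃ : ∀ f → Σ³ (λ u v w → f u w v) ≡ Σ³ f
    swap₂₃ f = ΣFin-cong n λ u → ΣFin-swap n n (λ v w → f u w v)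
    swap₁₂ : ∀ f → Σ³ (λ u v w → f v u w) ≡ Σ³ f
    swap₁₂ f = ΣFin-swap n n (λ u v → ΣFin n (f v u))
    plus : ∀ f g {a b} → Σ³ f ≡ a → Σ³ g ≡ b → Σ³ (λ u v w → f u v w + g u v w) ≡ a + b
    plus f g f≡a g≡b = trans (Σ³-+ f g) (cong₂ _+_ f≡a g≡b)
    e₂ : Σ³ (λ u v w → τ u w v) ≡ t
    e₂ = swap₂₃ τ
    e₃ : Σ³ (λ u v w → τ v u w) ≡ t
    e₃ = swap₁₂ τ
    e₄ : Σ³ (λ u v w → τ v w u) ≡ t
    e₄ = trans (swap₁₂ (λ u v w → τ u w v)) e₂
    e₅ : Σ³ (λ u v w → τ w u v) ≡ t
    e₅ = trans (swap₂₃ (λ u v w → τ v u w)) e₃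
    e₆ : Σ³ (λ u v w → τ w v u) ≡ t
    e₆ = trans (swap₁₂ (λ u v w → τ w u v)) e₅
    six : ∀ t → t + (t + (t + (t + (t + t)))) ≡ 6 * t
    six = solve-∀

-- Adding isolated vertices

cycle-successor : ∀ {m} (i : Fin m) → ∃[ j ] CycAdj m i j
cycle-successor {suc m} i with suc (toℕ i) <? suc m
... | yes i<m = fromℕ< i<m , inj₁ (≡-sym (toℕ-fromℕ< i<m))
... | no  i≮m = zero , inj₂ (≤-antisym (toℕ<n i) (≮⇒≥ i≮m) , refl)

module Padding {m : ℕ} (r : ℕ) (G : Graph m) where

  padAdj : Fin (m + r) → Fin (m + r) → Bool
  padAdj u v = [ (λ a → [ adj G a , (λ _ → false) ]′ (Fin.splitAt m v)) , (λ _ → false) ]′ (Fin.splitAt m u)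

  pad : Graph (m + r)
  pad = record { adj = padAdj ; sym = symmetric ; irrefl = irreflexive }
    where
    symmetric : ∀ u v → padAdj u v ≡ padAdj v u
    symmetric u v with Fin.splitAt m u | Fin.splitAt m v
    ... | inj₁ a | inj₁ b = Graph.sym G a b
    ... | inj₁ _ | inj₂ _ = refl
    ... | inj₂ _ | inj₁ _ = refl
    ... | inj₂ _ | inj₂ _ = refl
    irreflexive : ∀ u → padAdj u u ≡ false
    irreflexive u with Fin.splitAt m u
    ... | inj₁ a = irrefl G a
    ... | inj₂ _ = refl

  pad-edge : ∀ {u v} → Edge pad u v → ∃[ a ] ∃[ b ] (u ≡ a Fin.↑ˡ r × v ≡ b Fin.↑ˡ r × Edge G a b)
  pad-edge {u} {v} uv with Fin.splitAt m u in eu | Fin.splitAt m v in ev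
  ... | inj₁ a | inj₁ b = a , b , ≡-sym (Fin.splitAt⁻¹-↑ˡ eu) , ≡-sym (Fin.splitAt⁻¹-↑ˡ ev) , uv

  pad-adj-↑ˡ : ∀ a b → padAdj (a Fin.↑ˡ r) (b Fin.↑ˡ r) ≡ adj G a b
  pad-adj-↑ˡ a b rewrite Fin.splitAt-↑ˡ m a r | Fin.splitAt-↑ˡ m b r = refl

  triangleCount-pad : triangleCount G ≤ triangleCount pad
  triangleCount-pad =
    ≤-trans (ΣFin-mono m λ u → ≤-trans (ΣFin-mono m λ v →
      ≤-trans (≤-reflexive (ΣFin-cong m λ w → ≡-sym (same u v w)))
        (ΣFin-injection m (m + r) ι ι-injective (λ w → sortedTriangle pad (ι u) (ι v) w)))
        (ΣFin-injection m (m + r) ι ι-injective (λ v → ΣFin (m + r) λ w → sortedTriangle pad (ι u) v w)))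
      (ΣFin-injection m (m + r) ι ι-injective
        (λ u → ΣFin (m + r) λ v → ΣFin (m + r) λ w → sortedTriangle pad u v w))
    where
    ι : Fin m → Fin (m + r)
    ι = Fin._↑ˡ r
    ι-injective : ∀ {i j} → ι i ≡ ι j → i ≡ j
    ι-injective = Fin.↑ˡ-injective r _ _
    same : ∀ u v w → sortedTriangle pad (ι u) (ι v) (ι w) ≡ sortedTriangle G u v w
    same u v w rewrite Fin.toℕ-↑ˡ u r | Fin.toℕ-↑ˡ v r | Fin.toℕ-↑ˡ w r
      | pad-adj-↑ˡ u v | pad-adj-↑ˡ v w | pad-adj-↑ˡ u w = refl

  -- Every vertex of a cycle has a cycle edge leaving it, so no added vertex lies on a cycle and the
  -- whole cycle pulls back.
  padCycle : ∀ {l} {f : Fin l → Fin (m + r)} → CycleMap pad l f →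
    ∃[ g ] ((∀ i → f i ≡ g i Fin.↑ˡ r) × CycleMap G l g)
  padCycle {l} {f} (inj , edges) = g , f≡ ,
    (λ gi≡gj → inj (trans (f≡ _) (trans (cong (Fin._↑ˡ r) gi≡gj) (≡-sym (f≡ _))))) ,
    λ i j ij → subst₂ (λ x y → padAdj x y ≡ true) (f≡ i) (f≡ j) (edges i j ij) ▹ pad-adj-↑ˡ (g i) (g j)
    where
    _▹_ : ∀ {a b : Bool} → a ≡ true → a ≡ b → b ≡ true
    e ▹ a≡b = trans (≡-sym a≡b) e
    next : ∀ i → ∃[ a ] (f i ≡ a Fin.↑ˡ r)
    next i with cycle-successor i
    ... | j , ij with pad-edge (edges i j ij)
    ...   | a , _ , fi≡ , _ = a , fi≡
    g : Fin l → Fin m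
    g i = proj₁ (next i)
    f≡ : ∀ i → f i ≡ g i Fin.↑ˡ r
    f≡ i = proj₂ (next i)

  pad-HasCycle : ∀ {l} → HasCycle pad l → HasCycle G l
  pad-HasCycle (f , cyc) with padCycle cyc
  ... | g , _ , cyc′ = g , cyc′

  module _ (c : ProperColouring G) where

    padCol : Fin (m + r) → Fin (m + r) → ℕ
    padCol u v = [ (λ a → [ col c a , (λ _ → 0) ]′ (Fin.splitAt m v)) , (λ _ → 0) ]′ (Fin.splitAt m u)

    padCol-↑ˡ : ∀ a b → padCol (a Fin.↑ˡ r) (b Fin.↑ˡ r) ≡ col c a b
    padCol-↑ˡ a b rewrite Fin.splitAt-↑ˡ m a r | Fin.splitAt-↑ˡ m b r = refl

    padColouring : ProperColouring pad
    padColouring = record { col = padCol ; colSym = symmetric ; proper = isProper }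
      where
      symmetric : ∀ u v → padCol u v ≡ padCol v u
      symmetric u v with Fin.splitAt m u | Fin.splitAt m v
      ... | inj₁ a | inj₁ b = colSym c a b
      ... | inj₁ _ | inj₂ _ = refl
      ... | inj₂ _ | inj₁ _ = refl
      ... | inj₂ _ | inj₂ _ = refl
      isProper : ∀ u v w → Edge pad u v → Edge pad u w → v ≢ w → padCol u v ≢ padCol u w
      isProper u v w uv uw v≢w eq
        with pad-edge {u} {v} uv | pad-edge {u} {w} uw
      ... | a , b , refl , refl , ab | a′ , b′ , a≡a′ , refl , a′b′
        with Fin.↑ˡ-injective r a a′ a≡a′
      ... | refl = proper c a b b′ ab a′b′ (v≢w ∘ cong (Fin._↑ˡ r))
        (trans (≡-sym (padCol-↑ˡ a b)) (trans eq (padCol-↑ˡ a b′)))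

    pad-HasRainbowCycle : ∀ {l} → HasRainbowCycle pad padColouring l → HasRainbowCycle G c l
    pad-HasRainbowCycle (f , cyc , rainbow) with padCycle cyc
    ... | g , f≡ , cyc′ = g , cyc′ , λ i j i′ j′ ij i′j′ i≢i′ eq →
      rainbow i j i′ j′ ij i′j′ i≢i′ (trans (colour i j) (trans eq (≡-sym (colour i′ j′))))
      where
      colour : ∀ i j → padCol (f i) (f j) ≡ col c (g i) (g j)
      colour i j rewrite f≡ i | f≡ j = padCol-↑ˡ (g i) (g j)

-- Transfers a construction of special order m to every n ≥ m.
max-TriRainbowFree-≥ : ∀ {n l M m t} → IsMax (TriRainbowFree n l) M → m ≤ n → TriRainbowFree m l t → t ≤ M
max-TriRainbowFree-≥ {m = m} (_ , max) m≤n (G , c , free , refl) with m≤n⇒∃[o]m+o≡n m≤n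
... | r , refl = ≤-trans triangleCount-pad
  (max _ (pad , padColouring c , free ∘ pad-HasRainbowCycle c , refl))
  where open Padding r G

max-TriFree-≥ : ∀ {n l M m t} → IsMax (TriFree n l) M → m ≤ n → TriFree m l t → t ≤ M
max-TriFree-≥ {m = m} (_ , max) m≤n (G , free , refl) with m≤n⇒∃[o]m+o≡n m≤n
... | r , refl = ≤-trans triangleCount-pad (max _ (pad , free ∘ pad-HasCycle , refl))
  where open Padding r G

-- Cycles as periodic walks indexed by ℕ

module Cyclic (m : ℕ) {{_ : NonZero m}} where

  residue : ℕ → Fin m
  residue i = fromℕ< (m%n<n i m)

  toℕ-residue : ∀ i → toℕ (residue i) ≡ i % m
  toℕ-residue i = toℕ-fromℕ< (m%n<n i m)

  toℕ-residue-< : ∀ {i} → i < m → toℕ (residue i) ≡ i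
  toℕ-residue-< {i} i<m = trans (toℕ-residue i) (m<n⇒m%n≡m i<m)

  suc-% : ∀ i → suc i % m ≡ suc (i % m) % m
  suc-% i = trans (cong (λ x → suc x % m) (m≡m%n+[m/n]*n i m)) ([m+kn]%n≡m%n (suc (i % m)) (i / m) m)

  residue-CycAdj : ∀ i → CycAdj m (residue i) (residue (suc i))
  residue-CycAdj i rewrite toℕ-residue i | toℕ-residue (suc i) | suc-% i with m≤n⇒m<n∨m≡n (m%n<n i m)
  ... | inj₁ r<m = inj₁ (≡-sym (m<n⇒m%n≡m r<m))
  ... | inj₂ r≡m = inj₂ (r≡m , trans (cong (_% m) r≡m) (n%n≡0 m))

  residue-+m : ∀ i → residue (i + m) ≡ residue i
  residue-+m i = toℕ-injective (trans (toℕ-residue (i + m))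
    (trans (cong (λ x → (i + x) % m) (≡-sym (+-identityʳ m))) (trans ([m+kn]%n≡m%n i 1 m) (≡-sym (toℕ-residue i)))))

  residue-injective : ∀ {i j} → i < m → j < m → residue i ≡ residue j → i ≡ j
  residue-injective i<m j<m eq =
    trans (≡-sym (toℕ-residue-< i<m)) (trans (cong toℕ eq) (toℕ-residue-< j<m))

  -- Equal residues would make m divide d, although 0 < d < m. Vertices fewer than m steps apart on
  -- a cycle are therefore distinct.
  residue-≢ : ∀ {d} → 0 < d → d < m → ∀ i → residue (d + i) ≢ residue i
  residue-≢ {d} 0<d d<m i eq = <⇒≱ d<m (∣⇒≤ {{>-nonZero 0<d}} (∣m+n∣m⇒∣n
    (divides ((d + i) / m) (+-cancelˡ-≡ (i % m) _ _ equation)) (n∣m*n (i / m))))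
    where
    open ≡-Reasoning
    %-eq : (d + i) % m ≡ i % m
    %-eq = trans (≡-sym (toℕ-residue (d + i))) (trans (cong toℕ eq) (toℕ-residue i))
    rearrange : ∀ r q d → r + (q + d) ≡ d + (r + q)
    rearrange = solve-∀
    equation : i % m + (i / m * m + d) ≡ i % m + (d + i) / m * m
    equation = begin
      i % m + (i / m * m + d)         ≡⟨ rearrange (i % m) (i / m * m) d ⟩
      d + (i % m + i / m * m)         ≡⟨ cong (d +_) (m≡m%n+[m/n]*n i m) ⟨
      d + i                           ≡⟨ m≡m%n+[m/n]*n (d + i) m ⟩
      (d + i) % m + (d + i) / m * m   ≡⟨ cong (_+ (d + i) / m * m) %-eq ⟩
      i % m + (d + i) / m * m         ∎

-- The coloured graph of twins and apexes

funToFin-cong : ∀ {m n} {f g : Fin m → Fin n} → (∀ i → f i ≡ g i) → Fin.funToFin f ≡ Fin.funToFin g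
funToFin-cong {zero} _ = refl
funToFin-cong {suc m} f≗g = cong₂ Fin.combine (f≗g zero) (funToFin-cong (f≗g ∘ suc))

abstract

  sub-add-cancel : ∀ a r b → a ≡ r ℤ.+ b → a ℤ.- r ≡ b
  sub-add-cancel a r b refl = identity r b
    where
    identity : ∀ r b → r ℤ.+ b ℤ.- r ≡ b
    identity = solve-∀-ℤ

  sub-one-mul : ∀ x t u → x ℤ.- t ℤ.* 1ℤ ℤ.- (x ℤ.- u ℤ.* 1ℤ) ≡ u ℤ.- t
  sub-one-mul = solve-∀-ℤ

-- An Elt codes the coefficients of X, …, X^k of an element of 1 + XF[X]/(X^(k+1)), and Step t x y says
-- that y = x(1 - tX). Both twins of x are adjacent to apex y whenever Step t x y for some t; edges between
-- twins have colour 0.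
module Construction (p : ℕ) (pp : Prime p) (k : ℕ) where

  open Mod p
  open Matching p pp

  Elt : Set
  Elt = Fin (p ^ k)

  series : Elt → Series
  series x zero = 1ℤ
  series x (suc j) with j <? k
  ... | yes j<k = ℤ.+ toℕ (Fin.finToFun {p} {k} x (fromℕ< j<k))
  ... | no  _   = 0ℤ

  series-coordinate : ∀ x (j : Fin k) → series x (suc (toℕ j)) ≡ ℤ.+ toℕ (Fin.finToFun {p} {k} x j)
  series-coordinate x j with toℕ j <? k
  ... | yes j<k = cong (λ i → ℤ.+ toℕ (Fin.finToFun {p} {k} x i)) (Fin.fromℕ<-toℕ j j<k)
  ... | no  j≮k = ⊥-elim (j≮k (toℕ<n j))

  data Step (t : Fin p) (x y : Elt) : Set where
    step : (∀ (j : Fin k) → series y (suc (toℕ j)) ≈ mulLin (ℤ.+ toℕ t) (series x) (suc (toℕ j))) → Step t x y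

  coordinates : ∀ {t x y} → Step t x y →
    ∀ (j : Fin k) → series y (suc (toℕ j)) ≈ mulLin (ℤ.+ toℕ t) (series x) (suc (toℕ j))
  coordinates (step s) = s

  _≈?_ : ∀ a b → Dec (a ≈ b)
  a ≈? b with (ℤ.+ p) ℤ.∣? (a ℤ.- b)
  ... | yes d = yes (mk≈ d)
  ... | no ¬d = no (¬d ∘ ∣difference)

  link? : ∀ x y → Dec (∃[ t ] Step t x y)
  link? x y = any? λ t → Dec.map′ step coordinates
    (all? λ j → series y (suc (toℕ j)) ≈? mulLin (ℤ.+ toℕ t) (series x) (suc (toℕ j)))

  Fin⇒≤k : {P : ℕ → Set} → P 0 → (∀ (j : Fin k) → P (suc (toℕ j))) → ∀ j → j ≤ k → P j
  Fin⇒≤k P0 Psuc zero _ = P0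
  Fin⇒≤k {P} P0 Psuc (suc j) j<k = subst (P ∘ suc) (toℕ-fromℕ< j<k) (Psuc (fromℕ< j<k))

  Step⇒≈ : ∀ {t x y} → Step t x y → series y ≈[ k ] mulLin (ℤ.+ toℕ t) (series x)
  Step⇒≈ {t} {x} {y} (step s) = Fin⇒≤k {λ j → series y j ≈ mulLin (ℤ.+ toℕ t) (series x) j} (≈-reflexive refl) s

  series-injective : ∀ {x y} → series x ≈[ k ] series y → x ≡ y
  series-injective {x} {y} x≈y = trans (≡-sym (Fin.funToFin-finToFin {k} {p} x))
    (trans (funToFin-cong coordinate) (Fin.funToFin-finToFin {k} {p} y))
    where
    coordinate : ∀ j → Fin.finToFun {p} {k} x j ≡ Fin.finToFun y j
    coordinate j = toℕ-injective (≈⇒≡ (toℕ<n _) (toℕ<n _)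
      (subst₂ _≈_ (series-coordinate x j) (series-coordinate y j) (x≈y (suc (toℕ j)) (toℕ<n j))))

  instance
    p≢0 : NonZero p
    p≢0 = prime⇒nonZero pp

  shifted : Fin p → Elt → Fin k → Fin p
  shift : Fin p → Elt → Elt
  shift t x = Fin.funToFin (shifted t x)

  shifted t x j = fromℕ< (ℤ.n%ℕd<d (mulLin (ℤ.+ toℕ t) (series x) (suc (toℕ j))) p)

  %ℕ-≈ : ∀ a → ℤ.+ (a ℤ.%ℕ p) ≈ a
  %ℕ-≈ a = ≈-sym (≈-from (≡-sym (sub-add-cancel a _ _ (ℤ.a≡a%ℕn+[a/ℕn]*n a p))) (ℤ.∣n⇒∣m*n (a ℤ./ℕ p) ℤ.∣-refl))

  shift-Step : ∀ t x → Step t x (shift t x)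
  shift-Step t x = step λ j → let target = mulLin (ℤ.+ toℕ t) (series x) (suc (toℕ j)) in
    subst (_≈ target)
    (≡-sym (trans (series-coordinate (shift t x) j)
      (cong ℤ.+_ (trans (cong toℕ (Fin.finToFun-funToFin (shifted t x) j)) (toℕ-fromℕ< _)))))
    (%ℕ-≈ target)

  Step-unique-target : ∀ {t x y y′} → Step t x y → Step t x y′ → y ≡ y′
  Step-unique-target s s′ = series-injective λ j j≤k → ≈-trans (Step⇒≈ s j j≤k) (≈-sym (Step⇒≈ s′ j j≤k))

  Step-unique-source : ∀ {t x x′ y} → Step t x y → Step t x′ y → x ≡ x′
  Step-unique-source {t} s s′ = series-injective (mulLin-cancel (ℤ.+ toℕ t)
    λ j j≤k → ≈-trans (≈-sym (Step⇒≈ s j j≤k)) (Step⇒≈ s′ j j≤k))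

  -- Multiplication by 1 - tX lowers the coefficient of X by t, since the constant term is 1; as 0 <
  -- k this coefficient is recorded.
  Step-unique-label : 0 < k → ∀ {t t′ x y} → Step t x y → Step t′ x y → t ≡ t′
  Step-unique-label 0<k {t} {t′} {x} s s′ = toℕ-injective (≡-sym (≈⇒≡ (toℕ<n t′) (toℕ<n t)
    (≈-from (sub-one-mul (series x 1) (ℤ.+ toℕ t) (ℤ.+ toℕ t′))
      (∣difference (≈-trans (≈-sym (Step⇒≈ s 1 0<k)) (Step⇒≈ s′ 1 0<k))))))

  data Vertex : Set where
    twin : Bool → Elt → Vertex
    apex : Elt → Vertex

  decode′ : Fin 3 × Elt → Vertex
  decode′ (zero , x) = twin false x
  decode′ (suc zero , x) = twin true x
  decode′ (suc (suc zero) , y) = apex y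

  encode′ : Vertex → Fin 3 × Elt
  encode′ (twin false x) = zero , x
  encode′ (twin true x) = suc zero , x
  encode′ (apex y) = suc (suc zero) , y

  decode : Fin (3 * p ^ k) → Vertex
  decode u = decode′ (Fin.remQuot (p ^ k) u)

  encode : Vertex → Fin (3 * p ^ k)
  encode v = Fin.combine (proj₁ (encode′ v)) (proj₂ (encode′ v))

  decode-encode : ∀ v → decode (encode v) ≡ v
  decode-encode v = trans (cong decode′ (Fin.remQuot-combine (proj₁ (encode′ v)) (proj₂ (encode′ v)))) (inverse v)
    where
    inverse : ∀ v → decode′ (encode′ v) ≡ v
    inverse (twin false x) = refl
    inverse (twin true x) = refl
    inverse (apex y) = refl

  encode-decode : ∀ u → encode (decode u) ≡ u
  encode-decode u = trans (cong (λ (i , x) → Fin.combine i x) (inverse (Fin.remQuot (p ^ k) u))) (Fin.combine-remQuot (p ^ k) u)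
    where
    inverse : ∀ w → encode′ (decode′ w) ≡ w
    inverse (zero , x) = refl
    inverse (suc zero , x) = refl
    inverse (suc (suc zero) , y) = refl

  decode-injective : ∀ {u v} → decode u ≡ decode v → u ≡ v
  decode-injective eq = trans (≡-sym (encode-decode _)) (trans (cong encode eq) (encode-decode _))

  encode-injective : ∀ {u v} → encode u ≡ encode v → u ≡ v
  encode-injective eq = trans (≡-sym (decode-encode _)) (trans (cong decode eq) (decode-encode _))

  adjᵥ : Vertex → Vertex → Bool
  adjᵥ (twin b x) (twin b′ x′) = ⌊ x Fin.≟ x′ ⌋ ∧ (b xor b′)
  adjᵥ (twin b x) (apex y) = ⌊ link? x y ⌋
  adjᵥ (apex y) (twin b x) = ⌊ link? x y ⌋
  adjᵥ (apex y) (apex y′) = false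

  -- Shifted by one because colour 0 belongs to the edges between twins.
  labelCode : Label → ℕ
  labelCode (t , b) = suc (toℕ (Fin.combine t (bitFin b)))
    where
    bitFin : Bool → Fin 2
    bitFin false = zero
    bitFin true = suc zero

  labelCode-injective : ∀ {l l′} → labelCode l ≡ labelCode l′ → l ≡ l′
  labelCode-injective {t , b} {t′ , b′} eq
    with Fin.combine-injective t _ t′ _ (toℕ-injective (suc-injective eq))
  labelCode-injective {t , false} {t′ , false} eq | refl , _ = refl
  labelCode-injective {t , true}  {t′ , true}  eq | refl , _ = refl

  linkColour : ∀ {x y} → Bool → Dec (∃[ t ] Step t x y) → ℕ
  linkColour b (yes (t , _)) = labelCode (t , b)
  linkColour b (no _) = 0

  colᵥ : Vertex → Vertex → ℕ
  colᵥ (twin b x) (twin b′ x′) = 0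
  colᵥ (twin b x) (apex y) = linkColour b (link? x y)
  colᵥ (apex y) (twin b x) = linkColour b (link? x y)
  colᵥ (apex y) (apex y′) = 0

  adjᵥ-sym : ∀ u v → adjᵥ u v ≡ adjᵥ v u
  adjᵥ-sym (twin b x) (twin b′ x′) with x Fin.≟ x′ | x′ Fin.≟ x
  ... | yes _ | yes _ = xor-comm b b′
  ... | no  _ | no  _ = refl
  ... | yes x≡x′ | no x′≢x = ⊥-elim (x′≢x (≡-sym x≡x′))
  ... | no x≢x′ | yes x′≡x = ⊥-elim (x≢x′ (≡-sym x′≡x))
  adjᵥ-sym (twin b x) (apex y) = refl
  adjᵥ-sym (apex y) (twin b x) = refl
  adjᵥ-sym (apex y) (apex y′) = refl

  adjᵥ-irrefl : ∀ u → adjᵥ u u ≡ false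
  adjᵥ-irrefl (twin b x) = trans (cong (⌊ x Fin.≟ x ⌋ ∧_) (xor-same b)) (∧-zeroʳ _)
  adjᵥ-irrefl (apex y) = refl

  colᵥ-sym : ∀ u v → colᵥ u v ≡ colᵥ v u
  colᵥ-sym (twin b x) (twin b′ x′) = refl
  colᵥ-sym (twin b x) (apex y) = refl
  colᵥ-sym (apex y) (twin b x) = refl
  colᵥ-sym (apex y) (apex y′) = refl

  twin-edge : ∀ {b x b′ x′} → adjᵥ (twin b x) (twin b′ x′) ≡ true → x ≡ x′ × b′ ≡ not b
  twin-edge {b} {x} {b′} {x′} e with x Fin.≟ x′
  twin-edge {false} {b′ = true} e | yes x≡x′ = x≡x′ , refl
  twin-edge {true} {b′ = false} e | yes x≡x′ = x≡x′ , refl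

  link-edge : ∀ {b x y} → adjᵥ (twin b x) (apex y) ≡ true →
    ∃[ t ] (Step t x y × colᵥ (twin b x) (apex y) ≡ labelCode (t , b))
  link-edge {b} {x} {y} e with link? x y
  ... | yes (t , s) = t , s , refl

  -- At a twin, the label of a link determines the apex. At an apex, it determines the copy, and
  -- also the series because 1 - tX can be cancelled.
  colᵥ-proper : ∀ u v w → adjᵥ u v ≡ true → adjᵥ u w ≡ true → v ≢ w → colᵥ u v ≢ colᵥ u w
  colᵥ-proper (twin b x) (twin b₁ x₁) (twin b₂ x₂) uv uw v≢w _
    with twin-edge {b} {x} uv | twin-edge {b} {x} uw
  ... | refl , refl | refl , refl = v≢w refl
  colᵥ-proper (twin b x) (twin b₁ x₁) (apex y) uv uw v≢w eq with link-edge {b} {x} {y} uw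
  ... | _ , _ , c with () ← trans eq c
  colᵥ-proper (twin b x) (apex y) (twin b₁ x₁) uv uw v≢w eq with link-edge {b} {x} {y} uv
  ... | _ , _ , c with () ← trans (≡-sym eq) c
  colᵥ-proper (twin b x) (apex y) (apex y′) uv uw v≢w eq
    with link-edge {b} {x} {y} uv | link-edge {b} {x} {y′} uw
  ... | t , s , c | t′ , s′ , c′
    with labelCode-injective {t , b} {t′ , b} (trans (≡-sym c) (trans eq c′))
  ... | refl = v≢w (cong apex (Step-unique-target {t} {x} s s′))
  colᵥ-proper (apex y) (twin b x) (twin b′ x′) uv uw v≢w eq
    with link-edge {b} {x} {y} uv | link-edge {b′} {x′} {y} uw
  ... | t , s , c | t′ , s′ , c′
    with labelCode-injective {t , b} {t′ , b′} (trans (≡-sym c) (trans eq c′))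
  ... | refl = v≢w (cong (twin b) (Step-unique-source {t} s s′))

  G : Graph (3 * p ^ k)
  G = record
    { adj = λ u v → adjᵥ (decode u) (decode v)
    ; sym = λ u v → adjᵥ-sym (decode u) (decode v)
    ; irrefl = λ u → adjᵥ-irrefl (decode u) }

  c : ProperColouring G
  c = record
    { col = λ u v → colᵥ (decode u) (decode v)
    ; colSym = λ u v → colᵥ-sym (decode u) (decode v)
    ; proper = λ u v w uv uw v≢w → colᵥ-proper (decode u) (decode v) (decode w) uv uw (v≢w ∘ decode-injective) }

  -- For each of the p^k series x, the two twins form a triangle with each of the p distinct apexes
  -- x(1 - tX).
  triangles : 0 < k → p ^ k * p ≤ 6 * triangleCount G
  triangles 0<k = begin
    p ^ k * p
      ≡⟨ ΣFin-const (p ^ k) p ⟨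
    ΣFin (p ^ k) (λ _ → p)
      ≤⟨ ΣFin-mono (p ^ k) per-element ⟩
    ΣFin (p ^ k) (λ x → ΣFin N λ v → ΣFin N λ w → orderedTriangle G (encode (twin false x)) v w)
      ≤⟨ ΣFin-injection (p ^ k) N (encode ∘ twin false) (λ {x} {x′} eq → twin-injective (encode-injective {twin false x} {twin false x′} eq)) _ ⟩
    orderedTriangleCount G
      ≤⟨ orderedTriangleCount-≤ G ⟩
    6 * triangleCount G ∎
    where
    open ≤-Reasoning
    N = 3 * p ^ k
    twin-injective : ∀ {b x x′} → twin b x ≡ twin b x′ → x ≡ x′
    twin-injective refl = refl
    apex-injective : ∀ {y y′} → apex y ≡ apex y′ → y ≡ y′
    apex-injective refl = refl
    edge : ∀ {u v} → adjᵥ u v ≡ true → Edge G (encode u) (encode v)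
    edge {u} {v} e rewrite decode-encode u | decode-encode v = e
    link : ∀ t x → ⌊ link? x (shift t x) ⌋ ≡ true
    link t x with link? x (shift t x)
    ... | yes _ = refl
    ... | no ¬link = ⊥-elim (¬link (t , shift-Step t x))
    twins : ∀ x → adjᵥ (twin false x) (twin true x) ≡ true
    twins x with x Fin.≟ x
    ... | yes _ = refl
    ... | no x≢x = ⊥-elim (x≢x refl)
    per-element : ∀ x → p ≤ ΣFin N λ v → ΣFin N λ w → orderedTriangle G (encode (twin false x)) v w
    per-element x = begin
      p
        ≡⟨ trans (ΣFin-const p 1) (*-identityʳ p) ⟨
      ΣFin p (λ _ → 1)
        ≡⟨ ΣFin-cong p (λ t → orderedTriangle-true G {u} {v} (edge {twin false x} {twin true x} (twins x))
             (edge {twin true x} {apex (shift t x)} (link t x)) (edge {twin false x} {apex (shift t x)} (link t x))) ⟨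
      ΣFin p (λ t → orderedTriangle G u v (encode (apex (shift t x))))
        ≤⟨ ΣFin-injection p N (λ t → encode (apex (shift t x)))
             (λ {t} {t′} eq → Step-unique-label 0<k {t} {t′} {x} (shift-Step t x)
               (subst (Step t′ x) (≡-sym (apex-injective (encode-injective {apex (shift t x)} {apex (shift t′ x)} eq))) (shift-Step t′ x)))
             (orderedTriangle G u v) ⟩
      ΣFin N (orderedTriangle G u v)
        ≤⟨ ΣFin-≥-term N (λ v → ΣFin N λ w → orderedTriangle G u v w) v ⟩
      ΣFin N (λ v → ΣFin N λ w → orderedTriangle G u v w) ∎
      where
      u v : Fin N
      u = encode (twin false x)
      v = encode (twin true x)

-- Parity along rainbow closed walks

double : ∀ a → a + a ≡ a * 2
double = solve-∀

double≢suc-double : ∀ a b → a + a ≢ suc (b + b)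
double≢suc-double a b eq = case ∣1⇒≡1 2∣1 of λ ()
  where
  2∣double : ∀ a → 2 ∣ a + a
  2∣double a = divides a (double a)
  2∣1 : 2 ∣ 1
  2∣1 = ∣m+n∣m⇒∣n (subst (2 ∣_) (trans eq (≡-sym (+-comm (b + b) 1))) (2∣double a)) (2∣double b)

double-injective : ∀ {a b} → a + a ≡ b + b → a ≡ b
double-injective {a} {b} eq = *-cancelʳ-≡ a b 2 (trans (≡-sym (double a)) (trans eq (double b)))

-- Uniqueness of quotient and remainder modulo 2.
double+bit-injective : ∀ {a k z z₀} → z ≤ 1 → z₀ ≤ 1 → a + a + z ≡ 2 * k + z₀ → a ≡ k × z ≡ z₀
double+bit-injective {a} {k} z≤1 z₀≤1 eq rewrite +-identityʳ k = go z≤1 z₀≤1 eq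
  where
  go : ∀ {z z₀} → z ≤ 1 → z₀ ≤ 1 → a + a + z ≡ k + k + z₀ → a ≡ k × z ≡ z₀
  go z≤n z≤n eq rewrite +-identityʳ (a + a) | +-identityʳ (k + k) = double-injective eq , refl
  go (s≤s z≤n) (s≤s z≤n) eq = double-injective (+-cancelʳ-≡ 1 (a + a) (k + k) eq) , refl
  go z≤n (s≤s z≤n) eq rewrite +-identityʳ (a + a) | +-comm (k + k) 1 = ⊥-elim (double≢suc-double a k eq)
  go (s≤s z≤n) z≤n eq rewrite +-identityʳ (k + k) | +-comm (a + a) 1 = ⊥-elim (double≢suc-double k a (≡-sym eq))

-- Along a rainbow closed walk, O collects the labels (t , b) of the steps from a twin to an apex and E those
-- of the steps back. The products over O and E agree, so O and E are matched and exactly k of the 2k labels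
-- have b = true. That number has the parity of the number z of edges between twins.
module RainbowWalk (p : ℕ) (pp : Prime p) (k : ℕ) (start : Construction.Vertex p pp k) (colour : ℕ → ℕ) where

  open Mod p
  open Matching p pp
  open Construction p pp k

  -- Modulo 2, `parityBit` changes by the copy bit across a link and by 1 across an edge between
  -- twins. `side` lets `balance` hold also when the walk stands at an apex.
  side parityBit : Vertex → ℕ
  side (twin _ _) = 0
  side (apex _) = 1
  parityBit (twin b _) = bit b
  parityBit (apex _) = 0

  element : Vertex → Elt
  element (twin _ x) = x
  element (apex y) = y

  Used : ℕ → ℕ → Set
  Used i colour′ = ∃[ j ] (j < i × colour j ≡ colour′)

  weaken : ∀ {i c′} → Used i c′ → Used (suc i) c′
  weaken (j , j<i , eq) = j , m<n⇒m<1+n j<i , eq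

  -- The invariant after i steps. `product≈` keeps the backward factors on the side of v, so that no
  -- inverse is formed. `Used` ties each label to a colour already spent; freshness then yields
  -- `distinct`, and it keeps z at most 1 because all edges between twins share a colour.
  record State (i : ℕ) (v : Vertex) : Set where
    field
      O E : List Label
      z : ℕ
      balance : length O + side start ≡ length E + side v
      count : length O + length E + z ≡ i
      parity : 2 ∣ bits O + bits E + (z + (parityBit start + parityBit v))
      twinEdge : z ≡ 0 ⊎ (z ≡ 1 × Used i 0)
      usedO : ∀ {l} → l ∈ O → Used i (labelCode l)
      usedE : ∀ {l} → l ∈ E → Used i (labelCode l)
      distinct : ∀ {l l′} → l ∈ O → l′ ∈ E → l ≢ l′
      product≈ : mulLins O (series (element start)) ≈[ k ] mulLins E (series (element v))

  initial : State 0 start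
  initial = record
    { O = [] ; E = [] ; z = 0 ; balance = refl ; count = refl
    ; parity = divides (parityBit start) (double (parityBit start))
    ; twinEdge = inj₁ refl
    ; usedO = λ () ; usedE = λ () ; distinct = λ ()
    ; product≈ = λ _ _ → ≈-reflexive refl }

  Fresh : ℕ → ℕ → Set
  Fresh i c′ = ∀ j → j < i → colour j ≢ c′

  fresh-unused : ∀ {i c′} → Fresh i c′ → ¬ Used i c′
  fresh-unused fresh (j , j<i , eq) = fresh j j<i eq

  extend : ∀ {i} u v → State i u → adjᵥ u v ≡ true → colour i ≡ colᵥ u v → Fresh i (colᵥ u v) →
    State (suc i) v
  extend {i} (twin b x) (twin b′ x′) st uv ci fresh with twin-edge {b} {x} {b′} {x′} uv
  ... | refl , refl with State.twinEdge st
  -- A second edge between twins would repeat colour 0.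
  ...   | inj₂ (_ , used) = ⊥-elim (fresh-unused fresh used)
  ...   | inj₁ z≡0 = record
    { O = O ; E = E ; z = 1 ; balance = balance
    ; count = trans (+-comm (length O + length E) 1)
        (cong suc (trans (≡-sym (+-identityʳ _)) (trans (cong (length O + length E +_) (≡-sym z≡0)) count)))
    ; parity = flip b (subst (λ z → 2 ∣ bits O + bits E + (z + _)) z≡0 parity)
    ; twinEdge = inj₂ (refl , i , ≤-refl , ci)
    ; usedO = weaken ∘ usedO ; usedE = weaken ∘ usedE
    ; distinct = distinct ; product≈ = product≈ }
    where
    open State st
    shift₂ : ∀ a s → a + (0 + (s + 0)) + 2 ≡ a + (1 + (s + 1))
    shift₂ = solve-∀
    shift₀ : ∀ a s → a + (0 + (s + 1)) ≡ a + (1 + (s + 0))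
    shift₀ = solve-∀
    flip : ∀ b → 2 ∣ bits O + bits E + (0 + (parityBit start + bit b)) →
      2 ∣ bits O + bits E + (1 + (parityBit start + bit (not b)))
    flip false d = subst (2 ∣_) (shift₂ (bits O + bits E) (parityBit start)) (∣m∣n⇒∣m+n d ∣-refl)
    flip true d = subst (2 ∣_) (shift₀ (bits O + bits E) (parityBit start)) d
  extend {i} (twin b x) (apex y) st uv ci fresh with link-edge {b} {x} {y} uv
  ... | t , s , c≡ = record
    { O = (t , b) ∷ O ; E = E ; z = z
    ; balance = trans (cong suc (trans balance (+-identityʳ _))) (+-comm 1 (length E))
    ; count = cong suc count
    ; parity = subst (2 ∣_) (move (bit b) (bits O) (bits E) z (parityBit start)) parity
    ; twinEdge = map₂ (λ (z≡1 , used) → z≡1 , weaken used) twinEdge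
    ; usedO = λ { (here refl) → i , ≤-refl , trans ci c≡ ; (there l∈) → weaken (usedO l∈) }
    ; usedE = weaken ∘ usedE
    ; distinct = λ { (here refl) l′∈ refl → fresh-unused (subst (Fresh i) c≡ fresh) (usedE l′∈)
                   ; (there l∈) l′∈ → distinct l∈ l′∈ }
    ; product≈ = λ j j≤k →
        ≈-trans (mulLin-cong (ℤ.+ toℕ t) product≈ j j≤k)
        (≈-trans (mulLin-mulLins-comm val (ℤ.+ toℕ t) E (series x) k j j≤k)
          (mulLins-cong val E (λ i i≤k → ≈-sym (Step⇒≈ {t} {x} {y} s i i≤k)) j j≤k)) }
    where
    open State st
    move : ∀ b o e z s → o + e + (z + (s + b)) ≡ b + o + e + (z + (s + 0))
    move = solve-∀
  extend {i} (apex y) (twin b x) st uv ci fresh with link-edge {b} {x} {y} uv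
  ... | t , s , c≡ = record
    { O = O ; E = (t , b) ∷ E ; z = z
    ; balance = trans balance (trans (+-comm (length E) 1) (≡-sym (+-identityʳ _)))
    ; count = trans (cong (_+ z) (+-suc (length O) (length E))) (cong suc count)
    ; parity = subst (2 ∣_) (move (bit b) (bits O) (bits E) z (parityBit start))
        (∣m∣n⇒∣m+n parity (divides (bit b) (double (bit b))))
    ; twinEdge = map₂ (λ (z≡1 , used) → z≡1 , weaken used) twinEdge
    ; usedO = weaken ∘ usedO
    ; usedE = λ { (here refl) → i , ≤-refl , trans ci c≡ ; (there l∈) → weaken (usedE l∈) }
    ; distinct = λ { l∈ (here refl) refl → fresh-unused (subst (Fresh i) c≡ fresh) (usedO l∈)
                   ; l∈ (there l′∈) → distinct l∈ l′∈ }
    ; product≈ = λ j j≤k →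
        ≈-trans (product≈ j j≤k)
        (≈-trans (mulLins-cong val E (Step⇒≈ {t} {x} {y} s) j j≤k)
          (≈-sym (mulLin-mulLins-comm val (ℤ.+ toℕ t) E (series x) k j j≤k))) }
    where
    open State st
    move : ∀ b o e z s → o + e + (z + (s + 0)) + (b + b) ≡ o + (b + e) + (z + (s + b))
    move = solve-∀

  -- Back at the start, O and E have equal length, so the total length 2k + z₀ forces k labels in
  -- each and z = z₀. The matching makes the bits sum to k; the two end bits are equal, so `parity`
  -- says that k + z₀ is even.
  closed : ∀ {z₀} → z₀ ≤ 1 → State (2 * k + z₀) start → 2 ∣ k + z₀
  closed {z₀} z₀≤1 st = subst (λ z → 2 ∣ k + z) (proj₂ lengths)
    (∣m+n∣m⇒∣n (subst (2 ∣_) (rearrange k z (parityBit start)) (subst (λ x → 2 ∣ x + (z + (parityBit start + parityBit start))) bits≡k parity))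
      (divides (parityBit start) (double (parityBit start))))
    where
    open State st
    rearrange : ∀ k z s → k + (z + (s + s)) ≡ s + s + (k + z)
    rearrange = solve-∀
    O≡E : length O ≡ length E
    O≡E = +-cancelʳ-≡ (side start) _ _ balance
    z≤1 : z ≤ 1
    z≤1 = [ (λ { refl → z≤n }) , (λ { (refl , _) → ≤-refl }) ]′ twinEdge
    lengths : length O ≡ k × z ≡ z₀
    lengths = double+bit-injective z≤1 z₀≤1 (trans (cong (λ x → length O + x + z) O≡E) count)
    lenO : length O ≡ k
    lenO = proj₁ lengths
    lenE : length E ≡ k
    lenE = trans (≡-sym O≡E) lenO
    -- Up to degree k the starting series cancels; above k both products vanish, having only k
    -- factors. So the truncated congruence holds in every degree.
    product-one : ∀ n → mulLins O one ≈[ n ] mulLins E one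
    product-one n j _ with j ≤? k
    ... | yes j≤k = mulLins-cancel val k O E {series (element start)} refl product≈ j j≤k
    ... | no  j≰k = ≈-reflexive (trans (mulLins-one-degree O j (subst (_< j) (≡-sym lenO) (≰⇒> j≰k)))
      (≡-sym (mulLins-one-degree E j (subst (_< j) (≡-sym lenE) (≰⇒> j≰k)))))
    bits≡k : bits O + bits E ≡ k
    bits≡k = bits-matching k O E lenO lenE product-one distinct

module _ (p : ℕ) (pp : Prime p) (k : ℕ) (0<k : 0 < k) where

  open Construction p pp k

  no-rainbow-cycle : ∀ z₀ → z₀ ≤ 1 → ¬ (2 ∣ k + z₀) → ¬ HasRainbowCycle G c (2 * k + z₀)
  no-rainbow-cycle z₀ z₀≤1 odd (f , (inj , edges) , rainbow) =
    odd (closed z₀≤1 (subst (State m) (cong (decode ∘ f) (residue-+m 0)) (walk m ≤-refl)))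
    where
    m = 2 * k + z₀
    instance
      m≢0 : NonZero m
      m≢0 = >-nonZero (≤-trans 0<k (≤-trans (m≤m+n k (k + 0)) (m≤m+n (2 * k) z₀)))
    open Cyclic m
    w : ℕ → Vertex
    w i = decode (f (residue i))
    colour : ℕ → ℕ
    colour i = colᵥ (w i) (w (suc i))
    open RainbowWalk p pp k (w 0) colour
    walk : ∀ i → i ≤ m → State i (w i)
    walk zero _ = initial
    walk (suc i) i<m = extend (w i) (w (suc i)) (walk i (<⇒≤ i<m))
      (edges _ _ (residue-CycAdj i)) refl
      λ j j<i → rainbow _ _ _ _ (residue-CycAdj j) (residue-CycAdj i)
        λ eq → <⇒≢ j<i (residue-injective (<-trans j<i i<m) i<m eq)

-- Lower bounds of order n^(1+1/k)

^-distribʳ-* : ∀ k a b → (a * b) ^ k ≡ a ^ k * b ^ k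
^-distribʳ-* zero a b = refl
^-distribʳ-* (suc k) a b = trans (cong (a * b *_) (^-distribʳ-* k a b)) (exchange a b (a ^ k) (b ^ k))
  where
  exchange : ∀ a b c d → a * b * (c * d) ≡ a * c * (b * d)
  exchange = solve-∀

*-^-≤ : ∀ a b p k → 0 < k → a * (b * p) ^ k ≤ (a * b * p) ^ k
*-^-≤ a b p (suc k) _ = begin
  a * (b * p) ^ suc k         ≤⟨ *-monoˡ-≤ ((b * p) ^ suc k) (n≤n^suc a k) ⟩
  a ^ suc k * (b * p) ^ suc k ≡⟨ ^-distribʳ-* (suc k) a (b * p) ⟨
  (a * (b * p)) ^ suc k       ≡⟨ cong (_^ suc k) (*-assoc a b p) ⟨
  (a * b * p) ^ suc k         ∎
  where open ≤-Reasoning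

-- Eliminates p: the first hypothesis is raised to the power k + 1 and the second to the power k,
-- where both contain p^(k(k+1)).
power-bound : ∀ a b k {n p M} → n ≤ (a * p) ^ k → p ^ (k + 1) ≤ b * M →
  n ^ (k + 1) ≤ (a ^ (k + 1) * b) ^ k * M ^ k
power-bound a b k {n} {p} {M} n≤ p≤ = begin
  n ^ (k + 1)                      ≤⟨ ^-monoˡ-≤ (k + 1) n≤ ⟩
  ((a * p) ^ k) ^ (k + 1)          ≡⟨ ^-*-assoc (a * p) k (k + 1) ⟩
  (a * p) ^ (k * (k + 1))          ≡⟨ cong ((a * p) ^_) (*-comm k (k + 1)) ⟩
  (a * p) ^ ((k + 1) * k)          ≡⟨ ^-*-assoc (a * p) (k + 1) k ⟨
  ((a * p) ^ (k + 1)) ^ k          ≡⟨ cong (_^ k) (^-distribʳ-* (k + 1) a p) ⟩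
  (a ^ (k + 1) * p ^ (k + 1)) ^ k  ≤⟨ ^-monoˡ-≤ k (*-monoʳ-≤ (a ^ (k + 1)) p≤) ⟩
  (a ^ (k + 1) * (b * M)) ^ k      ≡⟨ cong (_^ k) (*-assoc (a ^ (k + 1)) b M) ⟨
  (a ^ (k + 1) * b * M) ^ k        ≡⟨ ^-distribʳ-* k (a ^ (k + 1) * b) M ⟩
  (a ^ (k + 1) * b) ^ k * M ^ k    ∎
  where open ≤-Reasoning

-- Here z₀ is the number of edges between twins that a rainbow cycle of length 2k + z₀ would
-- contain. The constant 3 · 32 comes from `scaled-prime`, and 6 from the orderings of a triangle.
omega-odd : ∀ k → 0 < k → ∀ z₀ → z₀ ≤ 1 → ¬ (2 ∣ k + z₀) → OmegaPow (exTriRainbow (2 * k + z₀)) k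
omega-odd k 0<k z₀ z₀≤1 odd = (3 * 32) ^ (k + 1) * 6 , proj₁ (scaled-prime k 0<k) , bound
  where
  bound : ∀ n → proj₁ (scaled-prime k 0<k) ≤ n → ∀ M → exTriRainbow (2 * k + z₀) n M →
    n ^ (k + 1) ≤ ((3 * 32) ^ (k + 1) * 6) ^ k * M ^ k
  bound n N≤n M isMax with proj₂ (scaled-prime k 0<k) n N≤n
  ... | p , pp , _ , 3p^k≤n , n≤ = power-bound (3 * 32) 6 k (≤-trans n≤ (*-^-≤ 3 32 p k 0<k)) p^[k+1]≤6M
    where
    open ≤-Reasoning
    open Construction p pp k
    t≤M : triangleCount G ≤ M
    t≤M = max-TriRainbowFree-≥ {l = 2 * k + z₀} isMax 3p^k≤n (G , c , no-rainbow-cycle p pp k 0<k z₀ z₀≤1 odd , refl)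
    p^[k+1]≤6M : p ^ (k + 1) ≤ 6 * M
    p^[k+1]≤6M = begin
      p ^ (k + 1)         ≡⟨ ^-distribˡ-+-* p k 1 ⟩
      p ^ k * (p * 1)     ≡⟨ cong (p ^ k *_) (*-identityʳ p) ⟩
      p ^ k * p           ≤⟨ triangles 0<k ⟩
      6 * triangleCount G ≤⟨ *-monoʳ-≤ 6 t≤M ⟩
      6 * M               ∎

-- Paths and the cycles they close

lookup-injective : ∀ {A : Set} {xs : List A} → Unique xs → ∀ {i j} → lookup xs i ≡ lookup xs j → i ≡ j
lookup-injective (_ ∷ _) {zero} {zero} _ = refl
lookup-injective (x∉ ∷ _) {zero} {suc j} eq = ⊥-elim (All.lookup x∉ (∈-lookup j) eq)
lookup-injective (x∉ ∷ _) {suc i} {zero} eq = ⊥-elim (All.lookup x∉ (∈-lookup i) (≡-sym eq))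
lookup-injective (_ ∷ u) {suc i} {suc j} eq = cong suc (lookup-injective u eq)

-- Paths grow at their start while the end `y` stays fixed. The list omits the start, so its length
-- is the number of edges.
data Path {n} (G : Graph n) (y : Fin n) : Fin n → List (Fin n) → Set where
  stop : Path G y y []
  step : ∀ {w x vs} → Edge G w x → w ∉ x ∷ vs → Path G y x vs → Path G y w (x ∷ vs)

module _ {n : ℕ} {G : Graph n} where

  path-unique : ∀ {x y vs} → Path G y x vs → Unique (x ∷ vs)
  path-unique stop = [] ∷ []
  path-unique (step _ w∉ path) = ¬Any⇒All¬ _ w∉ ∷ path-unique path

  path-last : ∀ {x y vs} → Path G y x vs → ∀ i → toℕ i ≡ length vs → lookup (x ∷ vs) i ≡ y
  path-last stop zero _ = refl
  path-last (step _ _ path) (suc i) eq = path-last path i (suc-injective eq)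

  path-edge : ∀ {x y vs} → Path G y x vs → ∀ i j → suc (toℕ i) ≡ toℕ j →
    Edge G (lookup (x ∷ vs) i) (lookup (x ∷ vs) j)
  path-edge (step wx _ _) zero (suc zero) _ = wx
  path-edge (step _ _ path) (suc i) (suc j) eq = path-edge path i j (suc-injective eq)

  path-cycle : ∀ {x y vs} → Path G y x vs → Edge G y x → CycleMap G (suc (length vs)) (lookup (x ∷ vs))
  path-cycle {x} {y} {vs} path yx = (λ {i} {j} → lookup-injective (path-unique path) {i} {j}) , edges
    where
    edges : ∀ i j → CycAdj (suc (length vs)) i j → Edge G (lookup (x ∷ vs) i) (lookup (x ∷ vs) j)
    edges i j (inj₁ eq) = path-edge path i j eq
    edges i zero (inj₂ (eq , refl)) = subst (λ v → Edge G v x) (≡-sym (path-last path i (suc-injective eq))) yx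

  module _ (c : ProperColouring G) where

    colours : Fin n → List (Fin n) → List ℕ
    colours x [] = []
    colours w (x ∷ vs) = col c w x ∷ colours x vs

    length-colours : ∀ x vs → length (colours x vs) ≡ length vs
    length-colours x [] = refl
    length-colours w (x ∷ vs) = cong suc (length-colours x vs)

    colours-lookup : ∀ x vs i j → suc (toℕ i) ≡ toℕ j →
      ∃[ e ] (toℕ e ≡ toℕ i × lookup (colours x vs) e ≡ col c (lookup (x ∷ vs) i) (lookup (x ∷ vs) j))
    colours-lookup w (x ∷ vs) zero (suc zero) _ = zero , refl , refl
    colours-lookup w (x ∷ vs) (suc i) (suc j) eq with colours-lookup x vs i j (suc-injective eq)
    ... | e , e≡i , eq′ = suc e , cong suc e≡i , eq′

    path-rainbow-cycle : ∀ {x y vs} → Path G y x vs → Edge G y x →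
      Unique (colours x vs) → col c y x ∉ colours x vs → HasRainbowCycle G c (suc (length vs))
    path-rainbow-cycle {x} {y} {vs} path yx unique yx∉ = lookup (x ∷ vs) , path-cycle path yx , rainbow
      where
      f = lookup (x ∷ vs)
      last-colour : ∀ i (j : Fin (suc (length vs))) → suc (toℕ i) ≡ suc (length vs) → toℕ j ≡ 0 → col c (f i) (f j) ≡ col c y x
      last-colour i zero eq _ = cong (λ v → col c v x) (path-last path i (suc-injective eq))
      rainbow : ∀ i j i′ j′ → CycAdj _ i j → CycAdj _ i′ j′ → i ≢ i′ → col c (f i) (f j) ≢ col c (f i′) (f j′)
      rainbow i j i′ j′ (inj₁ s) (inj₁ s′) i≢i′ eq
        with colours-lookup x vs i j s | colours-lookup x vs i′ j′ s′
      ... | e , e≡ , ce | e′ , e′≡ , ce′ = i≢i′ (toℕ-injective (trans (≡-sym e≡) (trans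
        (cong toℕ (lookup-injective unique {e} {e′} (trans ce (trans eq (≡-sym ce′))))) e′≡)))
      rainbow i j i′ j′ (inj₁ s) (inj₂ (l , z)) i≢i′ eq with colours-lookup x vs i j s
      ... | e , _ , ce = yx∉ (subst (_∈ colours x vs) (trans ce (trans eq (last-colour i′ j′ l z))) (∈-lookup e))
      rainbow i j i′ j′ (inj₂ (l , z)) (inj₁ s′) i≢i′ eq with colours-lookup x vs i′ j′ s′
      ... | e , _ , ce = yx∉ (subst (_∈ colours x vs) (trans ce (trans (≡-sym eq) (last-colour i j l z))) (∈-lookup e))
      rainbow i j i′ j′ (inj₂ (l , _)) (inj₂ (l′ , _)) i≢i′ _ =
        i≢i′ (toℕ-injective (suc-injective (trans l (≡-sym l′))))

-- Rainbow cycles when every edge lies in many triangles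

bit-true : ∀ {b} → b ≡ true → bit b ≡ 1
bit-true refl = refl

∧-true : ∀ {a b} → a ∧ b ≡ true → a ≡ true × b ≡ true
∧-true {true} {true} _ = refl , refl

⌊⌋-true : ∀ {P : Set} {P? : Dec P} → ⌊ P? ⌋ ≡ true → P
⌊⌋-true {P? = yes p} _ = p

true-⌊⌋ : ∀ {P : Set} {P? : Dec P} → P → ⌊ P? ⌋ ≡ true
true-⌊⌋ {P? = yes _} _ = refl
true-⌊⌋ {P? = no ¬p} p = ⊥-elim (¬p p)

module _ {n : ℕ} where

  AtMostOne : (Fin n → Bool) → Set
  AtMostOne Q = ∀ {i j} → Q i ≡ true → Q j ≡ true → i ≡ j

  ΣFin-AtMostOne : ∀ {Q} → AtMostOne Q → ΣFin n (bit ∘ Q) ≤ 1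
  ΣFin-AtMostOne {Q} unique with any? (λ i → Q i Bool.≟ true)
  ... | yes (i₀ , Qi₀) = ≤-trans (ΣFin-mono n λ i → below i (Q i) refl) (ΣFin-eqBit-≤ i₀)
    where
    below : ∀ i q → Q i ≡ q → bit q ≤ eqBit i₀ i
    below i false _ = z≤n
    below i true Qi with unique Qi Qi₀
    ... | refl = ≤-reflexive (≡-sym (eqBit-refl i))
  ... | no none = ≤-trans (ΣFin-≤-const n 0 λ i → below i (Q i) refl) (≤-trans (≤-reflexive (*-zeroʳ n)) z≤n)
    where
    below : ∀ i q → Q i ≡ q → bit q ≤ 0
    below i false _ = z≤n
    below i true Qi = ⊥-elim (none (i , Qi))

  ΣFin-cover : ∀ {P Qs} → All AtMostOne Qs → (∀ i → P i ≡ true → Any (λ Q → Q i ≡ true) Qs) →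
    ΣFin n (bit ∘ P) ≤ length Qs
  ΣFin-cover {P} {Qs} unique cover =
    ≤-trans (ΣFin-mono n λ i → covered i (P i) refl) (total Qs unique)
    where
    hits : List (Fin n → Bool) → Fin n → ℕ
    hits Qs i = sum (map (λ Q → bit (Q i)) Qs)
    hit : ∀ {i Qs} → Any (λ Q → Q i ≡ true) Qs → 1 ≤ hits Qs i
    hit (here Qi) = ≤-trans (≤-reflexive (≡-sym (bit-true Qi))) (m≤m+n _ _)
    hit (there any) = ≤-trans (hit any) (m≤n+m _ _)
    covered : ∀ i q → P i ≡ q → bit q ≤ hits Qs i
    covered i false _ = z≤n
    covered i true Pi = hit (cover i Pi)
    total : ∀ Qs → All AtMostOne Qs → ΣFin n (hits Qs) ≤ length Qs
    total [] _ = ≤-reflexive (trans (ΣFin-const n 0) (*-zeroʳ n))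
    total (Q ∷ Qs) (u ∷ us) = ≤-trans (≤-reflexive (ΣFin-+ n (bit ∘ Q) (hits Qs)))
      (+-mono-≤ (ΣFin-AtMostOne {Q} u) (total Qs us))

  -- Each excluded class contains at most one index, so more candidates than classes leave one
  -- outside all of them.
  avoid : ∀ {P Qs} → All AtMostOne Qs → length Qs < ΣFin n (bit ∘ P) →
    ∃[ i ] (P i ≡ true × ¬ Any (λ Q → Q i ≡ true) Qs)
  avoid {P} {Qs} unique big
    with any? (λ i → (P i Bool.≟ true) ×-dec ¬? (Any.any? (λ Q → Q i Bool.≟ true) Qs))
  ... | yes found = found
  ... | no none = ⊥-elim (<⇒≱ big (ΣFin-cover {P} {Qs} unique λ i Pi →
    Dec.decidable-stable (Any.any? (λ Q → Q i Bool.≟ true) Qs) λ ¬any → none (i , Pi , ¬any)))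

module _ {n : ℕ} (G : Graph n) where

  common : Fin n → Fin n → Fin n → Bool
  common a b w = adj G a w ∧ adj G b w

  codegree : Fin n → Fin n → ℕ
  codegree a b = ΣFin n (bit ∘ common a b)

  codegree-sym : ∀ a b → codegree a b ≡ codegree b a
  codegree-sym a b = ΣFin-cong n λ w → cong bit (∧-comm (adj G a w) (adj G b w))

  -- A path whose ends lie in many triangles extends by a common neighbour of its two ends.
  module _ (c : ProperColouring G) (D : ℕ) (rich : ∀ {x y} → Edge G x y → D < codegree x y) where

    extend-rainbow : ∀ {x y vs} → Path G y x vs → Edge G x y → Unique (colours c x vs) →
      3 * suc (length vs) ≤ D →
      ∃[ w ] (Path G y w (x ∷ vs) × Edge G w y × Unique (colours c w (x ∷ vs)) × col c y w ∉ colours c w (x ∷ vs))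
    extend-rainbow {x} {y} {vs} path xy unique small = w , step wx w∉ path , wy ,
      ¬Any⇒All¬ _ wx∉ ∷ unique , λ { (here eq) → yw≢wx eq ; (there yw∈) → yw∉ yw∈ }
      where
      cs = colours c x vs
      ofVertex : Fin n → Fin n → Bool
      ofVertex v w = ⌊ w Fin.≟ v ⌋
      ofColour : Fin n → ℕ → Fin n → Bool
      ofColour z k w = adj G z w ∧ ⌊ col c z w ≟ k ⌋
      -- The bad choices of w: a vertex of the path, or a vertex whose edge to x or to y repeats a
      -- colour of the path. By properness each vertex and each colour excludes at most one w, which
      -- gives at most 3(l + 1) exclusions for a path with l edges.
      Qs : List (Fin n → Bool)
      Qs = map ofVertex (x ∷ vs) ++ (map (ofColour x) cs ++ map (ofColour y) cs)
      ofColour-unique : ∀ z k → AtMostOne (ofColour z k)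
      ofColour-unique z k {i} {j} Qi Qj with i Fin.≟ j | ∧-true {adj G z i} Qi | ∧-true {adj G z j} Qj
      ... | yes i≡j | _ | _ = i≡j
      ... | no i≢j | zi , ci | zj , cj = ⊥-elim (proper c z i j zi zj i≢j
        (trans (⌊⌋-true {P? = col c z i ≟ k} ci) (≡-sym (⌊⌋-true {P? = col c z j ≟ k} cj))))
      Qs-unique : All AtMostOne Qs
      Qs-unique = All-++⁺
        (All-map⁺ (All.universal (λ v {i} {j} ei ej →
          trans (⌊⌋-true {P? = i Fin.≟ v} ei) (≡-sym (⌊⌋-true {P? = j Fin.≟ v} ej))) (x ∷ vs)))
        (All-++⁺ (All-map⁺ (All.universal (λ k {i} {j} → ofColour-unique x k {i} {j}) cs))
                 (All-map⁺ (All.universal (λ k {i} {j} → ofColour-unique y k {i} {j}) cs)))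
      length-Qs : length Qs ≤ D
      length-Qs = ≤-trans (≤-reflexive (trans (length-++ (map ofVertex (x ∷ vs)))
        (cong₂ _+_ (length-map ofVertex (x ∷ vs))
          (trans (length-++ (map (ofColour x) cs)) (cong₂ _+_
            (trans (length-map (ofColour x) cs) (length-colours c x vs))
            (trans (length-map (ofColour y) cs) (length-colours c x vs)))))))
        (≤-trans (≤-trans (m≤m+n _ 2) (≤-reflexive (count (length vs)))) small)
        where
        count : ∀ l → suc l + (l + l) + 2 ≡ 3 * suc l
        count = solve-∀
      good = avoid {P = common x y} Qs-unique (≤-<-trans length-Qs (rich xy))
      w = proj₁ good
      xw = proj₁ (∧-true {adj G x w} (proj₁ (proj₂ good)))
      yw = proj₂ (∧-true {adj G x w} (proj₁ (proj₂ good)))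
      wx = adj-sym G xw
      wy = adj-sym G yw
      ¬Qs : ¬ Any (λ Q → Q w ≡ true) Qs
      ¬Qs = proj₂ (proj₂ good)
      w∉ : w ∉ x ∷ vs
      w∉ w∈ = ¬Qs (Any-++⁺ˡ (Any-map⁺ (Any.map (λ {v} w≡v → true-⌊⌋ {P? = w Fin.≟ v} w≡v) w∈)))
      colour∉ : ∀ z → Edge G z w → (Any (λ Q → Q w ≡ true) (map (ofColour z) cs) → ⊥) → col c z w ∉ cs
      colour∉ z zw ¬Q z∈ = ¬Q (Any-map⁺ (Any.map
        (λ {k} e → trans (cong (_∧ ⌊ col c z w ≟ k ⌋) zw) (true-⌊⌋ {P? = col c z w ≟ k} e)) z∈))
      wx∉ : col c w x ∉ cs
      wx∉ wx∈ = colour∉ x xw (λ any → ¬Qs (Any-++⁺ʳ (map ofVertex (x ∷ vs)) (Any-++⁺ˡ any)))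
        (subst (_∈ cs) (colSym c w x) wx∈)
      yw∉ : col c y w ∉ cs
      yw∉ = colour∉ y yw λ any → ¬Qs (Any-++⁺ʳ (map ofVertex (x ∷ vs)) (Any-++⁺ʳ (map (ofColour x) cs) any))
      yw≢wx : col c y w ≢ col c w x
      yw≢wx eq = proper c w y x wy wx (λ y≡x → adj⇒≢ G xy (≡-sym y≡x)) (trans (colSym c w y) eq)

    rainbow-path : ∀ {a b} → Edge G a b → ∀ l → 3 * (2 + l) ≤ D →
      ∃[ x ] ∃[ y ] ∃[ vs ] (Path G y x vs × Edge G x y × Unique (colours c x vs) ×
        col c y x ∉ colours c x vs × length vs ≡ 2 + l)
    rainbow-path {a} {b} ab zero small
      -- The start is degenerate: ab is both the path and the closing edge. The extension keeps the
      -- path and replaces the closing edge, so a triangle results.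
      with extend-rainbow {a} {b} {b ∷ []} (step ab (λ { (here eq) → adj⇒≢ G ab eq }) stop) ab ([] ∷ []) small
    ... | w , path , wb , unique , wb∉ = w , b , a ∷ b ∷ [] , path , wb , unique , wb∉ , refl
    rainbow-path ab (suc l) small with rainbow-path ab l (≤-trans (*-monoʳ-≤ 3 (n≤1+n (2 + l))) small)
    ... | x , y , vs , path , xy , unique , _ , len
      with extend-rainbow path xy unique (subst (λ l → 3 * suc l ≤ D) (≡-sym len) small)
    ... | w , path′ , wy , unique′ , wy∉ = w , y , x ∷ vs , path′ , wy , unique′ , wy∉ , cong suc len

    rich⇒rainbow-cycle : ∀ {a b} → Edge G a b → ∀ l → 3 * (2 + l) ≤ D → HasRainbowCycle G c (3 + l)
    rich⇒rainbow-cycle ab l small with rainbow-path ab l small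
    ... | x , y , vs , path , xy , unique , yx∉ , len =
      subst (HasRainbowCycle G c) (cong suc len) (path-rainbow-cycle c path (adj-sym G xy) unique yx∉)

-- Deleting an edge that lies in few triangles

bit-∧₅-≤ : ∀ a b c d e {m} →
  (a ≡ true → b ≡ true → c ≡ true → d ≡ true → e ≡ true → 1 ≤ m) → bit (a ∧ b ∧ c ∧ d ∧ e) ≤ m
bit-∧₅-≤ true true c d e 1≤m = bit-∧₃-≤ c d e (1≤m refl refl)
bit-∧₅-≤ false _ _ _ _ _ = z≤n
bit-∧₅-≤ true false _ _ _ _ = z≤n

∧-intro : ∀ {a b} → a ≡ true → b ≡ true → a ∧ b ≡ true
∧-intro refl refl = refl

not-true⇒false : ∀ {b} → ¬ (b ≡ true) → b ≡ false
not-true⇒false {true} ¬t = ⊥-elim (¬t refl)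
not-true⇒false {false} _ = refl

ΣFin-eqBit-* : ∀ {n} (x : Fin n) c → ΣFin n (λ i → eqBit x i * c) ≤ c
ΣFin-eqBit-* {n} x c = begin
  ΣFin n (λ i → eqBit x i * c) ≡⟨ ΣFin-cong n (λ i → *-comm (eqBit x i) c) ⟩
  ΣFin n (λ i → c * eqBit x i) ≡⟨ ΣFin-*ˡ n c (eqBit x) ⟩
  c * ΣFin n (eqBit x)         ≤⟨ *-monoʳ-≤ c (ΣFin-eqBit-≤ x) ⟩
  c * 1                        ≡⟨ *-identityʳ c ⟩
  c                            ∎
  where open ≤-Reasoning

lt⇒< : ∀ {n} {u v : Fin n} → lt u v ≡ true → toℕ u < toℕ v
lt⇒< {u = u} {v} e = <ᵇ⇒< (toℕ u) (toℕ v) (subst T (≡-sym e) tt)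

module Deletion {n : ℕ} (G : Graph n) (a b : Fin n) (ab : Edge G a b) (a<b : toℕ a < toℕ b) where

  isAB : Fin n → Fin n → Bool
  isAB u v = ⌊ u Fin.≟ a ⌋ ∧ ⌊ v Fin.≟ b ⌋

  deleted : Graph n
  deleted = record
    { adj = λ u v → adj G u v ∧ not (isAB u v ∨ isAB v u)
    ; sym = λ u v → cong₂ _∧_ (Graph.sym G u v) (cong not (∨-comm (isAB u v) (isAB v u)))
    ; irrefl = λ u → cong (_∧ not (isAB u u ∨ isAB u u)) (irrefl G u) }

  deleted⊆ : ∀ {u v} → Edge deleted u v → Edge G u v
  deleted⊆ uv = proj₁ (∧-true uv)

  deletedColouring : ProperColouring G → ProperColouring deleted
  deletedColouring c = record
    { col = col c ; colSym = colSym c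
    ; proper = λ u v w uv uw → proper c u v w (deleted⊆ uv) (deleted⊆ uw) }

  deleted-HasRainbowCycle : ∀ {c l} → HasRainbowCycle deleted (deletedColouring c) l → HasRainbowCycle G c l
  deleted-HasRainbowCycle (f , (inj , edges) , rainbow) = f , (inj , λ i j ij → deleted⊆ (edges i j ij)) , rainbow

  isAB⇒ : ∀ {u v} → isAB u v ≡ true → u ≡ a × v ≡ b
  isAB⇒ {u} {v} e = ⌊⌋-true {P? = u Fin.≟ a} (proj₁ (∧-true e)) ,
    ⌊⌋-true {P? = v Fin.≟ b} (proj₂ (∧-true {⌊ u Fin.≟ a ⌋} e))

  kept : ∀ {u v} → toℕ u < toℕ v → Edge G u v → ¬ (u ≡ a × v ≡ b) → Edge deleted u v
  kept {u} {v} u<v uv ≢ab = ∧-intro uv (cong not (cong₂ _∨_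
    (not-true⇒false (≢ab ∘ isAB⇒))
    (not-true⇒false {isAB v u} λ e → case isAB⇒ {v} {u} e of λ { (refl , refl) → <-asym u<v a<b })))

  edgeCount-deleted : suc (edgeCount deleted) ≤ edgeCount G
  edgeCount-deleted = begin
    1 + edgeCount deleted
      ≤⟨ +-monoˡ-≤ (edgeCount deleted) one-≤ ⟩
    ΣFin n (λ u → ΣFin n λ v → eqBit a u * eqBit b v) + edgeCount deleted
      ≡⟨ trans (ΣFin-cong n λ u → ΣFin-+ n (λ v → eqBit a u * eqBit b v) _) (ΣFin-+ n _ _) ⟨
    ΣFin n (λ u → ΣFin n λ v → eqBit a u * eqBit b v + bit (lt u v ∧ adj deleted u v))
      ≤⟨ ΣFin-mono n (λ u → ΣFin-mono n λ v → pointwise u v) ⟩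
    edgeCount G ∎
    where
    open ≤-Reasoning
    one-≤ : 1 ≤ ΣFin n (λ u → ΣFin n λ v → eqBit a u * eqBit b v)
    one-≤ = ≤-trans (≤-reflexive (≡-sym (cong₂ _*_ (eqBit-refl a) (eqBit-refl b))))
      (≤-trans (ΣFin-≥-term n (λ v → eqBit a a * eqBit b v) b)
        (ΣFin-≥-term n (λ u → ΣFin n λ v → eqBit a u * eqBit b v) a))
    weaken : ∀ l e x → bit (l ∧ e ∧ x) ≤ bit (l ∧ e)
    weaken true true x = bit-≤1 x
    weaken true false x = z≤n
    weaken false e x = z≤n
    pointwise : ∀ u v → eqBit a u * eqBit b v + bit (lt u v ∧ adj deleted u v) ≤ bit (lt u v ∧ adj G u v)
    pointwise u v with u Fin.≟ a | v Fin.≟ b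
    ... | no _ | _ = weaken (lt u v) (adj G u v) _
    ... | yes _ | no _ = weaken (lt u v) (adj G u v) _
    ... | yes refl | yes refl rewrite <⇒lt G a<b | ab = ≤-refl

  -- A lost triangle u < v < w contains ab as uv, uw or vw, and its third vertex is a common
  -- neighbour of a and b; `T₁`, `T₂` and `T₃` count these three positions.
  triangleCount-deleted : triangleCount G ≤ triangleCount deleted + 3 * codegree G a b
  triangleCount-deleted = begin
    triangleCount G
      ≤⟨ ΣFin-mono n (λ u → ΣFin-mono n λ v → ΣFin-mono n λ w → pointwise u v w) ⟩
    ΣFin n (λ u → ΣFin n λ v → ΣFin n λ w → sortedTriangle deleted u v w + (T₁ u v w + (T₂ u v w + T₃ u v w)))
      ≡⟨ trans (Σ³-+ _ _) (cong (triangleCount deleted +_) (trans (Σ³-+ T₁ _) (cong (Σ³ T₁ +_) (Σ³-+ T₂ T₃)))) ⟩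
    triangleCount deleted + (Σ³ T₁ + (Σ³ T₂ + Σ³ T₃))
      ≤⟨ +-monoʳ-≤ (triangleCount deleted) (+-mono-≤ ΣT₁ (+-mono-≤ ΣT₂ (≤-trans ΣT₃ (m≤m+n _ 0)))) ⟩
    triangleCount deleted + 3 * codegree G a b ∎
    where
    open ≤-Reasoning
    co : Fin n → ℕ
    co = bit ∘ common G a b
    T₁ T₂ T₃ : Fin n → Fin n → Fin n → ℕ
    T₁ u v w = eqBit a u * (eqBit b v * co w)
    T₂ u v w = eqBit a u * (eqBit b w * co v)
    T₃ u v w = eqBit a v * (eqBit b w * co u)
    Σ³ : (Fin n → Fin n → Fin n → ℕ) → ℕ
    Σ³ f = ΣFin n λ u → ΣFin n λ v → ΣFin n λ w → f u v w
    Σ³-+ : ∀ f g → Σ³ (λ u v w → f u v w + g u v w) ≡ Σ³ f + Σ³ g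
    Σ³-+ f g = trans (ΣFin-cong n λ u → trans (ΣFin-cong n λ v → ΣFin-+ n (f u v) (g u v))
      (ΣFin-+ n (λ v → ΣFin n (f u v)) (λ v → ΣFin n (g u v)))) (ΣFin-+ n _ _)
    inner : ∀ e x → ΣFin n (λ w → e * (eqBit b w * x)) ≤ e * x
    inner e x = ≤-trans (≤-reflexive (ΣFin-*ˡ n e (λ w → eqBit b w * x))) (*-monoʳ-≤ e (ΣFin-eqBit-* b x))
    ΣT₁ : Σ³ T₁ ≤ codegree G a b
    ΣT₁ = ≤-trans (ΣFin-mono n λ u → ≤-trans (ΣFin-mono n λ v → ≤-reflexive
        (trans (ΣFin-*ˡ n (eqBit a u) (λ w → eqBit b v * co w)) (cong (eqBit a u *_) (ΣFin-*ˡ n (eqBit b v) co))))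
        (inner (eqBit a u) (codegree G a b)))
      (ΣFin-eqBit-* a (codegree G a b))
    ΣT₂ : Σ³ T₂ ≤ codegree G a b
    ΣT₂ = ≤-trans (ΣFin-mono n λ u → ≤-trans (ΣFin-mono n λ v → inner (eqBit a u) (co v))
        (≤-reflexive (ΣFin-*ˡ n (eqBit a u) co)))
      (ΣFin-eqBit-* a (codegree G a b))
    ΣT₃ : Σ³ T₃ ≤ codegree G a b
    ΣT₃ = ΣFin-mono n λ u → ≤-trans (ΣFin-mono n λ v → inner (eqBit a v) (co u)) (ΣFin-eqBit-* a (co u))
    found : ∀ {x} m → Edge G a x → Edge G b x → 1 ≤ eqBit a a * (eqBit b b * co x) + m
    found m ax bx rewrite eqBit-refl a | eqBit-refl b | ax | bx = s≤s z≤n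
    pointwise : ∀ u v w → sortedTriangle G u v w ≤ sortedTriangle deleted u v w + (T₁ u v w + (T₂ u v w + T₃ u v w))
    pointwise u v w = bit-∧₅-≤ (lt u v) (lt v w) (adj G u v) (adj G v w) (adj G u w) present
      where
      present : lt u v ≡ true → lt v w ≡ true → Edge G u v → Edge G v w → Edge G u w →
        1 ≤ sortedTriangle deleted u v w + (T₁ u v w + (T₂ u v w + T₃ u v w))
      present luv lvw uv vw uw
        with (u Fin.≟ a) ×-dec (v Fin.≟ b) | (u Fin.≟ a) ×-dec (w Fin.≟ b) | (v Fin.≟ a) ×-dec (w Fin.≟ b)
      ... | yes (refl , refl) | _ | _ = m≤n⇒m≤o+n (sortedTriangle deleted u v w) (found _ uw vw)
      ... | _ | yes (refl , refl) | _ = m≤n⇒m≤o+n (sortedTriangle deleted u v w) (m≤n⇒m≤o+n (T₁ u v w)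
        (found _ uv (adj-sym G vw)))
      ... | _ | _ | yes (refl , refl) = m≤n⇒m≤o+n (sortedTriangle deleted u v w) (m≤n⇒m≤o+n (T₁ u v w)
        (m≤n⇒m≤o+n (T₂ u v w) (subst (1 ≤_) (+-identityʳ _) (found 0 (adj-sym G uv) (adj-sym G uw)))))
      ... | no ¬uv | no ¬uw | no ¬vw = ≤-trans (≤-reflexive (≡-sym (sortedTriangle-true deleted u<v v<w
        (kept u<v uv ¬uv) (kept v<w vw ¬vw) (kept (<-trans u<v v<w) uw ¬uw)))) (m≤m+n _ _)
        where
        u<v = lt⇒< luv
        v<w = lt⇒< lvw

triangles-≤-edges : ∀ {n} D l → 3 * (2 + l) ≤ D → (G : Graph n) (c : ProperColouring G) →
  ¬ HasRainbowCycle G c (3 + l) → triangleCount G ≤ 3 * D * edgeCount G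
triangles-≤-edges {n} D l small G c free = go (edgeCount G) G c free ≤-refl
  where
  edgeless : ∀ (G : Graph n) → (∀ u v → ¬ Edge G u v) → triangleCount G ≤ 0
  edgeless G none = zero-sum λ u → zero-sum λ v → zero-sum λ w →
    bit-∧₅-≤ (lt u v) (lt v w) (adj G u v) (adj G v w) (adj G u w) λ _ _ uv _ _ → ⊥-elim (none u v uv)
    where
    zero-sum : ∀ {f : Fin n → ℕ} → (∀ i → f i ≤ 0) → ΣFin n f ≤ 0
    zero-sum f≤0 = ≤-trans (ΣFin-≤-const n 0 f≤0) (≤-reflexive (*-zeroʳ n))
  go : ∀ N (G : Graph n) (c : ProperColouring G) → ¬ HasRainbowCycle G c (3 + l) → edgeCount G ≤ N →
    triangleCount G ≤ 3 * D * edgeCount G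
  go N G c free e≤N
    with any? (λ a → any? (λ b → (adj G a b Bool.≟ true) ×-dec ((toℕ a <? toℕ b) ×-dec (codegree G a b ≤? D))))
  go zero G c free e≤0 | yes (a , b , ab , a<b , poor) = ⊥-elim (<⇒≱ edgeCount-deleted (≤-trans e≤0 z≤n))
    where open Deletion G a b ab a<b
  go (suc N) G c free e≤N | yes (a , b , ab , a<b , poor) = begin
    triangleCount G                              ≤⟨ triangleCount-deleted ⟩
    triangleCount deleted + 3 * codegree G a b   ≤⟨ +-mono-≤ ih (*-monoʳ-≤ 3 poor) ⟩
    3 * D * edgeCount deleted + 3 * D            ≡⟨ trans (*-suc (3 * D) (edgeCount deleted)) (+-comm (3 * D) _) ⟨
    3 * D * suc (edgeCount deleted)              ≤⟨ *-monoʳ-≤ (3 * D) edgeCount-deleted ⟩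
    3 * D * edgeCount G                          ∎
    where
    open ≤-Reasoning
    open Deletion G a b ab a<b
    ih = go N deleted (deletedColouring c) (free ∘ deleted-HasRainbowCycle {c})
      (≤-pred (≤-trans edgeCount-deleted e≤N))
  -- Now every edge has codegree above D, so even one edge would grow into a rainbow cycle.
  go N G c free e≤N | no none with any? (λ a → any? (λ b → adj G a b Bool.≟ true))
  ... | no noEdge = ≤-trans (edgeless G λ u v uv → noEdge (u , v , uv)) z≤n
  ... | yes (a , b , ab) = ⊥-elim (free (rich⇒rainbow-cycle G c D rich ab l small))
    where
    rich : ∀ {x y} → Edge G x y → D < codegree G x y
    rich {x} {y} xy with <-cmp (toℕ x) (toℕ y)
    ... | tri< x<y _ _ = ≰⇒> λ poor → none (x , y , xy , x<y , poor)
    ... | tri≈ _ x≡y _ = ⊥-elim (adj⇒≢ G xy (toℕ-injective x≡y))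
    ... | tri> _ _ y<x = subst (D <_) (codegree-sym G y x)
      (≰⇒> λ poor → none (y , x , adj-sym G xy , y<x , poor))

bigO-exStar : ∀ l → BigO (exTriRainbow (3 + l)) (exStar (3 + l))
bigO-exStar l = 3 * (3 * (2 + l)) , 0 , bound
  where
  bound : ∀ n → 0 ≤ n → ∀ a b → exTriRainbow (3 + l) n a → exStar (3 + l) n b → a ≤ 3 * (3 * (2 + l)) * b
  bound n _ a b ((G , c , free , refl) , _) (_ , max) =
    ≤-trans (triangles-≤-edges (3 * (2 + l)) l ≤-refl G c free)
      (*-monoʳ-≤ (3 * (3 * (2 + l))) (max _ (G , c , free , refl)))

-- From uncoloured to coloured graphs

-- A graph without C_m has no rainbow C_m under any proper colouring; this one is proper because the
-- colour and one end determine the other end.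
sumColouring : ∀ {n} (G : Graph n) → ProperColouring G
sumColouring G = record
  { col = λ u v → toℕ u + toℕ v
  ; colSym = λ u v → +-comm (toℕ u) (toℕ v)
  ; proper = λ u v w _ _ v≢w eq → v≢w (toℕ-injective (+-cancelˡ-≡ (toℕ u) _ _ eq)) }

geqAll-exTri : ∀ m → GeqAll (exTriRainbow m) (exTri m)
geqAll-exTri m n a b (_ , max) ((G , free , refl) , _) =
  max _ (G , sumColouring G , (λ (f , cyc , _) → free (f , cyc)) , refl)

-- Bipartite subgraphs and twins

xorBit-≤ : ∀ s t → 1 ≤ bit (s xor t) + bit (not s xor t)
xorBit-≤ true true = ≤-refl
xorBit-≤ true false = ≤-refl
xorBit-≤ false true = ≤-refl
xorBit-≤ false false = ≤-refl

-- Greedy choice: the new vertex joins the side on which at least half of the weight between it and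
-- the earlier vertices is cut. The weight counts both directions, since `w` need not be symmetric.
max-cut : ∀ n (w : Fin n → Fin n → ℕ) → (∀ u → w u u ≡ 0) →
  Σ[ side ∈ (Fin n → Bool) ] (ΣFin n (λ u → ΣFin n (w u)) ≤ 2 * ΣFin n (λ u → ΣFin n λ v → bit (side u xor side v) * w u v))
max-cut zero w _ = (λ ()) , z≤n
max-cut (suc n) w diag with max-cut n (λ u v → w (suc u) (suc v)) (diag ∘ suc)
... | side , ih = side′ , (begin
  ΣFin (suc n) (λ u → ΣFin (suc n) (w u))
    ≡⟨ split w ⟩
  w zero zero + (ΣFin n star + W)
    ≡⟨ cong (_+ (ΣFin n star + W)) (diag zero) ⟩
  ΣFin n star + W
    ≤⟨ +-mono-≤ star-≤ ih ⟩
  2 * starCut s₀ + 2 * W′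
    ≡⟨ *-distribˡ-+ 2 (starCut s₀) W′ ⟨
  2 * (starCut s₀ + W′)
    ≤⟨ *-monoʳ-≤ 2 cut-≥ ⟩
  2 * ΣFin (suc n) (λ u → ΣFin (suc n) (cutWeight u)) ∎)
  where
  open ≤-Reasoning
  split : ∀ (w : Fin (suc n) → Fin (suc n) → ℕ) → ΣFin (suc n) (λ u → ΣFin (suc n) (w u)) ≡
    w zero zero + (ΣFin n (λ v → w zero (suc v) + w (suc v) zero) + ΣFin n (λ u → ΣFin n (λ v → w (suc u) (suc v))))
  split w = trans (ΣFin-suc n (λ u → ΣFin (suc n) (w u))) (trans (cong₂ _+_ (ΣFin-suc n (w zero))
    (trans (ΣFin-cong n λ u → ΣFin-suc n (w (suc u))) (ΣFin-+ n _ _)))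
    (trans (rearrange (w zero zero) _ _ _) (cong (λ x → w zero zero + (x + ΣFin n (λ u → ΣFin n (λ v → w (suc u) (suc v))))) (≡-sym (ΣFin-+ n _ _)))))
    where
    rearrange : ∀ a b c d → a + b + (c + d) ≡ a + (b + c + d)
    rearrange = solve-∀
  star : Fin n → ℕ
  star v = w zero (suc v) + w (suc v) zero
  W = ΣFin n (λ u → ΣFin n (λ v → w (suc u) (suc v)))
  W′ = ΣFin n (λ u → ΣFin n (λ v → bit (side u xor side v) * w (suc u) (suc v)))
  starCut : Bool → ℕ
  starCut s = ΣFin n (λ v → bit (s xor side v) * star v)
  both : ΣFin n star ≤ starCut true + starCut false
  both = ≤-trans (ΣFin-mono n λ v → ≤-trans (≤-reflexive (≡-sym (*-identityˡ (star v))))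
      (≤-trans (*-monoˡ-≤ (star v) (xorBit-≤ true (side v))) (≤-reflexive (*-distribʳ-+ (star v) (bit (true xor side v)) _))))
    (≤-reflexive (ΣFin-+ n _ _))
  choice : ∃[ s ] (ΣFin n star ≤ 2 * starCut s)
  choice with ≤-total (starCut true) (starCut false)
  ... | inj₁ t≤f = false , ≤-trans both (≤-trans (+-monoˡ-≤ (starCut false) t≤f)
    (≤-reflexive (cong (starCut false +_) (≡-sym (+-identityʳ (starCut false))))))
  ... | inj₂ f≤t = true , ≤-trans both (≤-trans (+-monoʳ-≤ (starCut true) f≤t)
    (≤-reflexive (cong (starCut true +_) (≡-sym (+-identityʳ (starCut true))))))
  s₀ = proj₁ choice
  star-≤ = proj₂ choice
  side′ : Fin (suc n) → Bool
  side′ zero = s₀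
  side′ (suc v) = side v
  cutWeight : Fin (suc n) → Fin (suc n) → ℕ
  cutWeight u v = bit (side′ u xor side′ v) * w u v
  cut-≥ : starCut s₀ + W′ ≤ ΣFin (suc n) (λ u → ΣFin (suc n) (cutWeight u))
  cut-≥ = begin
    starCut s₀ + W′
      ≡⟨ cong (_+ W′) (ΣFin-cong n λ v → trans (*-distribˡ-+ (bit (s₀ xor side v)) (w zero (suc v)) (w (suc v) zero))
           (cong (λ x → bit (s₀ xor side v) * w zero (suc v) + bit x * w (suc v) zero) (xor-comm s₀ (side v)))) ⟩
    ΣFin n (λ v → cutWeight zero (suc v) + cutWeight (suc v) zero) + W′
      ≤⟨ m≤n+m _ (cutWeight zero zero) ⟩
    cutWeight zero zero + (ΣFin n (λ v → cutWeight zero (suc v) + cutWeight (suc v) zero) + W′)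
      ≡⟨ split cutWeight ⟨
    ΣFin (suc n) (λ u → ΣFin (suc n) (cutWeight u)) ∎

module _ {n : ℕ} (G : Graph n) where

  -- Zero off the false side, so `cutSize` counts every cut edge once, at its false end.
  crossDegree : (Fin n → Bool) → Fin n → ℕ
  crossDegree side v = ΣFin n λ u → bit (side u ∧ not (side v) ∧ adj G u v)

  cutSize : (Fin n → Bool) → ℕ
  cutSize side = ΣFin n (crossDegree side)

  cutSize-not : ∀ side → cutSize (not ∘ side) ≡ cutSize side
  cutSize-not side = trans (ΣFin-swap n n _) (ΣFin-cong n λ v → ΣFin-cong n λ u → flip (side u) (side v) (Graph.sym G v u))
    where
    flip : ∀ s t {a b} → a ≡ b → bit (not t ∧ not (not s) ∧ a) ≡ bit (s ∧ not t ∧ b)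
    flip true true refl = refl
    flip true false refl = refl
    flip false true refl = refl
    flip false false refl = refl

  edgeCount-≤-cut : Σ[ side ∈ (Fin n → Bool) ] (edgeCount G ≤ 4 * cutSize side)
  edgeCount-≤-cut with max-cut n (λ u v → bit (adj G u v)) (λ u → cong bit (irrefl G u))
  ... | side , half = side , (begin
    edgeCount G
      ≤⟨ ΣFin-mono n (λ u → ΣFin-mono n λ v → drop (lt u v) (adj G u v)) ⟩
    ΣFin n (λ u → ΣFin n λ v → bit (adj G u v))
      ≤⟨ half ⟩
    2 * ΣFin n (λ u → ΣFin n λ v → bit (side u xor side v) * bit (adj G u v))
      ≡⟨ cong (2 *_) (trans (ΣFin-cong n λ u → trans (ΣFin-cong n λ v →
           xor-split (side u) (side v) (Graph.sym G u v)) (ΣFin-+ n _ _)) (ΣFin-+ n _ _)) ⟩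
    2 * (ΣFin n (λ u → ΣFin n λ v → bit (side u ∧ not (side v) ∧ adj G u v)) + cutSize side)
      ≡⟨ cong (λ x → 2 * (x + cutSize side)) (ΣFin-swap n n _) ⟩
    2 * (cutSize side + cutSize side)
      ≡⟨ four (cutSize side) ⟩
    4 * cutSize side ∎)
    where
    open ≤-Reasoning
    drop : ∀ a b → bit (a ∧ b) ≤ bit b
    drop true b = ≤-refl
    drop false b = z≤n
    four : ∀ c → 2 * (c + c) ≡ 4 * c
    four = solve-∀
    xor-split : ∀ s t {a b} → a ≡ b → bit (s xor t) * bit a ≡ bit (s ∧ not t ∧ a) + bit (t ∧ not s ∧ b)
    xor-split true true refl = refl
    xor-split true false refl = refl
    xor-split false true {a} refl = +-identityʳ (bit a)
    xor-split false false refl = refl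

flat : ∀ {A : Set} → List (A × A) → List A
flat [] = []
flat ((b , c) ∷ ps) = b ∷ c ∷ flat ps

module _ {A : Set} (d : A → ℕ) where

  -- Only the weight of the first member of each pair is retained, so the heavier one comes first.
  -- This costs a factor 2, or 3 when an odd number of vertices leaves one unpaired.
  record Pairing (L : List A) : Set where
    constructor pairing
    field
      pairs : List (A × A)
      unique : Unique (flat pairs)
      within : ∀ {x} → x ∈ flat pairs → x ∈ L
      weight : sum (map d L) ≤ 3 * sum (map (d ∘ proj₁) pairs)

  consPair : ∀ {x y L R} → x ≢ y → x ∉ L → y ∉ L → x ∈ R → y ∈ R → (∀ {z} → z ∈ L → z ∈ R) →
    sum (map d R) ≤ 3 * d x + sum (map d L) → Pairing L → Pairing R
  consPair {x} {y} x≢y x∉ y∉ x∈ y∈ L⊆R total (pairing ps u ⊆L w) = pairing ((x , y) ∷ ps)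
    ((x≢y ∷ All.tabulate λ { z∈ refl → x∉ (⊆L z∈) }) ∷ (All.tabulate λ { z∈ refl → y∉ (⊆L z∈) }) ∷ u)
    (λ { (here refl) → x∈ ; (there (here refl)) → y∈ ; (there (there z∈)) → L⊆R (⊆L z∈) })
    (≤-trans total (≤-trans (+-monoʳ-≤ (3 * d x) w) (≤-reflexive (≡-sym (*-distribˡ-+ 3 (d x) _)))))

  two-≤ : ∀ {a b} s → b ≤ a → a + (b + s) ≤ 3 * a + s
  two-≤ {a} s b≤a = ≤-trans (+-monoʳ-≤ a (+-monoˡ-≤ s b≤a)) (≤-trans (m≤n+m _ a) (≤-reflexive (identity a s)))
    where
    identity : ∀ a s → a + (a + (a + s)) ≡ 3 * a + s
    identity = solve-∀

  three-≤ : ∀ {m a b c} → a ≤ m → b ≤ m → c ≤ m → a + (b + (c + 0)) ≤ 3 * m + 0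
  three-≤ {m} a≤m b≤m c≤m = ≤-trans (+-mono-≤ a≤m (+-mono-≤ b≤m (+-monoˡ-≤ 0 c≤m))) (≤-reflexive (identity m))
    where
    identity : ∀ m → m + (m + (m + 0)) ≡ 3 * m + 0
    identity = solve-∀

  addPair : ∀ {x y L} → Unique (x ∷ y ∷ L) → Pairing L → Pairing (x ∷ y ∷ L)
  addPair {x} {y} {L} ((x≢y ∷ x∉) ∷ y∉ ∷ _) P with ≤-total (d y) (d x)
  ... | inj₁ y≤x = consPair x≢y (λ x∈ → All.lookup x∉ x∈ refl) (λ y∈ → All.lookup y∉ y∈ refl)
    (here refl) (there (here refl)) (there ∘ there) (two-≤ (sum (map d L)) y≤x) P
  ... | inj₂ x≤y = consPair (x≢y ∘ ≡-sym) (λ y∈ → All.lookup y∉ y∈ refl) (λ x∈ → All.lookup x∉ x∈ refl)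
    (there (here refl)) (here refl) (there ∘ there)
    (≤-trans (≤-reflexive (exchange (d x) (d y) _)) (two-≤ (sum (map d L)) x≤y)) P
    where
    exchange : ∀ a b c → a + (b + c) ≡ b + (a + c)
    exchange = solve-∀

  emptyPairing : Pairing []
  emptyPairing = pairing [] [] (λ ()) z≤n

  pairUp : ∀ L → Unique L → 2 ≤ length L → Pairing L
  pairUp [] _ ()
  pairUp (x ∷ []) _ (s≤s ())
  pairUp (x ∷ y ∷ []) u _ = addPair u emptyPairing
  -- Of the last three vertices the heaviest goes first, one of the others becomes its partner, and
  -- the third is dropped.
  pairUp (x ∷ y ∷ z ∷ []) ((x≢y ∷ x≢z ∷ _) ∷ (y≢z ∷ _) ∷ _) _ with ≤-total (d x) (d y) | ≤-total (d x) (d z) | ≤-total (d y) (d z)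
  ... | _ | inj₁ x≤z | inj₁ y≤z = consPair (x≢z ∘ ≡-sym) (λ ()) (λ ()) (there (there (here refl))) (here refl) (λ ())
    (three-≤ x≤z y≤z ≤-refl) emptyPairing
  ... | inj₁ x≤y | _ | inj₂ z≤y = consPair (x≢y ∘ ≡-sym) (λ ()) (λ ()) (there (here refl)) (here refl) (λ ())
    (three-≤ x≤y ≤-refl z≤y) emptyPairing
  ... | inj₂ y≤x | inj₂ z≤x | _ = consPair x≢y (λ ()) (λ ()) (here refl) (there (here refl)) (λ ())
    (three-≤ ≤-refl y≤x z≤x) emptyPairing
  ... | inj₁ x≤y | inj₂ z≤x | inj₁ y≤z = consPair (x≢z ∘ ≡-sym) (λ ()) (λ ()) (there (there (here refl))) (here refl) (λ ())
    (three-≤ (≤-trans x≤y y≤z) y≤z ≤-refl) emptyPairing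
  ... | inj₂ y≤x | inj₁ x≤z | inj₂ z≤y = consPair x≢y (λ ()) (λ ()) (here refl) (there (here refl)) (λ ())
    (three-≤ ≤-refl y≤x (≤-trans z≤y y≤x)) emptyPairing
  pairUp (x ∷ y ∷ z ∷ w ∷ L) u@(_ ∷ _ ∷ u′) _ = addPair u (pairUp (z ∷ w ∷ L) u′ (s≤s (s≤s z≤n)))

module _ {n : ℕ} {H : Graph n} where

  path-suffix : ∀ {x y z vs} → Path H y x vs → z ∈ x ∷ vs →
    ∃[ vs′ ] (Path H y z vs′ × length vs′ ≤ length vs × (∀ {v} → v ∈ z ∷ vs′ → v ∈ x ∷ vs))
  path-suffix {vs = vs} path (here refl) = vs , path , ≤-refl , id
  path-suffix (step _ _ path) (there z∈) with path-suffix path z∈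
  ... | vs′ , path′ , shorter , within = vs′ , path′ , m≤n⇒m≤1+n shorter , there ∘ within

  loop-erasure : ∀ {a} (h : ℕ → Fin n) L → (∀ i → i < L → h i ≡ h (suc i) ⊎ Edge H (h i) (h (suc i))) →
    (∀ i → i ≤ L → h i ≢ a) → ∃[ vs ] (Path H (h 0) (h L) vs × length vs ≤ L × a ∉ h L ∷ vs)
  loop-erasure h zero walk avoids = [] , stop , z≤n , λ { (here a≡) → avoids 0 z≤n (≡-sym a≡) }
  loop-erasure h (suc L) walk avoids
    with loop-erasure h L (λ i i<L → walk i (m<n⇒m<1+n i<L)) (λ i i≤L → avoids i (m≤n⇒m≤1+n i≤L))
  ... | vs , path , short , a∉ with walk L ≤-refl
  ...   | inj₁ same rewrite ≡-sym same = vs , path , m≤n⇒m≤1+n short , a∉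
  ...   | inj₂ edge with Any.any? (h (suc L) Fin.≟_) (h L ∷ vs)
  ...     | no new = h L ∷ vs , step (adj-sym H edge) new path , s≤s short ,
    λ { (here a≡) → avoids (suc L) ≤-refl (≡-sym a≡) ; (there a∈) → a∉ a∈ }
  ...     | yes old with path-suffix path old
  ...       | vs′ , path′ , shorter , within = vs′ , path′ , ≤-trans shorter (m≤n⇒m≤1+n short) , a∉ ∘ within

  module _ (side : Fin n → Bool) (bipartite : ∀ {u v} → Edge H u v → side u ≡ not (side v)) where

    path-parity : ∀ {x y vs} → Path H y x vs →
      ∃[ j ] ((side x ≡ side y × length vs ≡ j + j) ⊎ (side x ≡ not (side y) × length vs ≡ suc (j + j)))
    path-parity stop = 0 , inj₁ (refl , refl)
    path-parity (step wx _ path) with path-parity path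
    ... | j , inj₁ (x≡y , len) = j , inj₂ (trans (bipartite wx) (cong not x≡y) , cong suc len)
    ... | j , inj₂ (x≢y , len) = suc j , inj₁ (trans (bipartite wx) (trans (cong not x≢y) (not-involutive _)) ,
      cong suc (trans len (≡-sym (+-suc j j))))

    -- Closing the path at `a` gives a cycle whose length is even by bipartiteness; x ≢ y excludes
    -- the degenerate length 2.
    even-cycle-through : ∀ {a x y vs} → Path H y x vs → a ∉ x ∷ vs → Edge H a x → Edge H y a → x ≢ y →
      ∃[ l ] (2 ≤ l × 2 * l ≤ 2 + length vs × HasCycle H (2 * l))
    even-cycle-through {a} {y = y} path a∉ ax ya x≢y with path-parity (step ax a∉ path)
    ... | j , inj₁ (a≡y , _) = ⊥-elim (¬not≡ (trans (≡-sym a≡y) (bipartite (adj-sym H ya))))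
      where
      ¬not≡ : ∀ {b} → b ≢ not b
      ¬not≡ {true} ()
      ¬not≡ {false} ()
    ... | zero , inj₂ (_ , len) with stop ← path = ⊥-elim (x≢y refl)
    even-cycle-through {vs = vs} path a∉ ax ya x≢y | suc j , inj₂ (_ , len) =
      suc (suc j) , s≤s (s≤s z≤n) , ≤-reflexive (≡-sym length≡) ,
      subst (HasCycle H) length≡ (_ , path-cycle (step ax a∉ path) ya)
      where
      length≡ : suc (suc (length vs)) ≡ 2 * suc (suc j)
      length≡ = trans (cong suc len) (double-suc j)
        where
        double-suc : ∀ j → suc (suc (suc j + suc j)) ≡ 2 * suc (suc j)
        double-suc = solve-∀

module _ {A : Set} where

  pair-unique : ∀ {ps : List (A × A)} → Unique (flat ps) → ∀ {b c c′} → (b , c) ∈ ps → (b , c′) ∈ ps → c ≡ c′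
  fst-∈-flat : ∀ {ps : List (A × A)} {b c} → (b , c) ∈ ps → b ∈ flat ps
  snd-∈-flat : ∀ {ps : List (A × A)} {b c} → (b , c) ∈ ps → c ∈ flat ps

  pair-unique _ (here refl) (here refl) = refl
  pair-unique ((_ ∷ b∉) ∷ _) (here refl) (there bc′) = ⊥-elim (All.lookup b∉ (fst-∈-flat bc′) refl)
  pair-unique ((_ ∷ b∉) ∷ _) (there bc) (here refl) = ⊥-elim (All.lookup b∉ (fst-∈-flat bc) refl)
  pair-unique (_ ∷ _ ∷ u) (there bc) (there bc′) = pair-unique u bc bc′

  fst-∈-flat (here refl) = here refl
  fst-∈-flat (there p) = there (there (fst-∈-flat p))

  snd-∈-flat (here refl) = there (here refl)
  snd-∈-flat (there p) = there (there (snd-∈-flat p))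

  ∈-flat : ∀ {ps : List (A × A)} {b c v} → (b , c) ∈ ps → v ≡ b ⊎ v ≡ c → v ∈ flat ps
  ∈-flat bc (inj₁ refl) = fst-∈-flat bc
  ∈-flat bc (inj₂ refl) = snd-∈-flat bc

  flat-fst-unique : ∀ {ps : List (A × A)} → Unique (flat ps) → Unique (map proj₁ ps)
  flat-fst-unique {[]} _ = []
  flat-fst-unique {(b , c) ∷ ps} ((_ ∷ b∉) ∷ _ ∷ u) = All.tabulate (λ z∈ → All.lookup b∉ (firsts z∈)) ∷ flat-fst-unique u
    where
    firsts : ∀ {z ps} → z ∈ map proj₁ ps → z ∈ flat ps
    firsts {ps = _ ∷ _} (here refl) = here refl
    firsts {ps = _ ∷ _} (there z∈) = there (there (firsts z∈))

cutGraph : ∀ {n} → Graph n → (Fin n → Bool) → Graph n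
cutGraph G side = record
  { adj = λ u v → adj G u v ∧ (side u xor side v)
  ; sym = λ u v → cong₂ _∧_ (Graph.sym G u v) (xor-comm (side u) (side v))
  ; irrefl = λ u → cong (_∧ (side u xor side u)) (irrefl G u) }

-- The false side of a bipartite subgraph of G is partly paired up as (b , c); b and c become adjacent
-- twins, both joined to the neighbours of b on the true side.
module Doubling {n : ℕ} (G : Graph n) (side : Fin n → Bool) (ps : List (Fin n × Fin n))
  (unique : Unique (flat ps)) (paired : ∀ {v} → v ∈ flat ps → side v ≡ false) where

  data Kind : Set where
    centre unused : Kind
    copy : Fin n → Kind

  baseIn : List (Fin n × Fin n) → Fin n → Kind
  baseIn [] v = unused
  baseIn ((b , c) ∷ ps) v with v Fin.≟ b | v Fin.≟ c
  ... | yes _ | _     = copy b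
  ... | no _  | yes _ = copy b
  ... | no _  | no _  = baseIn ps v

  kind : Fin n → Kind
  kind v = Bool.if side v then centre else baseIn ps v

  baseIn-copy : ∀ qs {v b} → baseIn qs v ≡ copy b → ∃[ c ] ((b , c) ∈ qs × (v ≡ b ⊎ v ≡ c))
  baseIn-copy ((b , c) ∷ qs) {v} eq with v Fin.≟ b | v Fin.≟ c
  baseIn-copy ((b , c) ∷ qs) refl | yes v≡b | _ = c , here refl , inj₁ v≡b
  baseIn-copy ((b , c) ∷ qs) refl | no _ | yes v≡c = c , here refl , inj₂ v≡c
  ... | no _ | no _ with baseIn-copy qs eq
  ...   | c′ , bc , v≡ = c′ , there bc , v≡

  baseIn-pair : ∀ {qs} → Unique (flat qs) → ∀ {b c v} → (b , c) ∈ qs → v ≡ b ⊎ v ≡ c → baseIn qs v ≡ copy b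
  baseIn-pair {(b , c) ∷ qs} u {v = v} (here refl) v≡ with v Fin.≟ b | v Fin.≟ c
  ... | yes _ | _ = refl
  ... | no _ | yes _ = refl
  ... | no v≢b | no v≢c = ⊥-elim ([ v≢b , v≢c ]′ v≡)
  baseIn-pair {(b′ , c′) ∷ qs} ((_ ∷ b∉) ∷ c∉ ∷ u) {v = v} (there bc) v≡ with v Fin.≟ b′ | v Fin.≟ c′
  ... | yes refl | _ = ⊥-elim (All.lookup b∉ (∈-flat bc v≡) refl)
  ... | no _ | yes refl = ⊥-elim (All.lookup c∉ (∈-flat bc v≡) refl)
  ... | no _ | no _ = baseIn-pair u bc v≡

  kind-copy : ∀ {v b} → kind v ≡ copy b → ∃[ c ] ((b , c) ∈ ps × (v ≡ b ⊎ v ≡ c))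
  kind-copy {v} eq with side v
  ... | false = baseIn-copy ps eq

  kind-centre : ∀ {v} → kind v ≡ centre → side v ≡ true
  kind-centre {v} eq with side v
  ... | true = refl
  ... | false = ⊥-elim (not-centre ps eq)
    where
    not-centre : ∀ qs → baseIn qs v ≢ centre
    not-centre ((b , c) ∷ qs) eq with v Fin.≟ b | v Fin.≟ c
    ... | no _ | no _ = not-centre qs eq

  side⇒centre : ∀ {v} → side v ≡ true → kind v ≡ centre
  side⇒centre e rewrite e = refl

  pair⇒copy : ∀ {b c v} → (b , c) ∈ ps → v ≡ b ⊎ v ≡ c → kind v ≡ copy b
  pair⇒copy {b} {c} {v} bc v≡ rewrite paired (∈-flat bc v≡) = baseIn-pair unique bc v≡

  copy-side : ∀ {v b} → kind v ≡ copy b → side b ≡ false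
  copy-side eq with kind-copy eq
  ... | _ , bc , _ = paired (fst-∈-flat bc)

  two-copies : ∀ {u v w b} → kind u ≡ copy b → kind v ≡ copy b → kind w ≡ copy b → u ≢ v → w ≡ u ⊎ w ≡ v
  two-copies ku kv kw u≢v with kind-copy ku | kind-copy kv | kind-copy kw
  ... | c , bc , u≡ | c′ , bc′ , v≡ | c″ , bc″ , w≡
    with pair-unique unique bc bc′ | pair-unique unique bc bc″
  ... | refl | refl with u≡ | v≡ | w≡
  ... | inj₁ refl | inj₁ refl | _ = ⊥-elim (u≢v refl)
  ... | inj₂ refl | inj₂ refl | _ = ⊥-elim (u≢v refl)
  ... | inj₁ refl | inj₂ refl | w≡ = w≡
  ... | inj₂ refl | inj₁ refl | inj₁ e = inj₂ e
  ... | inj₂ refl | inj₁ refl | inj₂ e = inj₁ e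

  adjₖ : Fin n → Fin n → Kind → Kind → Bool
  adjₖ u v centre (copy b) = adj G u b
  adjₖ u v (copy b) centre = adj G v b
  adjₖ u v (copy b) (copy b′) = ⌊ b Fin.≟ b′ ⌋ ∧ not ⌊ u Fin.≟ v ⌋
  adjₖ u v _ _ = false

  ≟-comm : ∀ (u v : Fin n) → ⌊ u Fin.≟ v ⌋ ≡ ⌊ v Fin.≟ u ⌋
  ≟-comm u v with u Fin.≟ v | v Fin.≟ u
  ... | yes _ | yes _ = refl
  ... | no _ | no _ = refl
  ... | yes u≡v | no v≢u = ⊥-elim (v≢u (≡-sym u≡v))
  ... | no u≢v | yes v≡u = ⊥-elim (u≢v (≡-sym v≡u))

  adjₖ-sym : ∀ u v k l → adjₖ u v k l ≡ adjₖ v u l k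
  adjₖ-sym u v centre centre = refl
  adjₖ-sym u v centre unused = refl
  adjₖ-sym u v centre (copy _) = refl
  adjₖ-sym u v unused centre = refl
  adjₖ-sym u v unused unused = refl
  adjₖ-sym u v unused (copy _) = refl
  adjₖ-sym u v (copy _) centre = refl
  adjₖ-sym u v (copy _) unused = refl
  adjₖ-sym u v (copy b) (copy b′) = cong₂ (λ p q → p ∧ not q) (≟-comm b b′) (≟-comm u v)

  adjₖ-irrefl : ∀ u k → adjₖ u u k k ≡ false
  adjₖ-irrefl u centre = refl
  adjₖ-irrefl u unused = refl
  adjₖ-irrefl u (copy b) = trans (cong (λ x → ⌊ b Fin.≟ b ⌋ ∧ not x) (true-⌊⌋ {P? = u Fin.≟ u} refl)) (∧-zeroʳ _)

  doubled : Graph n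
  doubled = record
    { adj = λ u v → adjₖ u v (kind u) (kind v)
    ; sym = λ u v → adjₖ-sym u v (kind u) (kind v)
    ; irrefl = λ u → adjₖ-irrefl u (kind u) }

  data EdgeView (u v : Fin n) : Set where
    centre-copy : ∀ {b} → kind u ≡ centre → kind v ≡ copy b → Edge G u b → EdgeView u v
    copy-centre : ∀ {b} → kind u ≡ copy b → kind v ≡ centre → Edge G v b → EdgeView u v
    copy-copy : ∀ {b} → kind u ≡ copy b → kind v ≡ copy b → EdgeView u v

  edgeView : ∀ {u v} → Edge doubled u v → EdgeView u v
  edgeView {u} {v} e = view (kind u) (kind v) refl refl e
    where
    view : ∀ k l → kind u ≡ k → kind v ≡ l → adjₖ u v k l ≡ true → EdgeView u v
    view centre (copy b) ku kv e = centre-copy ku kv e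
    view (copy b) centre ku kv e = copy-centre ku kv e
    view (copy b) (copy b′) ku kv e with ⌊⌋-true {P? = b Fin.≟ b′} (proj₁ (∧-true e))
    ... | refl = copy-copy ku kv
    view centre centre _ _ ()
    view centre unused _ _ ()
    view unused _ _ _ ()
    view (copy _) unused _ _ ()

  H : Graph n
  H = cutGraph G side

  H-bipartite : ∀ {u v} → Edge H u v → side u ≡ not (side v)
  H-bipartite {u} {v} e = xor-true (side u) (side v) (proj₂ (∧-true {adj G u v} e))
    where
    xor-true : ∀ s t → s xor t ≡ true → s ≡ not t
    xor-true true false _ = refl
    xor-true false true _ = refl

  centre-base-edge : ∀ {u v b} → kind u ≡ centre → kind v ≡ copy b → Edge G u b → Edge H u b
  centre-base-edge ku kv ub = ∧-intro ub (cong₂ _xor_ (kind-centre ku) (copy-side kv))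

  projectKind : Fin n → Kind → Fin n
  projectKind v (copy b) = b
  projectKind v _ = v

  -- Collapses each pair to its first member, so that edges of `doubled` become edges of the
  -- bipartite graph `H` or stationary steps.
  project : Fin n → Fin n
  project v = projectKind v (kind v)

  project-copy : ∀ {v b} → kind v ≡ copy b → project v ≡ b
  project-copy {v} eq = cong (projectKind v) eq

  project-centre : ∀ {v} → kind v ≡ centre → project v ≡ v
  project-centre {v} eq = cong (projectKind v) eq

  project-edge : ∀ {u v} → Edge doubled u v → project u ≡ project v ⊎ Edge H (project u) (project v)
  project-edge e with edgeView e
  ... | centre-copy ku kv ub = inj₂ (subst₂ (Edge H) (≡-sym (project-centre ku)) (≡-sym (project-copy kv)) (centre-base-edge ku kv ub))
  ... | copy-centre ku kv vb = inj₂ (subst₂ (Edge H) (≡-sym (project-copy ku)) (≡-sym (project-centre kv))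
    (adj-sym H (centre-base-edge kv ku vb)))
  ... | copy-copy ku kv = inj₁ (trans (project-copy ku) (≡-sym (project-copy kv)))

  project≢centre : ∀ {u v} → kind u ≡ centre → v ≢ u → project v ≢ u
  project≢centre {u} {v} ku v≢u = go (kind v) refl
    where
    go : ∀ k → kind v ≡ k → projectKind v k ≢ u
    go centre _ = v≢u
    go unused _ = v≢u
    go (copy b) kv refl with () ← trans (≡-sym (copy-side kv)) (kind-centre ku)
  module _ (k m : ℕ) (5≤m : 5 ≤ m) (m≤2k+1 : m ≤ suc (2 * k))
    (evenFree : ∀ l → 2 ≤ l → l ≤ k → ¬ HasCycle G (2 * l)) where

    -- If the two cycle neighbours of a centre had different bases, the rest of the cycle would
    -- project to a walk between these bases avoiding the centre, and closing it up would give a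
    -- forbidden even cycle in G. So they are the two copies of one base, and the cycle cannot go on
    -- to length 5.
    doubled-cycle-free : ¬ HasCycle doubled m
    doubled-cycle-free (f , inj , edges) = impossible
      where
      instance
        m≢0 : NonZero m
        m≢0 = >-nonZero (≤-trans (s≤s z≤n) 5≤m)
      open Cyclic m

      g : ℕ → Fin n
      g i = f (residue i)

      edge : ∀ i → Edge doubled (g i) (g (suc i))
      edge i = edges _ _ (residue-CycAdj i)

      g-≢ : ∀ d i → 0 < d → d < m → g (d + i) ≢ g i
      g-≢ d i 0<d d<m eq = residue-≢ 0<d d<m i (inj eq)

      centre-step : ∀ i → kind (g (suc i)) ≡ centre → ∃[ b ] (kind (g i) ≡ copy b × kind (g (2 + i)) ≡ copy b)
      centre-step i ka with edgeView (edge i) | edgeView (edge (suc i))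
      ... | centre-copy _ ka′ _ | _ with () ← trans (≡-sym ka) ka′
      ... | copy-copy _ ka′ | _ with () ← trans (≡-sym ka) ka′
      ... | copy-centre _ _ _ | copy-centre ka′ _ _ with () ← trans (≡-sym ka) ka′
      ... | copy-centre _ _ _ | copy-copy ka′ _ with () ← trans (≡-sym ka) ka′
      centre-step i ka | copy-centre {b} ku _ ab | centre-copy {b′} _ kw ab′ with b Fin.≟ b′
      ... | yes refl = b , ku , kw
      ... | no b≢b′ = ⊥-elim (evenFree (proj₁ even) (proj₁ (proj₂ even)) l≤k
          (cut⊆ (proj₂ (proj₂ (proj₂ even)))))
        where
        -- The centre is at i + 1, and m - 2 steps lead from i + 2 around the cycle to i + m, which
        -- is i again.
        L = m ∸ 2
        L+2≡m : L + 2 ≡ m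
        L+2≡m = m∸n+n≡m (≤-trans (s≤s (s≤s z≤n)) 5≤m)
        h : ℕ → Fin n
        h j = project (g (j + (2 + i)))
        h0≡b′ : h 0 ≡ b′
        h0≡b′ = project-copy kw
        hL≡b : h L ≡ b
        hL≡b = trans (cong (λ v → project (f v)) (trans (cong residue (trans (≡-sym (+-assoc L 2 i))
          (trans (cong (_+ i) L+2≡m) (+-comm m i)))) (residue-+m i))) (project-copy ku)
        avoids : ∀ j → j ≤ L → h j ≢ g (suc i)
        avoids j j≤L = project≢centre ka (subst (λ x → g x ≢ g (suc i)) (≡-sym (+-suc j (suc i)))
          (g-≢ (suc j) (suc i) (s≤s z≤n) (subst (suc j <_) L+2≡m
            (≤-trans (s≤s (s≤s j≤L)) (≤-reflexive (+-comm 2 L))))))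
        erased = loop-erasure {H = H} {a = g (suc i)} h L (λ j _ → project-edge (edge (j + (2 + i)))) avoids
        even = even-cycle-through side H-bipartite (proj₁ (proj₂ erased)) (proj₂ (proj₂ (proj₂ erased)))
          (subst (Edge H (g (suc i))) (≡-sym hL≡b) (centre-base-edge ka ku ab))
          (adj-sym H (subst (Edge H (g (suc i))) (≡-sym h0≡b′) (centre-base-edge ka kw ab′)))
          (λ hL≡h0 → b≢b′ (trans (≡-sym hL≡b) (trans hL≡h0 h0≡b′)))
        -- An even number 2l ≤ m ≤ 2k + 1 is at most 2k.
        l≤k : proj₁ even ≤ k
        l≤k = ≮⇒≥ λ k<l → <-irrefl refl (begin-strict
          suc (2 * k)            <⟨ ≤-reflexive (≡-sym (*-suc 2 k)) ⟩
          2 * suc k              ≤⟨ *-monoʳ-≤ 2 k<l ⟩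
          2 * proj₁ even         ≤⟨ proj₁ (proj₂ (proj₂ even)) ⟩
          2 + length (proj₁ erased) ≤⟨ +-monoʳ-≤ 2 (proj₁ (proj₂ (proj₂ erased))) ⟩
          2 + L                  ≡⟨ trans (+-comm 2 L) L+2≡m ⟩
          m                      ≤⟨ m≤2k+1 ⟩
          suc (2 * k)            ∎)
          where open ≤-Reasoning
        cut⊆ : ∀ {l} → HasCycle H l → HasCycle G l
        cut⊆ (f , inj , edges) = f , inj , λ i j ij → proj₁ (∧-true (edges i j ij))

      copy-unique : ∀ {v b b′} → kind v ≡ copy b → kind v ≡ copy b′ → b ≡ b′
      copy-unique kv kv′ with refl ← trans (≡-sym kv) kv′ = refl

      <m : ∀ d → d ≤ 4 → d < m
      <m d d≤4 = ≤-trans (s≤s d≤4) 5≤m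

      -- Total offsets up to 4 stay below m, so the three positions carry distinct vertices, whereas
      -- a base has only two copies.
      three-copies : ∀ {b} i d e → 0 < d → 0 < e → d ≤ 4 → e ≤ 4 → kind (g i) ≡ copy b →
        kind (g (d + i)) ≡ copy b → kind (g (e + (d + i))) ≢ copy b ⊎ e + d > 4
      three-copies i d e 0<d 0<e d≤4 e≤4 k₀ k₁ with e + d ≤? 4
      ... | no big = inj₂ (≰⇒> big)
      ... | yes small = inj₁ λ k₂ → case two-copies k₀ k₁ k₂ (g-≢ d i 0<d (<m d d≤4) ∘ ≡-sym) of λ
        { (inj₁ eq) → g-≢ (e + d) i (≤-trans 0<e (m≤m+n e d)) (<m (e + d) small)
            (trans (cong g (+-assoc e d i)) eq)
        ; (inj₂ eq) → g-≢ e (d + i) 0<e (<m e e≤4) eq }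

      some-centre : ∃[ i ] kind (g (suc i)) ≡ centre
      some-centre with edgeView (edge 1)
      ... | centre-copy k₁ _ _ = 0 , k₁
      ... | copy-centre _ k₂ _ = 1 , k₂
      ... | copy-copy {b} k₁ k₂ with edgeView (edge 2)
      ...   | centre-copy k₂′ _ _ = 1 , k₂′
      ...   | copy-centre _ k₃ _ = 2 , k₃
      ...   | copy-copy k₂′ k₃ with refl ← copy-unique k₂ k₂′
        with three-copies 1 1 1 (s≤s z≤n) (s≤s z≤n) (s≤s z≤n) (s≤s z≤n) k₁ k₂
      ...     | inj₁ ¬k₃ = ⊥-elim (¬k₃ k₃)
      ...     | inj₂ 4<2 = ⊥-elim (<⇒≱ 4<2 (s≤s (s≤s z≤n)))

      -- Both neighbours of the centre are copies of b. The next vertex is a third copy of b, or a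
      -- centre whose far neighbour is one; the offset from the first copy is 3 or 4.
      impossible : ⊥
      impossible with some-centre
      ... | i , ka with centre-step i ka
      ... | b , k₀ , k₂ with edgeView (edge (2 + i))
      ... | centre-copy k₂′ _ _ with () ← trans (≡-sym k₂) k₂′
      impossible | i , ka | b , k₀ , k₂ | copy-copy k₂′ k₃ with refl ← copy-unique k₂ k₂′
        with three-copies i 2 1 (s≤s z≤n) (s≤s z≤n) (s≤s (s≤s z≤n)) (s≤s z≤n) k₀ k₂
      ... | inj₁ ¬k₃ = ¬k₃ k₃
      ... | inj₂ 4<3 = <⇒≱ 4<3 (s≤s (s≤s (s≤s z≤n)))
      impossible | i , ka | b , k₀ , k₂ | copy-centre _ k₃ _ with centre-step (2 + i) k₃
      ... | b′ , k₂′ , k₄ with refl ← copy-unique k₂ k₂′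
        with three-copies i 2 2 (s≤s z≤n) (s≤s z≤n) (s≤s (s≤s z≤n)) (s≤s (s≤s z≤n)) k₀ k₂
      ... | inj₁ ¬k₄ = ¬k₄ k₄
      ... | inj₂ 4<4 = <-irrefl refl 4<4

  -- A neighbour u of b across the cut gives the ordered triangle (u , b , c), and distinct pairs
  -- have distinct middle vertices b.
  crossDegree-triangles : sum (map (crossDegree G side ∘ proj₁) ps) ≤ 6 * triangleCount doubled
  crossDegree-triangles = begin
    sum (map (crossDegree G side ∘ proj₁) ps)
      ≤⟨ sum-mono ps (λ bc → bc) ⟩
    sum (map (at ∘ proj₁) ps)
      ≡⟨ cong sum (map-∘ ps) ⟩
    sum (map at (map proj₁ ps))
      ≤⟨ sum-unique-≤-ΣFin (flat-fst-unique unique) at ⟩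
    ΣFin n at
      ≡⟨ ΣFin-swap n n (λ v u → ΣFin n (orderedTriangle doubled u v)) ⟩
    orderedTriangleCount doubled
      ≤⟨ orderedTriangleCount-≤ doubled ⟩
    6 * triangleCount doubled ∎
    where
    open ≤-Reasoning
    at : Fin n → ℕ
    at v = ΣFin n λ u → ΣFin n λ w → orderedTriangle doubled u v w
    joined : ∀ {u v b} → kind u ≡ centre → kind v ≡ copy b → Edge G u b → Edge doubled u v
    joined {u} {v} ku kv ub rewrite ku | kv = ub
    twins : ∀ {b c} → kind b ≡ copy b → kind c ≡ copy b → b ≢ c → Edge doubled b c
    twins {b} {c} kb kc b≢c rewrite kb | kc = ∧-intro (true-⌊⌋ {P? = b Fin.≟ b} refl)
      (cong not (not-true⇒false (b≢c ∘ ⌊⌋-true {P? = b Fin.≟ c})))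
    distinct : ∀ {qs b c} → Unique (flat qs) → (b , c) ∈ qs → b ≢ c
    distinct ((b≢c ∷ _) ∷ _) (here refl) = b≢c
    distinct {_ ∷ _} (_ ∷ _ ∷ u) (there bc) = distinct u bc
    pair-≤ : ∀ {b c} → (b , c) ∈ ps → crossDegree G side b ≤ at b
    pair-≤ {b} {c} bc = ΣFin-mono n λ u → ≤-trans
      (bit-∧₃-≤ (side u) (not (side b)) (adj G u b) (λ su _ ub → ≤-reflexive (≡-sym
        (orderedTriangle-true doubled {u} {b} {c}
          (joined (side⇒centre su) kb ub) (twins kb kc (distinct unique bc)) (joined (side⇒centre su) kc ub)))))
      (ΣFin-≥-term n (orderedTriangle doubled u b) c)
      where
      kb = pair⇒copy {v = b} bc (inj₁ refl)
      kc = pair⇒copy {v = c} bc (inj₂ refl)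
    sum-mono : ∀ qs → (∀ {p} → p ∈ qs → p ∈ ps) → sum (map (crossDegree G side ∘ proj₁) qs) ≤ sum (map (at ∘ proj₁) qs)
    sum-mono [] _ = z≤n
    sum-mono ((b , c) ∷ qs) qs⊆ = +-mono-≤ (pair-≤ (qs⊆ (here refl))) (sum-mono qs (qs⊆ ∘ there))

two-alike : ∀ {n} → 3 ≤ n → (side : Fin n → Bool) → ∃[ x ] ∃[ y ] (x ≢ y × side x ≡ side y)
two-alike (s≤s (s≤s (s≤s _))) side with side zero Bool.≟ side (suc zero) | side zero Bool.≟ side (suc (suc zero))
... | yes e | _ = zero , suc zero , (λ ()) , e
... | no _ | yes e = zero , suc (suc zero) , (λ ()) , e
... | no ≢₁ | no ≢₂ = suc zero , suc (suc zero) , (λ ()) ,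
  trans (≢⇒not (side zero) (side (suc zero)) ≢₁) (≡-sym (≢⇒not (side zero) (side (suc (suc zero))) ≢₂))
  where
  ≢⇒not : ∀ b c → b ≢ c → c ≡ not b
  ≢⇒not true true b≢c = ⊥-elim (b≢c refl)
  ≢⇒not true false _ = refl
  ≢⇒not false true _ = refl
  ≢⇒not false false b≢c = ⊥-elim (b≢c refl)

-- Pairing needs two vertices on the false side. Among three vertices two lie on the same side, and
-- complementing the cut preserves its size.
large-cut : ∀ {n} → 3 ≤ n → (G : Graph n) →
  Σ[ side ∈ (Fin n → Bool) ] (edgeCount G ≤ 4 * cutSize G side × ∃[ x ] ∃[ y ] (x ≢ y × side x ≡ false × side y ≡ false))
large-cut {n} 3≤n G = orient (edgeCount-≤-cut G)
  where
  Oriented : Set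
  Oriented = Σ[ side ∈ (Fin n → Bool) ] (edgeCount G ≤ 4 * cutSize G side ×
    ∃[ x ] ∃[ y ] (x ≢ y × side x ≡ false × side y ≡ false))
  turn : ∀ side → edgeCount G ≤ 4 * cutSize G side → ∀ x y → x ≢ y → side x ≡ side y →
    ∀ s → side x ≡ s → Oriented
  turn side e≤ x y x≢y sx≡sy false sx = side , e≤ , x , y , x≢y , sx , trans (≡-sym sx≡sy) sx
  turn side e≤ x y x≢y sx≡sy true sx = not ∘ side ,
    ≤-trans e≤ (≤-reflexive (cong (4 *_) (≡-sym (cutSize-not G side)))) ,
    x , y , x≢y , cong not sx , cong not (trans (≡-sym sx≡sy) sx)
  orient : Σ[ side ∈ (Fin n → Bool) ] (edgeCount G ≤ 4 * cutSize G side) → Oriented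
  orient (side , e≤) = let (x , y , x≢y , sx≡sy) = two-alike 3≤n side in
    turn side e≤ x y x≢y sx≡sy (side x) refl

sum-filter : ∀ {n} (d : Fin n → ℕ) (side : Fin n → Bool) → (∀ v → side v ≡ true → d v ≡ 0) → ∀ xs →
  sum (map d xs) ≤ sum (map d (filter (λ v → side v Bool.≟ false) xs))
sum-filter d side zero-off [] = z≤n
sum-filter d side zero-off (x ∷ xs) with side x in sx
... | false = +-monoʳ-≤ (d x) (sum-filter d side zero-off xs)
... | true rewrite zero-off x sx = sum-filter d side zero-off xs

two-members : ∀ {A : Set} {x y : A} {L} → x ≢ y → x ∈ L → y ∈ L → 2 ≤ length L
two-members x≢y (here refl) (here refl) = ⊥-elim (x≢y refl)
two-members {L = _ ∷ _ ∷ _} _ _ _ = s≤s (s≤s z≤n)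
two-members {L = _ ∷ []} _ (there ()) _
two-members {L = _ ∷ []} _ (here _) (there ())

-- The constant is 72 = 4 · 3 · 6: passing to a cut, pairing up its false side, and the orderings of
-- a triangle.
bigO-exEven-exTri : ∀ k m → 5 ≤ m → m ≤ suc (2 * k) → BigO (exEven k) (exTri m)
bigO-exEven-exTri k m 5≤m m≤ = 72 , 3 , bound
  where
  bound : ∀ n → 3 ≤ n → ∀ a b → exEven k n a → exTri m n b → a ≤ 72 * b
  bound n 3≤n a b ((G , evenFree , refl) , _) (_ , max) with large-cut 3≤n G
  ... | side , e≤ , x , y , x≢y , sx , sy = begin
    edgeCount G                              ≤⟨ e≤ ⟩
    4 * cutSize G side                       ≤⟨ *-monoʳ-≤ 4 (sum-filter d side off (allFin n)) ⟩
    4 * sum (map d L)                        ≤⟨ *-monoʳ-≤ 4 weight ⟩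
    4 * (3 * sum (map (d ∘ proj₁) pairs))    ≤⟨ *-monoʳ-≤ 4 (*-monoʳ-≤ 3 crossDegree-triangles) ⟩
    4 * (3 * (6 * triangleCount doubled))    ≤⟨ *-monoʳ-≤ 4 (*-monoʳ-≤ 3 (*-monoʳ-≤ 6 t≤b)) ⟩
    4 * (3 * (6 * b))                        ≡⟨ trans (cong (4 *_) (≡-sym (*-assoc 3 6 b))) (≡-sym (*-assoc 4 18 b)) ⟩
    72 * b                                   ∎
    where
    open ≤-Reasoning
    d = crossDegree G side
    L = filter (λ v → side v Bool.≟ false) (allFin n)
    off : ∀ v → side v ≡ true → d v ≡ 0
    off v sv = n≤0⇒n≡0 (≤-trans (ΣFin-≤-const n 0 λ u →
      bit-∧₃-≤ (side u) (not (side v)) (adj G u v) λ _ ¬sv _ → case trans (≡-sym ¬sv) (cong not sv) of λ ())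
      (≤-reflexive (*-zeroʳ n)))
    member : ∀ {v} → side v ≡ false → v ∈ L
    member sv = ∈-filter⁺ (λ v → side v Bool.≟ false) (∈-allFin _) sv
    open Pairing (pairUp d L (filter⁺ _ (allFin⁺ n)) (two-members x≢y (member sx) (member sy)))
    open Doubling G side pairs unique (λ v∈ → proj₂ (∈-filter⁻ (λ v → side v Bool.≟ false) {xs = allFin n} (within v∈)))
    t≤b : triangleCount doubled ≤ b
    t≤b = max _ (doubled , doubled-cycle-free k m 5≤m m≤ evenFree , refl)

-- Triangles in graphs without 4-cycles

2ab≤a²+b² : ∀ a b → 2 * (a * b) ≤ a * a + b * b
2ab≤a²+b² a b with ≤-total a b
... | inj₁ a≤b with m≤n⇒∃[o]m+o≡n a≤b
...   | o , refl = ≤-trans (m≤m+n _ (o * o)) (≤-reflexive (identity a o))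
  where
  identity : ∀ a o → 2 * (a * (a + o)) + o * o ≡ a * a + (a + o) * (a + o)
  identity = solve-∀
2ab≤a²+b² a b | inj₂ b≤a with m≤n⇒∃[o]m+o≡n b≤a
...   | o , refl = ≤-trans (m≤m+n _ (o * o)) (≤-reflexive (identity b o))
  where
  identity : ∀ b o → 2 * ((b + o) * b) + o * o ≡ (b + o) * (b + o) + b * b
  identity = solve-∀

ΣFin-product : ∀ m n (f : Fin m → ℕ) (g : Fin n → ℕ) →
  ΣFin m f * ΣFin n g ≡ ΣFin m (λ i → ΣFin n (λ j → f i * g j))
ΣFin-product m n f g = ≡-sym (begin
  ΣFin m (λ i → ΣFin n (λ j → f i * g j)) ≡⟨ ΣFin-cong m (λ i → trans (ΣFin-*ˡ n (f i) g) (*-comm (f i) (ΣFin n g))) ⟩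
  ΣFin m (λ i → ΣFin n g * f i)           ≡⟨ ΣFin-*ˡ m (ΣFin n g) f ⟩
  ΣFin n g * ΣFin m f                     ≡⟨ *-comm (ΣFin n g) (ΣFin m f) ⟩
  ΣFin m f * ΣFin n g                     ∎)
  where open ≡-Reasoning

-- The inequality 2ab ≤ a² + b² summed over all pairs of indices.
cauchy-schwarz : ∀ n (f : Fin n → ℕ) → ΣFin n f * ΣFin n f ≤ n * ΣFin n (λ i → f i * f i)
cauchy-schwarz n f = *-cancelˡ-≤ 2 (begin
  2 * (ΣFin n f * ΣFin n f)
    ≡⟨ cong (2 *_) (ΣFin-product n n f f) ⟩
  2 * ΣFin n (λ i → ΣFin n (λ j → f i * f j))
    ≡⟨ trans (ΣFin-cong n λ i → ΣFin-*ˡ n 2 (λ j → f i * f j)) (ΣFin-*ˡ n 2 _) ⟨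
  ΣFin n (λ i → ΣFin n (λ j → 2 * (f i * f j)))
    ≤⟨ ΣFin-mono n (λ i → ΣFin-mono n λ j → 2ab≤a²+b² (f i) (f j)) ⟩
  ΣFin n (λ i → ΣFin n (λ j → f i * f i + f j * f j))
    ≡⟨ trans (ΣFin-cong n λ i → ΣFin-+ n (λ _ → f i * f i) (λ j → f j * f j)) (ΣFin-+ n _ _) ⟩
  ΣFin n (λ i → ΣFin n (λ _ → f i * f i)) + ΣFin n (λ _ → Q)
    ≡⟨ cong₂ _+_ (trans (ΣFin-cong n λ i → ΣFin-const n (f i * f i)) (ΣFin-*ˡ n n (λ i → f i * f i))) (ΣFin-const n Q) ⟩
  n * Q + n * Q
    ≡⟨ cong (n * Q +_) (+-identityʳ (n * Q)) ⟨
  2 * (n * Q) ∎)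
  where
  open ≤-Reasoning
  Q = ΣFin n (λ i → f i * f i)

module _ {n : ℕ} (G : Graph n) (C₄-free : ¬ HasCycle G 4) where

  common-unique : ∀ {u w} → u ≢ w → AtMostOne (common G u w)
  common-unique {u} {w} u≢w {i} {j} ci cj with i Fin.≟ j | ∧-true {adj G u i} ci | ∧-true {adj G u j} cj
  ... | yes i≡j | _ | _ = i≡j
  ... | no i≢j | ui , wi | uj , wj = ⊥-elim (C₄-free (_ , path-cycle {G = G}
    (step ui (λ { (here eq) → adj⇒≢ G ui eq ; (there (here eq)) → u≢w eq ; (there (there (here eq))) → adj⇒≢ G uj eq ; (there (there (there ()))) })
    (step (adj-sym G wi) (λ { (here eq) → adj⇒≢ G wi (≡-sym eq) ; (there (here eq)) → i≢j eq ; (there (there ())) })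
    (step wj (λ { (here eq) → adj⇒≢ G wj eq ; (there ()) }) stop)))
    (adj-sym G uj)))

  codegree-≤ : ∀ u w → codegree G u w ≤ 1 + eqBit u w * n
  codegree-≤ u w with w Fin.≟ u
  ... | yes _ = ≤-trans (ΣFin-≤-const n 1 λ i → bit-≤1 _) (≤-trans (≤-reflexive (trans (*-identityʳ n) (≡-sym (+-identityʳ n)))) (n≤1+n _))
  ... | no w≢u = ΣFin-AtMostOne {Q = common G u w} (common-unique (w≢u ∘ ≡-sym))

  degree : Fin n → ℕ
  degree v = ΣFin n λ u → bit (adj G v u)

  edgeCount-≤-degrees : edgeCount G ≤ ΣFin n degree
  edgeCount-≤-degrees = ΣFin-mono n λ u → ΣFin-mono n λ v → drop (lt u v) (adj G u v)
    where
    drop : ∀ a b → bit (a ∧ b) ≤ bit b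
    drop true b = ≤-refl
    drop false b = z≤n

  -- The left side counts walks u v w by their middle vertex. Counted by their ends they give the
  -- sum of the codegrees, which are at most 1 for u ≢ w and at most n + 1 on the diagonal after the
  -- crude bound; each row thus contributes at most 2n.
  Σdegree²-≤ : ΣFin n (λ v → degree v * degree v) ≤ 2 * (n * n)
  Σdegree²-≤ = begin
    ΣFin n (λ v → degree v * degree v)
      ≡⟨ ΣFin-cong n (λ v → ΣFin-product n n (λ u → bit (adj G v u)) (λ w → bit (adj G v w))) ⟩
    ΣFin n (λ v → ΣFin n λ u → ΣFin n λ w → bit (adj G v u) * bit (adj G v w))
      ≡⟨ trans (ΣFin-swap n n _) (ΣFin-cong n λ u → ΣFin-swap n n _) ⟩
    ΣFin n (λ u → ΣFin n λ w → ΣFin n λ v → bit (adj G v u) * bit (adj G v w))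
      ≡⟨ ΣFin-cong n (λ u → ΣFin-cong n λ w → ΣFin-cong n λ v → bit-* (Graph.sym G v u) (Graph.sym G v w)) ⟩
    ΣFin n (λ u → ΣFin n λ w → codegree G u w)
      ≤⟨ ΣFin-mono n (λ u → ≤-trans (ΣFin-mono n (codegree-≤ u)) (row u)) ⟩
    ΣFin n (λ u → n + n)
      ≡⟨ ΣFin-const n (n + n) ⟩
    n * (n + n)
      ≡⟨ identity n ⟩
    2 * (n * n) ∎
    where
    open ≤-Reasoning
    identity : ∀ n → n * (n + n) ≡ 2 * (n * n)
    identity = solve-∀
    bit-* : ∀ {a b c d} → a ≡ c → b ≡ d → bit a * bit b ≡ bit (c ∧ d)
    bit-* {true} {b} refl refl = +-identityʳ (bit b)
    bit-* {false} refl refl = refl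
    row : ∀ u → ΣFin n (λ w → 1 + eqBit u w * n) ≤ n + n
    row u = ≤-trans (≤-reflexive (ΣFin-+ n (λ _ → 1) _)) (+-mono-≤
      (≤-reflexive (trans (ΣFin-const n 1) (*-identityʳ n))) (ΣFin-eqBit-* u n))

  edgeCount²-≤ : edgeCount G * edgeCount G ≤ 2 * (n * n * n)
  edgeCount²-≤ = begin
    edgeCount G * edgeCount G                ≤⟨ *-mono-≤ edgeCount-≤-degrees edgeCount-≤-degrees ⟩
    ΣFin n degree * ΣFin n degree            ≤⟨ cauchy-schwarz n degree ⟩
    n * ΣFin n (λ v → degree v * degree v)   ≤⟨ *-monoʳ-≤ n Σdegree²-≤ ⟩
    n * (2 * (n * n))                        ≡⟨ identity n ⟩
    2 * (n * n * n)                          ∎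
    where
    open ≤-Reasoning
    identity : ∀ n → n * (2 * (n * n)) ≡ 2 * (n * n * n)
    identity = solve-∀

ΣFin-++ : ∀ m n (f : Fin (m + n) → ℕ) →
  ΣFin (m + n) f ≡ ΣFin m (λ i → f (i Fin.↑ˡ n)) + ΣFin n (λ j → f (m Fin.↑ʳ j))
ΣFin-++ zero n f = refl
ΣFin-++ (suc m) n f = trans (ΣFin-suc (m + n) f) (trans (cong (f zero +_) (ΣFin-++ m n (f ∘ suc)))
  (trans (≡-sym (+-assoc (f zero) _ _)) (cong (_+ ΣFin n (λ j → f (suc m Fin.↑ʳ j)))
    (≡-sym (ΣFin-suc m (λ i → f (i Fin.↑ˡ n)))))))

ΣFin-combine : ∀ m n (f : Fin (m * n) → ℕ) → ΣFin (m * n) f ≡ ΣFin m (λ i → ΣFin n (λ j → f (Fin.combine i j)))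
ΣFin-combine zero n f = refl
ΣFin-combine (suc m) n f = trans (ΣFin-++ n (m * n) f) (trans
  (cong (ΣFin n (λ j → f (j Fin.↑ˡ (m * n))) +_) (ΣFin-combine m n (f ∘ (n Fin.↑ʳ_))))
  (≡-sym (ΣFin-suc m (λ i → ΣFin n (λ j → f (Fin.combine i j))))))

-- Choosing the second coordinates α, β, γ as functions of all three first coordinates.
ΣFin³-fibre : ∀ m n (f : Fin (m * n) → Fin (m * n) → Fin (m * n) → ℕ) (α β γ : Fin m → Fin m → Fin m → Fin n) →
  ΣFin m (λ x → ΣFin m λ y → ΣFin m λ z →
    f (Fin.combine x (α x y z)) (Fin.combine y (β x y z)) (Fin.combine z (γ x y z))) ≤
  ΣFin (m * n) (λ u → ΣFin (m * n) λ v → ΣFin (m * n) λ w → f u v w)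
ΣFin³-fibre m n f α β γ = begin
  ΣFin m (λ x → ΣFin m λ y → ΣFin m λ z →
    f (x ⊗ α x y z) (y ⊗ β x y z) (z ⊗ γ x y z))
    ≤⟨ ΣFin-mono m (λ x → ΣFin-mono m λ y → ΣFin-mono m λ z → ≤-trans (ΣFin-≥-term n (λ c → f (x ⊗ α x y z) (y ⊗ β x y z) (z ⊗ c)) (γ x y z))
         (≤-trans (ΣFin-≥-term n (λ b → ΣFin n λ c → f (x ⊗ α x y z) (y ⊗ b) (z ⊗ c)) (β x y z))
           (ΣFin-≥-term n (λ a → ΣFin n λ b → ΣFin n λ c → f (x ⊗ a) (y ⊗ b) (z ⊗ c)) (α x y z)))) ⟩
  ΣFin m (λ x → ΣFin m λ y → ΣFin m λ z → ΣFin n λ a → ΣFin n λ b → ΣFin n λ c → f (x ⊗ a) (y ⊗ b) (z ⊗ c))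
    ≡⟨ ΣFin-cong m (λ x → trans (ΣFin-cong m λ y → trans (ΣFin-swap m n _) (ΣFin-cong n λ a → ΣFin-swap m n _)) (ΣFin-swap m n _)) ⟩
  ΣFin m (λ x → ΣFin n λ a → ΣFin m λ y → ΣFin n λ b → ΣFin m λ z → ΣFin n λ c → f (x ⊗ a) (y ⊗ b) (z ⊗ c))
    ≡⟨ trans (ΣFin-combine m n _) (ΣFin-cong m λ x → ΣFin-cong n λ a → trans (ΣFin-combine m n _)
         (ΣFin-cong m λ y → ΣFin-cong n λ b → ΣFin-combine m n _)) ⟨
  ΣFin (m * n) (λ u → ΣFin (m * n) λ v → ΣFin (m * n) λ w → f u v w) ∎
  where
  open ≤-Reasoning
  _⊗_ : Fin m → Fin n → Fin (m * n)
  _⊗_ = Fin.combine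

abstract

  -- The alternating sum of the four edge equations of a 4-cycle: the second coordinates cancel and
  -- this product remains.
  parallelogram : ∀ a b c d →
    (a ℤ.+ b) ℤ.* (a ℤ.+ b) ℤ.- (b ℤ.+ c) ℤ.* (b ℤ.+ c) ℤ.+ ((c ℤ.+ d) ℤ.* (c ℤ.+ d) ℤ.- (d ℤ.+ a) ℤ.* (d ℤ.+ a))
      ≡ ℤ.+ 2 ℤ.* ((a ℤ.- c) ℤ.* (b ℤ.- d))
  parallelogram = solve-∀-ℤ

  cancel-cycle : ∀ A B C D a b c d →
    (A ℤ.- (a ℤ.+ b)) ℤ.- (B ℤ.- (b ℤ.+ c)) ℤ.+ ((C ℤ.- (c ℤ.+ d)) ℤ.- (D ℤ.- (d ℤ.+ a))) ≡ A ℤ.- B ℤ.+ (C ℤ.- D)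
  cancel-cycle = solve-∀-ℤ

  cancel-common : ∀ S a b c → (S ℤ.- (b ℤ.+ c)) ℤ.- (S ℤ.- (a ℤ.+ b)) ≡ a ℤ.- c
  cancel-common = solve-∀-ℤ

  half-sum : ∀ h A B C X Y → X ℤ.- h ℤ.* (A ℤ.+ B ℤ.- C) ℤ.+ (Y ℤ.- h ℤ.* (A ℤ.+ C ℤ.- B)) ℤ.+ A ℤ.* (ℤ.+ 2 ℤ.* h ℤ.- 1ℤ)
    ≡ X ℤ.+ Y ℤ.- A
  half-sum = solve-∀-ℤ

-- Two distinct vertices u, v of F × F are adjacent when u + v lies on the parabola {(t , t²)}.
module SumGraph (p : ℕ) (pp : Prime p) (h : ℕ) (p≡ : p ≡ suc (h + h)) (5≤p : 5 ≤ p) where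

  open Mod p
  open Matching p pp using (≈⇒≡)

  instance
    p≢0 : NonZero p
    p≢0 = prime⇒nonZero pp

  V : Set
  V = Fin (p * p)

  x₁ x₂ : V → ℤ
  x₁ u = ℤ.+ toℕ (proj₁ (Fin.remQuot {p} p u))
  x₂ u = ℤ.+ toℕ (proj₂ (Fin.remQuot {p} p u))

  square : ℤ → ℤ
  square a = a ℤ.* a

  onParabola? : ∀ u v → Dec (ℤ.+ p ℤ.∣ square (x₁ u ℤ.+ x₁ v) ℤ.- (x₂ u ℤ.+ x₂ v))
  onParabola? u v = (ℤ.+ p) ℤ.∣? (square (x₁ u ℤ.+ x₁ v) ℤ.- (x₂ u ℤ.+ x₂ v))

  sumAdj : V → V → Bool
  sumAdj u v = not ⌊ u Fin.≟ v ⌋ ∧ ⌊ onParabola? u v ⌋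

  ⌊⌋-cong : ∀ {P Q : Set} {P? : Dec P} {Q? : Dec Q} → (P → Q) → (Q → P) → ⌊ P? ⌋ ≡ ⌊ Q? ⌋
  ⌊⌋-cong {P? = yes _} {yes _} _ _ = refl
  ⌊⌋-cong {P? = no _} {no _} _ _ = refl
  ⌊⌋-cong {P? = yes p} {no ¬q} f _ = ⊥-elim (¬q (f p))
  ⌊⌋-cong {P? = no ¬p} {yes q} _ g = ⊥-elim (¬p (g q))

  onParabola-sym : ∀ {u v} → ℤ.+ p ℤ.∣ square (x₁ u ℤ.+ x₁ v) ℤ.- (x₂ u ℤ.+ x₂ v) →
    ℤ.+ p ℤ.∣ square (x₁ v ℤ.+ x₁ u) ℤ.- (x₂ v ℤ.+ x₂ u)
  onParabola-sym {u} {v} = subst (ℤ.+ p ℤ.∣_) (cong₂ (λ a b → square a ℤ.- b) (ℤ.+-comm (x₁ u) (x₁ v)) (ℤ.+-comm (x₂ u) (x₂ v)))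

  G : Graph (p * p)
  G = record
    { adj = sumAdj
    ; sym = λ u v → cong₂ (λ a b → not a ∧ b)
        (⌊⌋-cong {P? = u Fin.≟ v} {v Fin.≟ u} ≡-sym ≡-sym)
        (⌊⌋-cong {P? = onParabola? u v} {onParabola? v u} (onParabola-sym {u} {v}) (onParabola-sym {v} {u}))
    ; irrefl = λ u → cong (λ b → not b ∧ ⌊ onParabola? u u ⌋) (true-⌊⌋ {P? = u Fin.≟ u} refl) }

  edge⇒ : ∀ {u v} → Edge G u v → ℤ.+ p ℤ.∣ square (x₁ u ℤ.+ x₁ v) ℤ.- (x₂ u ℤ.+ x₂ v)
  edge⇒ {u} {v} e = ⌊⌋-true {P? = onParabola? u v} (proj₂ (∧-true {not ⌊ u Fin.≟ v ⌋} e))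

  edge⇐ : ∀ {u v} → u ≢ v → ℤ.+ p ℤ.∣ square (x₁ u ℤ.+ x₁ v) ℤ.- (x₂ u ℤ.+ x₂ v) → Edge G u v
  edge⇐ {u} {v} u≢v on = ∧-intro (cong not (not-true⇒false (u≢v ∘ ⌊⌋-true {P? = u Fin.≟ v})))
    (true-⌊⌋ {P? = onParabola? u v} on)

  coordinates-injective : ∀ {u v} → x₁ u ≈ x₁ v → x₂ u ≈ x₂ v → u ≡ v
  coordinates-injective {u} {v} e₁ e₂ = trans (≡-sym (Fin.combine-remQuot {p} p u)) (trans
    (cong₂ Fin.combine (toℕ-injective (≈⇒≡ (toℕ<n _) (toℕ<n _) e₁)) (toℕ-injective (≈⇒≡ (toℕ<n _) (toℕ<n _) e₂)))
    (Fin.combine-remQuot {p} p v))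

  x₁-injective : ∀ {u v} → x₁ u ≈ x₁ v → x₁ u ≡ x₁ v
  x₁-injective e = cong ℤ.+_ (≈⇒≡ (toℕ<n _) (toℕ<n _) e)

  same-neighbour : ∀ {u w v} → Edge G u v → Edge G v w → x₁ u ≈ x₁ w → u ≡ w
  same-neighbour {u} {w} {v} uv vw e₁ = coordinates-injective e₁ (≈-from
    (cancel-common (square (x₁ v ℤ.+ x₁ w)) (x₂ u) (x₂ v) (x₂ w))
    (ℤ.∣m∣n⇒∣m-n (edge⇒ vw) (subst (λ a → ℤ.+ p ℤ.∣ square a ℤ.- (x₂ u ℤ.+ x₂ v)) same (edge⇒ uv))))
    where
    same : x₁ u ℤ.+ x₁ v ≡ x₁ v ℤ.+ x₁ w
    same = trans (ℤ.+-comm (x₁ u) (x₁ v)) (cong (λ a → x₁ v ℤ.+ a) (x₁-injective e₁))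

  -- By `parallelogram`, p divides twice the product of the differences of opposite first
  -- coordinates. As p ≥ 5, one difference vanishes, and two neighbours of one vertex with the same
  -- first coordinate are equal.
  square-free : ∀ {a b c d} → Edge G a b → Edge G b c → Edge G c d → Edge G d a → a ≢ c → b ≢ d → ⊥
  square-free {a} {b} {c} {d} ab bc cd da a≢c b≢d
    with ∣*⇒∣⊎∣ pp (ℤ.+ 2) ((x₁ a ℤ.- x₁ c) ℤ.* (x₁ b ℤ.- x₁ d)) (subst (ℤ.+ p ℤ.∣_) (parallelogram (x₁ a) (x₁ b) (x₁ c) (x₁ d))
      (subst (ℤ.+ p ℤ.∣_) (cancel-cycle (square (x₁ a ℤ.+ x₁ b)) (square (x₁ b ℤ.+ x₁ c)) (square (x₁ c ℤ.+ x₁ d)) (square (x₁ d ℤ.+ x₁ a)) (x₂ a) (x₂ b) (x₂ c) (x₂ d))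
        (ℤ.∣m∣n⇒∣m+n (ℤ.∣m∣n⇒∣m-n (edge⇒ ab) (edge⇒ bc)) (ℤ.∣m∣n⇒∣m-n (edge⇒ cd) (edge⇒ da)))))
  ... | inj₁ p∣2 = <⇒≱ 5≤p (≤-trans (∣⇒≤ (ℤ.∣⇒∣ᵤ p∣2)) (s≤s (s≤s z≤n)))
  ... | inj₂ p∣ with ∣*⇒∣⊎∣ pp (x₁ a ℤ.- x₁ c) (x₁ b ℤ.- x₁ d) p∣
  ...   | inj₁ a≈c = a≢c (same-neighbour ab bc (mk≈ a≈c))
  ...   | inj₂ b≈d = b≢d (same-neighbour bc cd (mk≈ b≈d))

  C₄-free : ¬ HasCycle G 4
  C₄-free (f , inj , edges) = square-free
    (edges zero (suc zero) (inj₁ refl)) (edges (suc zero) (suc (suc zero)) (inj₁ refl))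
    (edges (suc (suc zero)) (suc (suc (suc zero))) (inj₁ refl)) (edges (suc (suc (suc zero))) zero (inj₂ (refl , refl)))
    (λ eq → case inj eq of λ ()) (λ eq → case inj eq of λ ())

  half : ℤ
  half = ℤ.+ suc h

  p∣2half-1 : ℤ.+ p ℤ.∣ ℤ.+ 2 ℤ.* half ℤ.- 1ℤ
  p∣2half-1 = ℤ.∣-reflexive (≡-sym (trans (cong (λ x → x ℤ.- 1ℤ) (≡-sym (ℤ.pos-* 2 (suc h)))) (cong ℤ.+_ (trans (twice h) (≡-sym p≡)))))
    where
    twice : ∀ h → h + suc (h + 0) ≡ suc (h + h)
    twice = solve-∀

  -- The second coordinate over x when the three edge equations for first coordinates x, y, z are
  -- solved as a linear system; `half` is the inverse of 2 modulo p. So any three distinct first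
  -- coordinates carry a triangle.
  third : Fin p → Fin p → Fin p → ℤ
  third x y z = half ℤ.* (square (X ℤ.+ Y) ℤ.+ square (X ℤ.+ Z) ℤ.- square (Y ℤ.+ Z))
    where
    X = ℤ.+ toℕ x
    Y = ℤ.+ toℕ y
    Z = ℤ.+ toℕ z

  reduce : ℤ → Fin p
  reduce a = fromℕ< (ℤ.n%ℕd<d a p)

  reduce-≈ : ∀ a → ℤ.+ p ℤ.∣ ℤ.+ toℕ (reduce a) ℤ.- a
  reduce-≈ a = subst (ℤ.+ p ℤ.∣_) (neg-sub a (ℤ.+ toℕ (reduce a)))
    (ℤ.∣m⇒∣-m (subst (ℤ.+ p ℤ.∣_) (≡-sym difference) (ℤ.∣n⇒∣m*n (a ℤ./ℕ p) ℤ.∣-refl)))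
    where
    difference : a ℤ.- ℤ.+ toℕ (reduce a) ≡ (a ℤ./ℕ p) ℤ.* ℤ.+ p
    difference = trans (cong (λ r → a ℤ.- ℤ.+ r) (toℕ-fromℕ< (ℤ.n%ℕd<d a p)))
      (sub-add-cancel a (ℤ.+ (a ℤ.%ℕ p)) _ (ℤ.a≡a%ℕn+[a/ℕn]*n a p))

  vertex : Fin p → Fin p → Fin p → V
  vertex x y z = Fin.combine x (reduce (third x y z))

  x₁-combine : ∀ x y → x₁ (Fin.combine x y) ≡ ℤ.+ toℕ x
  x₁-combine x y = cong (λ w → ℤ.+ toℕ (proj₁ w)) (Fin.remQuot-combine x y)

  x₂-combine : ∀ x y → x₂ (Fin.combine {p} x y) ≡ ℤ.+ toℕ y
  x₂-combine x y = cong (λ w → ℤ.+ toℕ (proj₂ w)) (Fin.remQuot-combine {p} x y)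

  vertex-edge : ∀ {x y} z → x ≢ y → ∀ {α β} → ℤ.+ p ℤ.∣ ℤ.+ toℕ α ℤ.- third x y z → ℤ.+ p ℤ.∣ ℤ.+ toℕ β ℤ.- third y x z →
    Edge G (Fin.combine x α) (Fin.combine y β)
  vertex-edge {x} {y} z x≢y {α} {β} α≈ β≈ = edge⇐ (λ eq → x≢y (Fin.combine-injectiveˡ x α y β eq))
    (subst (ℤ.+ p ℤ.∣_) (cong₂ (λ s t → square s ℤ.- t)
        (≡-sym (cong₂ ℤ._+_ (x₁-combine x α) (x₁-combine y β)))
        (≡-sym (cong₂ ℤ._+_ (x₂-combine x α) (x₂-combine y β))))
      (subst (ℤ.+ p ℤ.∣_) (neg-sub (ℤ.+ toℕ α ℤ.+ ℤ.+ toℕ β) (square (X ℤ.+ Y)))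
        (ℤ.∣m⇒∣-m (subst (ℤ.+ p ℤ.∣_)
          (half-sum half (square (X ℤ.+ Y)) (square (X ℤ.+ Z)) (square (Y ℤ.+ Z)) (ℤ.+ toℕ α) (ℤ.+ toℕ β))
        (ℤ.∣m∣n⇒∣m+n (ℤ.∣m∣n⇒∣m+n α≈ (subst (λ s → ℤ.+ p ℤ.∣ ℤ.+ toℕ β ℤ.- half ℤ.* (square s ℤ.+ square (Y ℤ.+ Z) ℤ.- square (X ℤ.+ Z)))
            (ℤ.+-comm Y X) β≈))
          (ℤ.∣n⇒∣m*n (square (X ℤ.+ Y)) p∣2half-1))))))
    where
    X = ℤ.+ toℕ x
    Y = ℤ.+ toℕ y
    Z = ℤ.+ toℕ z

  third-swap : ∀ x y z → third x y z ≡ third x z y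
  third-swap x y z = cong (λ s → half ℤ.* s) (cong₂ ℤ._-_
    (ℤ.+-comm (square (X ℤ.+ Y)) (square (X ℤ.+ Z))) (cong square (ℤ.+-comm Y Z)))
    where
    X = ℤ.+ toℕ x
    Y = ℤ.+ toℕ y
    Z = ℤ.+ toℕ z

  triangle-≥ : ∀ x y z → 1 ≤ orderedTriangle G (vertex x y z) (vertex y x z) (vertex z x y) + (eqBit x y + (eqBit y z + eqBit x z))
  triangle-≥ x y z with y Fin.≟ x | z Fin.≟ y | z Fin.≟ x
  ... | yes refl | _ | _ = m≤n⇒m≤o+n (orderedTriangle G (vertex x y z) (vertex y x z) (vertex z x y)) (s≤s z≤n)
  ... | no _ | yes refl | _ = m≤n⇒m≤o+n (orderedTriangle G (vertex x y z) (vertex y x z) (vertex z x y)) (s≤s z≤n)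
  ... | no _ | no _ | yes refl = m≤n⇒m≤o+n (orderedTriangle G (vertex x y z) (vertex y x z) (vertex z x y)) (s≤s z≤n)
  ... | no y≢x | no z≢y | no z≢x = ≤-trans (≤-reflexive (≡-sym (orderedTriangle-true G {vertex x y z} {vertex y x z} {vertex z x y}
    (vertex-edge z (y≢x ∘ ≡-sym) (reduce-≈ (third x y z)) (reduce-≈ (third y x z)))
    (vertex-edge x (z≢y ∘ ≡-sym) (swapped y x z) (swapped z x y))
    (vertex-edge y (z≢x ∘ ≡-sym) (swapped x y z) (reduce-≈ (third z x y)))))) (m≤m+n _ 0)
    where
    swapped : ∀ x y z → ℤ.+ p ℤ.∣ ℤ.+ toℕ (reduce (third x y z)) ℤ.- third x z y
    swapped x y z = subst (λ t → ℤ.+ p ℤ.∣ ℤ.+ toℕ (reduce (third x y z)) ℤ.- t) (third-swap x y z) (reduce-≈ (third x y z))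

  T₀ : ℕ
  T₀ = ΣFin p λ x → ΣFin p λ y → ΣFin p λ z → orderedTriangle G (vertex x y z) (vertex y x z) (vertex z x y)

  p³≤T₀+3p² : p * (p * p) ≤ T₀ + 3 * (p * p)
  p³≤T₀+3p² = begin
    p * (p * p)
      ≡⟨ trans (ΣFin-cong p λ x → trans (ΣFin-cong p λ y → trans (ΣFin-const p 1) (*-identityʳ p)) (ΣFin-const p p)) (ΣFin-const p (p * p)) ⟨
    Σ³ (λ _ _ _ → 1)
      ≤⟨ ΣFin-mono p (λ x → ΣFin-mono p λ y → ΣFin-mono p λ z → triangle-≥ x y z) ⟩
    Σ³ (λ x y z → orderedTriangle G (vertex x y z) (vertex y x z) (vertex z x y) + (eqBit x y + (eqBit y z + eqBit x z)))
      ≡⟨ trans (Σ³-+ _ _) (cong (T₀ +_) (trans (Σ³-+ _ _) (cong (Σ³ (λ x y _ → eqBit x y) +_) (Σ³-+ _ _)))) ⟩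
    T₀ + (Σ³ (λ x y _ → eqBit x y) + (Σ³ (λ _ y z → eqBit y z) + Σ³ (λ x _ z → eqBit x z)))
      ≤⟨ +-monoʳ-≤ T₀ (+-mono-≤ xy (+-mono-≤ yz (≤-trans xz (m≤m+n _ 0)))) ⟩
    T₀ + 3 * (p * p) ∎
    where
    open ≤-Reasoning
    Σ³ : (Fin p → Fin p → Fin p → ℕ) → ℕ
    Σ³ f = ΣFin p λ x → ΣFin p λ y → ΣFin p λ z → f x y z
    Σ³-+ : ∀ f g → Σ³ (λ u v w → f u v w + g u v w) ≡ Σ³ f + Σ³ g
    Σ³-+ f g = trans (ΣFin-cong p λ u → trans (ΣFin-cong p λ v → ΣFin-+ p (f u v) (g u v))
      (ΣFin-+ p (λ v → ΣFin p (f u v)) (λ v → ΣFin p (g u v)))) (ΣFin-+ p _ _)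
    yz : Σ³ (λ _ y z → eqBit y z) ≤ p * p
    yz = ΣFin-≤-const p p λ _ → ≤-trans (ΣFin-≤-const p 1 λ y → ΣFin-eqBit-≤ y) (≤-reflexive (*-identityʳ p))
    xz : Σ³ (λ x _ z → eqBit x z) ≤ p * p
    xz = ΣFin-≤-const p p λ x → ≤-trans (ΣFin-≤-const p 1 λ _ → ΣFin-eqBit-≤ x) (≤-reflexive (*-identityʳ p))
    xy : Σ³ (λ x y _ → eqBit x y) ≤ p * p
    xy = ΣFin-≤-const p p λ x → ≤-trans (≤-reflexive (trans (ΣFin-cong p λ y → ΣFin-const p (eqBit x y)) (ΣFin-*ˡ p p (eqBit x))))
      (≤-trans (*-monoʳ-≤ p (ΣFin-eqBit-≤ x)) (≤-reflexive (*-identityʳ p)))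

  -- As p ≥ 5, the at most 3p² degenerate triples are at most three fifths of all p³, so `T₀` is at
  -- least two fifths of p³; the factor 6 again accounts for orderings.
  p³≤30t : p * (p * p) ≤ 30 * triangleCount G
  p³≤30t = *-cancelˡ-≤ 2 (+-cancelʳ-≤ (3 * P) (2 * P) (2 * (30 * triangleCount G)) (begin
    2 * P + 3 * P                          ≡⟨ *-distribʳ-+ P 2 3 ⟨
    5 * P                                  ≤⟨ *-monoʳ-≤ 5 p³≤T₀+3p² ⟩
    5 * (T₀ + 3 * (p * p))                 ≡⟨ identity T₀ (p * p) ⟩
    5 * T₀ + 3 * (5 * (p * p))             ≤⟨ +-mono-≤ (*-monoʳ-≤ 5 T₀≤) (*-monoʳ-≤ 3 (*-monoˡ-≤ (p * p) 5≤p)) ⟩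
    5 * (6 * triangleCount G) + 3 * P      ≡⟨ cong (_+ 3 * P) (*-assoc 5 6 (triangleCount G)) ⟨
    30 * triangleCount G + 3 * P           ≤⟨ +-monoˡ-≤ (3 * P) (m≤m+n (30 * triangleCount G) _) ⟩
    2 * (30 * triangleCount G) + 3 * P     ∎))
    where
    open ≤-Reasoning
    P = p * (p * p)
    identity : ∀ t q → 5 * (t + 3 * q) ≡ 5 * t + 3 * (5 * q)
    identity = solve-∀
    T₀≤ : T₀ ≤ 6 * triangleCount G
    T₀≤ = ≤-trans (ΣFin³-fibre p p (orderedTriangle G) (λ x y z → reduce (third x y z))
      (λ x y z → reduce (third y x z)) (λ x y z → reduce (third z x y))) (orderedTriangleCount-≤ G)

-- Assembling the bounds

odd-prime : ∀ {p} → Prime p → 5 ≤ p → ∃[ h ] (p ≡ suc (h + h))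
odd-prime {p} pp 5≤p with p % 2 in r | m%n<n p 2 | m≡m%n+[m/n]*n p 2
... | zero | _ | p≡ with prime⇒irreducible pp (divides (p / 2) p≡)
...   | inj₂ refl = ⊥-elim (<⇒≱ 5≤p (s≤s (s≤s z≤n)))
odd-prime {p} pp 5≤p | suc zero | _ | p≡ = p / 2 , trans p≡ (cong suc (≡-sym (double (p / 2))))
odd-prime {p} pp 5≤p | suc (suc _) | s≤s (s≤s ()) | _

m*m≤n*n⇒m≤n : ∀ {m n} → m * m ≤ n * n → m ≤ n
m*m≤n*n⇒m≤n mm≤nn = ≮⇒≥ λ n<m → <⇒≱ (*-mono-< n<m n<m) mm≤nn

-- With q = cp, e² ≤ 2n³ ≤ 54q⁶, and 54 is rounded up to 64 to obtain the integer bound e ≤ 8q³.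
cubic-bound : ∀ c p {e n M} → n ≤ 3 * (c * p) ^ 2 → e * e ≤ 2 * (n * n * n) → p * (p * p) ≤ 30 * M →
  e ≤ 8 * (c * c * c) * 30 * M
cubic-bound c p {e} {n} {M} n≤ ee≤ ppp≤ = begin
  e                              ≤⟨ m*m≤n*n⇒m≤n ee≤64q⁶ ⟩
  8 * (q * q * q)                ≡⟨ identity₂ c p ⟩
  8 * (c * c * c) * (p * (p * p)) ≤⟨ *-monoʳ-≤ (8 * (c * c * c)) ppp≤ ⟩
  8 * (c * c * c) * (30 * M)     ≡⟨ *-assoc (8 * (c * c * c)) 30 M ⟨
  8 * (c * c * c) * 30 * M       ∎
  where
  open ≤-Reasoning
  q = c * p
  identity₁ : ∀ q → 2 * (3 * (q * (q * 1)) * (3 * (q * (q * 1))) * (3 * (q * (q * 1)))) + 10 * ((q * q * q) * (q * q * q))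
    ≡ 8 * (q * q * q) * (8 * (q * q * q))
  identity₁ = solve-∀
  identity₂ : ∀ c p → 8 * (c * p * (c * p) * (c * p)) ≡ 8 * (c * c * c) * (p * (p * p))
  identity₂ = solve-∀
  ee≤64q⁶ : e * e ≤ 8 * (q * q * q) * (8 * (q * q * q))
  ee≤64q⁶ = ≤-trans ee≤ (≤-trans (*-monoʳ-≤ 2 (*-mono-≤ (*-mono-≤ n≤ n≤) n≤))
    (≤-trans (m≤m+n _ (10 * ((q * q * q) * (q * q * q)))) (≤-reflexive (identity₁ q))))

C₄-bound : ∀ c n a b → exEven 2 n a → exTri 4 n b →
  ∃[ p ] (Prime p × 5 ≤ p × 3 * p ^ 2 ≤ n × n ≤ 3 * (c * p) ^ 2) → a ≤ 8 * (c * c * c) * 30 * b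
C₄-bound c n a b ((G₀ , evenFree , refl) , _) maxb (p , pp , 5≤p , 3p²≤n , n≤) = cubic-bound c p n≤
  (edgeCount²-≤ G₀ (evenFree 2 ≤-refl ≤-refl)) (≤-trans p³≤30t (*-monoʳ-≤ 30 t≤b))
  where
  open SumGraph p pp (proj₁ (odd-prime pp 5≤p)) (proj₂ (odd-prime pp 5≤p)) 5≤p
  p*p≤n : p * p ≤ n
  p*p≤n = ≤-trans (≤-reflexive (cong (p *_) (≡-sym (*-identityʳ p)))) (≤-trans (m≤n*m (p ^ 2) 3) 3p²≤n)
  t≤b : triangleCount G ≤ b
  t≤b = max-TriFree-≥ {l = 4} maxb p*p≤n (G , C₄-free , refl)

bigO-C₄ : BigO (exEven 2) (exTri 4)
bigO-C₄ = 8 * (32 * 32 * 32) * 30 , proj₁ primes ,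
  λ n N≤n a b Ea Tb → C₄-bound 32 n a b Ea Tb (proj₂ primes n N≤n)
  where
  primes = scaled-prime 2 (s≤s z≤n)

-- For k ≥ 3 the length 2k is at least 6, within reach of the doubled graph; for k = 2 it is 4, and
-- the sum graph takes over.
bigO-even : ∀ k → 2 ≤ k → BigO (exEven k) (exTri (2 * k))
bigO-even 2 _ = bigO-C₄
bigO-even k@(suc (suc (suc k′))) _ = bigO-exEven-exTri k (2 * k)
  (≤-trans (m≤m+n 5 (suc (2 * k′))) (≤-reflexive (identity k′))) (n≤1+n (2 * k))
  where
  identity : ∀ k → 5 + suc (2 * k) ≡ 2 * (3 + k)
  identity = solve-∀
bigO-even 1 (s≤s ())

bigO-odd : ∀ k → 2 ≤ k → BigO (exEven k) (exTri (2 * k + 1))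
bigO-odd k 2≤k = bigO-exEven-exTri k (2 * k + 1) (+-monoˡ-≤ 1 (*-monoʳ-≤ 2 2≤k)) (≤-reflexive (+-comm (2 * k) 1))

bigO-rainbow : ∀ k → 2 ≤ k → BigO (exTriRainbow (2 * k)) (exStar (2 * k))
bigO-rainbow k@(suc (suc k′)) _ = subst (λ m → BigO (exTriRainbow m) (exStar m)) (identity k′) (bigO-exStar (suc (2 * k′)))
  where
  identity : ∀ k → 3 + suc (2 * k) ≡ 2 * (2 + k)
  identity = solve-∀
bigO-rainbow 1 (s≤s ())

2∤1+even : ∀ {k} → 2 ∣ k → ¬ (2 ∣ k + 1)
2∤1+even 2∣k 2∣k+1 = case ∣1⇒≡1 (∣m+n∣m⇒∣n 2∣k+1 2∣k) of λ ()

theorem1p6 : (k : ℕ) → 2 ≤ k →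
    (¬ (2 ∣ k) → OmegaPow (exTriRainbow (2 * k)) k) ×
    (2 ∣ k → OmegaPow (exTriRainbow (2 * k + 1)) k) ×
    BigO (exTriRainbow (2 * k)) (exStar (2 * k)) ×
    GeqAll (exTriRainbow (2 * k)) (exTri (2 * k)) ×
    BigO (exEven k) (exTri (2 * k)) ×
    GeqAll (exTriRainbow (2 * k + 1)) (exTri (2 * k + 1)) ×
    BigO (exEven k) (exTri (2 * k + 1))
theorem1p6 k 2≤k =
  (λ 2∤k → subst (λ m → OmegaPow (exTriRainbow m) k) (+-identityʳ (2 * k))
    (omega-odd k 0<k 0 z≤n (2∤k ∘ subst (2 ∣_) (+-identityʳ k)))) ,
  (λ 2∣k → omega-odd k 0<k 1 ≤-refl (2∤1+even 2∣k)) ,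
  bigO-rainbow k 2≤k ,
  geqAll-exTri (2 * k) ,
  bigO-even k 2≤k ,
  geqAll-exTri (2 * k + 1) ,
  bigO-odd k 2≤k
  where
  0<k : 0 < k
  0<k = ≤-trans (s≤s z≤n) 2≤k
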